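{- Let $G^{\phi}$ be a $3$-regular optimum Hermitian energy mixed graph whose underlying graph $G$ is the hypercube $Q_3$. Then, up to isomorphism of mixed graphs and switching equivalence, $G^{\phi}$ is one of the seven mixed graphs $D_2,H_1,H_2,H_3,H_4,H_5,H_6$; that is, $G^\phi$ is isomorphic to a mixed graph that is switching equivalent to one of them. Here all seven have vertex set $\{v_1,\dots,v_8\}$ and underlying graph the cube with the $12$ edges $v_1v_2,v_3v_4,v_5v_6,v_7v_8,v_1v_3,v_2v_4,v_5v_7,v_6v_8,v_1v_5,v_2v_6,v_3v_7,v_4v_8$, and they are the following: $D_2$ (oriented graph): arcs $v_1\to v_2,\ v_4\to v_3,\ v_1\to v_3,\ v_2\to v_4,\ v_6\to v_5,\ v_7\to v_8,\ v_7\to v_5,\ v_8\to v_6,\ v_1\to v_5,\ v_2\to v_6,\ v_3\to v_7,\ v_4\to v_8$. $H_1$: undirected edges $v_1\leftrightarrow v_2,\ v_1\leftrightarrow v_3,\ v_1\leftrightarrow v_5$; arcs $v_3\to v_4,\ v_4\to v_2,\ v_2\to v_6,\ v_6\to v_5,\ v_5\to v_7,\ v_7\to v_3,\ v_4\to v_8,\ v_6\to v_8,\ v_7\to v_8$. $H_2$: undirected edges $v_1\leftrightarrow v_3,\ v_2\leftrightarrow v_4,\ v_5\leftrightarrow v_7,\ v_6\leftrightarrow v_8$; arcs $v_1\to v_2,\ v_2\to v_6,\ v_6\to v_5,\ v_1\to v_5,\ v_4\to v_3,\ v_8\to v_4,\ v_7\to v_8,\ v_7\to v_3$. $H_3$: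 undirected edges $v_1\leftrightarrow v_3,\ v_1\leftrightarrow v_2,\ v_5\leftrightarrow v_7,\ v_5\leftrightarrow v_6$; arcs $v_3\to v_4,\ v_4\to v_2,\ v_7\to v_8,\ v_8\to v_6,\ v_4\to v_8,\ v_6\to v_2,\ v_1\to v_5,\ v_7\to v_3$. $H_4$: undirected edges $v_1\leftrightarrow v_3,\ v_1\leftrightarrow v_2,\ v_3\leftrightarrow v_7,\ v_5\leftrightarrow v_6,\ v_7\leftrightarrow v_8$; arcs $v_3\to v_4,\ v_4\to v_2,\ v_4\to v_8,\ v_7\to v_5,\ v_5\to v_1,\ v_2\to v_6,\ v_6\to v_8$. $H_5$: undirected edges $v_1\leftrightarrow v_3,\ v_1\leftrightarrow v_2,\ v_3\leftrightarrow v_7,\ v_5\leftrightarrow v_6,\ v_6\leftrightarrow v_8,\ v_4\leftrightarrow v_8$; arcs $v_3\to v_4,\ v_4\to v_2,\ v_2\to v_6,\ v_5\to v_1,\ v_7\to v_5,\ v_8\to v_7$. $H_6$: undirected edges $v_1\leftrightarrow v_3,\ v_1\leftrightarrow v_2,\ v_1\leftrightarrow v_5,\ v_6\leftrightarrow v_8,\ v_4\leftrightarrow v_8,\ v_7\leftrightarrow v_8$; arcs $v_3\to v_4,\ v_4\to v_2,\ v_2\to v_6,\ v_6\to v_5,\ v_5\to v_7,\ v_7\to v_3$.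
   Context: A mixed graph $G^{\phi}$ is obtained from a finite simple undirected graph $G$ (its underlying graph) by choosing a subset $S\subseteq E(G)$ and giving each edge of $S$ an orientation. Oriented edges are arcs, written $u\to v$, and the edges not in $S$ remain undirected, written $u\leftrightarrow v$. If $S=E(G)$, $G^\phi$ is an oriented graph. Degree, regularity, order, etc. refer to the underlying graph. The Hermitian-adjacency matrix $H(G^\phi)=(h_{kl})$ has $h_{kl}=h_{lk}=1$ if $k\leftrightarrow l$, $h_{kl}=i$ and $h_{lk}=-i$ if $k\to l$, and $h_{kl}=0$ otherwise, where $i$ is the imaginary unit. The Hermitian energy $\mathcal{E}_H(G^\phi)$ is the sum of the absolute values of the eigenvalues of $H(G^\phi)$ (equivalently, the sum of its singular values). A mixed graph on $n$ vertices with maximum degree $\Delta$ is an optimum Hermitian energy mixed graph if $\mathcal{E}_H(G^\phi)=n\sqrt{\Delta}$. Two mixed graphs $G^{\phi_1},G^{\phi_2}$ with the same underlying graph and the same vertex set are switching equivalent if there is a diagonal matrix $D$ with all diagonal entries in $\{1,-1\}$ such that $H(G^{\phi_2})=D^{ -1}H(G^{\phi_1})D$. An isomorphism of mixed graphs is a bijection of vertex sets that preserves (in both directions) undirected edges and arcs with their directions. -}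

module Defs where

open import Algebra.Bundles.Raw using (RawRing)
import Algebra.Definitions.RawSemiring as RawSemiringDefinitions
open import Data.Bool.Base using (Bool; true; false; T; not; if_then_else_; _∧_; _∨_; _xor_)
open import Data.Bool.Properties using (∨-comm; xor-comm; ∨-zeroʳ)
import Data.Bool.Properties as Bool
open import Data.Fin.Base using (Fin; zero; suc; toℕ; punchIn)
open import Data.Fin.Patterns using (0F; 1F; 2F; 3F; 4F; 5F; 6F; 7F)
import Data.Fin.Properties as Fin
import Data.Fin.Subset as Subset
open import Data.Integer.Base using (+_)
open import Data.List.Base using (List; []; _∷_)
import Data.List.Base as List
open import Data.Nat.Base as ℕ using (ℕ; zero; suc; _≡ᵇ_; _⊔_)
import Data.Nat.Properties as ℕ
open import Data.Product.Base using (Σ-syntax; ∃-syntax; _×_; _,_; proj₁; proj₂)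
open import Data.Rational.Base as ℚ using (ℚ; 0ℚ; 1ℚ; ½)
import Data.Rational.Properties as ℚ
open import Data.Rational.Solver using (module +-*-Solver)
open import Data.Sum.Base using (_⊎_; inj₁; inj₂)
open import Data.Vec.Base as Vec using (Vec)
import Data.Vec.Properties as Vec
import Data.Vec.Functional as Vector
open import Function.Bundles using (_↔_; module Inverse)
open import Level using (0ℓ)
open import Relation.Binary.PropositionalEquality
  using (_≡_; refl; sym; trans; cong; cong₂; subst)
open import Relation.Nullary.Decidable using (Dec; does; True; toWitness; _×-dec_)
open import Relation.Nullary.Negation using (¬_)

-- A real number is a Cauchy sequence of rationals; equality `_≃ᴿ_` means that the
-- difference tends to 0.

Cauchy : (ℕ → ℚ) → Set
Cauchy x = ∀ ε → 0ℚ ℚ.< ε →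
  ∃[ N ] (∀ m n → N ℕ.≤ m → N ℕ.≤ n → ℚ.∣ x m ℚ.- x n ∣ ℚ.≤ ε)

record ℝ : Set where
  constructor mkℝ
  field
    seq    : ℕ → ℚ
    cauchy : Cauchy seq

open ℝ public

infix 4 _≃ᴿ_ _≤ᴿ_

_≃ᴿ_ : ℝ → ℝ → Set
x ≃ᴿ y = ∀ ε → 0ℚ ℚ.< ε →
  ∃[ N ] (∀ n → N ℕ.≤ n → ℚ.∣ seq x n ℚ.- seq y n ∣ ℚ.≤ ε)

_≤ᴿ_ : ℝ → ℝ → Set
x ≤ᴿ y = ∀ ε → 0ℚ ℚ.< ε →
  ∃[ N ] (∀ n → N ℕ.≤ n → seq x n ℚ.≤ seq y n ℚ.+ ε)

abstract

  private
    ½-pos : ∀ {ε} → 0ℚ ℚ.< ε → 0ℚ ℚ.< ½ ℚ.* ε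
    ½-pos {ε} p = ℚ.positive⁻¹ _ {{ℚ.pos*pos⇒pos ½ ε {{ℚ.positive p}}}}

    halves : ∀ ε → ½ ℚ.* ε ℚ.+ ½ ℚ.* ε ≡ ε
    halves ε = trans (sym (ℚ.*-distribʳ-+ ε ½ ½)) (ℚ.*-identityˡ ε)

    ∣a∣≤∣a-b∣+∣b∣ : ∀ a b → ℚ.∣ a ∣ ℚ.≤ ℚ.∣ a ℚ.- b ∣ ℚ.+ ℚ.∣ b ∣
    ∣a∣≤∣a-b∣+∣b∣ a b = subst (λ c → ℚ.∣ c ∣ ℚ.≤ ℚ.∣ a ℚ.- b ∣ ℚ.+ ℚ.∣ b ∣)
      (solve 2 (λ a b → (a :- b) :+ b := a) refl a b)
      (ℚ.∣p+q∣≤∣p∣+∣q∣ (a ℚ.- b) b)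
      where open +-*-Solver

    ∣a-b∣≡∣b-a∣ : ∀ a b → ℚ.∣ a ℚ.- b ∣ ≡ ℚ.∣ b ℚ.- a ∣
    ∣a-b∣≡∣b-a∣ a b = trans (sym (ℚ.∣-p∣≡∣p∣ (a ℚ.- b)))
      (cong ℚ.∣_∣ (solve 2 (λ a b → :- (a :- b) := b :- a) refl a b))
      where open +-*-Solver

    ∣a∣-∣b∣≤∣a-b∣ : ∀ a b → ℚ.∣ a ∣ ℚ.- ℚ.∣ b ∣ ℚ.≤ ℚ.∣ a ℚ.- b ∣
    ∣a∣-∣b∣≤∣a-b∣ a b = subst (ℚ.∣ a ∣ ℚ.- ℚ.∣ b ∣ ℚ.≤_)
      (solve 2 (λ c d → (c :+ d) :- d := c) refl ℚ.∣ a ℚ.- b ∣ ℚ.∣ b ∣)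
      (ℚ.+-monoˡ-≤ (ℚ.- ℚ.∣ b ∣) (∣a∣≤∣a-b∣+∣b∣ a b))
      where open +-*-Solver

    ∣∣a∣-∣b∣∣≤∣a-b∣ : ∀ a b → ℚ.∣ ℚ.∣ a ∣ ℚ.- ℚ.∣ b ∣ ∣ ℚ.≤ ℚ.∣ a ℚ.- b ∣
    ∣∣a∣-∣b∣∣≤∣a-b∣ a b with ℚ.∣p∣≡p∨∣p∣≡-p (ℚ.∣ a ∣ ℚ.- ℚ.∣ b ∣)
    ... | inj₁ eq = subst (ℚ._≤ ℚ.∣ a ℚ.- b ∣) (sym eq) (∣a∣-∣b∣≤∣a-b∣ a b)
    ... | inj₂ eq = subst (ℚ._≤ ℚ.∣ a ℚ.- b ∣)
      (sym (trans eq (solve 2 (λ c d → :- (c :- d) := d :- c) refl ℚ.∣ a ∣ ℚ.∣ b ∣)))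
      (subst (ℚ.∣ b ∣ ℚ.- ℚ.∣ a ∣ ℚ.≤_) (∣a-b∣≡∣b-a∣ b a) (∣a∣-∣b∣≤∣a-b∣ b a))
      where open +-*-Solver

  const-cauchy : ∀ q → Cauchy (λ _ → q)
  const-cauchy q ε 0<ε = 0 , λ _ _ _ _ →
    subst (ℚ._≤ ε) (sym (cong ℚ.∣_∣ (ℚ.+-inverseʳ q))) (ℚ.<⇒≤ 0<ε)

  neg-cauchy : ∀ x → Cauchy x → Cauchy (λ n → ℚ.- x n)
  neg-cauchy x cx ε 0<ε with cx ε 0<ε
  ... | N , h = N , λ m n N≤m N≤n → subst (ℚ._≤ ε) (eq (x m) (x n)) (h m n N≤m N≤n)
    where
    open +-*-Solver
    eq : ∀ a b → ℚ.∣ a ℚ.- b ∣ ≡ ℚ.∣ (ℚ.- a) ℚ.- (ℚ.- b) ∣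
    eq a b = trans (∣a-b∣≡∣b-a∣ a b)
      (cong ℚ.∣_∣ (solve 2 (λ a b → b :- a := (:- a) :- (:- b)) refl a b))

  abs-cauchy : ∀ x → Cauchy x → Cauchy (λ n → ℚ.∣ x n ∣)
  abs-cauchy x cx ε 0<ε with cx ε 0<ε
  ... | N , h = N , λ m n N≤m N≤n →
    ℚ.≤-trans (∣∣a∣-∣b∣∣≤∣a-b∣ (x m) (x n)) (h m n N≤m N≤n)

  +-cauchy : ∀ x y → Cauchy x → Cauchy y → Cauchy (λ n → x n ℚ.+ y n)
  +-cauchy x y cx cy ε 0<ε
    with cx (½ ℚ.* ε) (½-pos 0<ε) | cy (½ ℚ.* ε) (½-pos 0<ε)
  ... | M , f | N , g = M ℕ.⊔ N , λ m n p q → let open ℚ.≤-Reasoning in begin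
    ℚ.∣ (x m ℚ.+ y m) ℚ.- (x n ℚ.+ y n) ∣
      ≡⟨ cong ℚ.∣_∣ (solve 4 (λ a b c d → (a :+ b) :- (c :+ d) := (a :- c) :+ (b :- d))
                       refl (x m) (y m) (x n) (y n)) ⟩
    ℚ.∣ (x m ℚ.- x n) ℚ.+ (y m ℚ.- y n) ∣
      ≤⟨ ℚ.∣p+q∣≤∣p∣+∣q∣ (x m ℚ.- x n) (y m ℚ.- y n) ⟩
    ℚ.∣ x m ℚ.- x n ∣ ℚ.+ ℚ.∣ y m ℚ.- y n ∣
      ≤⟨ ℚ.+-mono-≤ (f m n (ℕ.m⊔n≤o⇒m≤o M N p) (ℕ.m⊔n≤o⇒m≤o M N q))
                    (g m n (ℕ.m⊔n≤o⇒n≤o M N p) (ℕ.m⊔n≤o⇒n≤o M N q)) ⟩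
    ½ ℚ.* ε ℚ.+ ½ ℚ.* ε
      ≡⟨ halves ε ⟩
    ε ∎
    where open +-*-Solver

  eventually-bounded : ∀ x → Cauchy x →
    ∃[ B ] (0ℚ ℚ.< B × ∃[ N ] (∀ n → N ℕ.≤ n → ℚ.∣ x n ∣ ℚ.≤ B))
  eventually-bounded x cx with cx 1ℚ (ℚ.positive⁻¹ 1ℚ)
  ... | N , h = 1ℚ ℚ.+ ℚ.∣ x N ∣
      , ℚ.+-mono-<-≤ (ℚ.positive⁻¹ 1ℚ) (ℚ.0≤∣p∣ (x N))
      , N , λ n N≤n → ℚ.≤-trans (∣a∣≤∣a-b∣+∣b∣ (x n) (x N))
                        (ℚ.+-monoˡ-≤ ℚ.∣ x N ∣ (h n N N≤n ℕ.≤-refl))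

  private
    product-≤ : ∀ u v {U V} → 0ℚ ℚ.≤ U → ℚ.∣ u ∣ ℚ.≤ U → ℚ.∣ v ∣ ℚ.≤ V →
                ℚ.∣ u ℚ.* v ∣ ℚ.≤ U ℚ.* V
    product-≤ u v {U} {V} 0≤U u≤U v≤V = subst (ℚ._≤ U ℚ.* V) (sym (ℚ.∣p*q∣≡∣p∣*∣q∣ u v))
      (ℚ.≤-trans
        (ℚ.*-monoʳ-≤-nonNeg ℚ.∣ v ∣ {{ℚ.nonNegative (ℚ.0≤∣p∣ v)}} u≤U)
        (ℚ.*-monoˡ-≤-nonNeg U {{ℚ.nonNegative 0≤U}} v≤V))

    ∣ab-cd∣≤ : ∀ a b c d {A B δ} → 0ℚ ℚ.≤ A → 0ℚ ℚ.≤ B → ℚ.∣ a ∣ ℚ.≤ A → ℚ.∣ d ∣ ℚ.≤ B →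
               ℚ.∣ b ℚ.- d ∣ ℚ.≤ δ → ℚ.∣ a ℚ.- c ∣ ℚ.≤ δ →
               ℚ.∣ a ℚ.* b ℚ.- c ℚ.* d ∣ ℚ.≤ (A ℚ.+ B) ℚ.* δ
    ∣ab-cd∣≤ a b c d {A} {B} {δ} 0≤A 0≤B a≤A d≤B bd ac = begin
      ℚ.∣ a ℚ.* b ℚ.- c ℚ.* d ∣
        ≡⟨ cong ℚ.∣_∣ (solve 4 (λ a b c d → a :* b :- c :* d := a :* (b :- d) :+ d :* (a :- c))
                         refl a b c d) ⟩
      ℚ.∣ a ℚ.* (b ℚ.- d) ℚ.+ d ℚ.* (a ℚ.- c) ∣
        ≤⟨ ℚ.∣p+q∣≤∣p∣+∣q∣ (a ℚ.* (b ℚ.- d)) (d ℚ.* (a ℚ.- c)) ⟩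
      ℚ.∣ a ℚ.* (b ℚ.- d) ∣ ℚ.+ ℚ.∣ d ℚ.* (a ℚ.- c) ∣
        ≤⟨ ℚ.+-mono-≤ (product-≤ a (b ℚ.- d) 0≤A a≤A bd) (product-≤ d (a ℚ.- c) 0≤B d≤B ac) ⟩
      A ℚ.* δ ℚ.+ B ℚ.* δ
        ≡⟨ sym (ℚ.*-distribʳ-+ δ A B) ⟩
      (A ℚ.+ B) ℚ.* δ ∎
      where
      open +-*-Solver
      open ℚ.≤-Reasoning

    scale : ∀ C ε → 0ℚ ℚ.< C → 0ℚ ℚ.< ε → ∃[ δ ] (0ℚ ℚ.< δ × C ℚ.* δ ≡ ε)
    scale C ε 0<C 0<ε = C⁻¹ ℚ.* ε
      , ℚ.positive⁻¹ _ {{ℚ.pos*pos⇒pos C⁻¹ {{ℚ.1/pos⇒pos C {{C⁺}}}} ε {{ℚ.positive 0<ε}}}}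
      , trans (sym (ℚ.*-assoc C C⁻¹ ε))
          (trans (cong (ℚ._* ε) (ℚ.*-inverseʳ C {{C≠0}})) (ℚ.*-identityˡ ε))
      where
      C⁺ : ℚ.Positive C
      C⁺ = ℚ.positive 0<C
      C≠0 : ℚ.NonZero C
      C≠0 = ℚ.pos⇒nonZero C {{C⁺}}
      C⁻¹ : ℚ
      C⁻¹ = ℚ.1/_ C {{C≠0}}

  *-cauchy : ∀ x y → Cauchy x → Cauchy y → Cauchy (λ n → x n ℚ.* y n)
  *-cauchy x y cx cy ε 0<ε =
    let A , 0<A , K , a = eventually-bounded x cx
        B , 0<B , L , b = eventually-bounded y cy
        δ , 0<δ , eq    = scale (A ℚ.+ B) ε (ℚ.+-mono-< 0<A 0<B) 0<ε
        M , f           = cx δ 0<δ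
        N , g           = cy δ 0<δ
    in (K ℕ.⊔ L) ℕ.⊔ (M ℕ.⊔ N) , λ m n p q →
      let KL≤m = ℕ.m⊔n≤o⇒m≤o (K ℕ.⊔ L) (M ℕ.⊔ N) p
          KL≤n = ℕ.m⊔n≤o⇒m≤o (K ℕ.⊔ L) (M ℕ.⊔ N) q
          MN≤m = ℕ.m⊔n≤o⇒n≤o (K ℕ.⊔ L) (M ℕ.⊔ N) p
          MN≤n = ℕ.m⊔n≤o⇒n≤o (K ℕ.⊔ L) (M ℕ.⊔ N) q
      in subst (ℚ.∣ x m ℚ.* y m ℚ.- x n ℚ.* y n ∣ ℚ.≤_) eq
        (∣ab-cd∣≤ (x m) (y m) (x n) (y n) (ℚ.<⇒≤ 0<A) (ℚ.<⇒≤ 0<B)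
          (a m (ℕ.m⊔n≤o⇒m≤o K L KL≤m))
          (b n (ℕ.m⊔n≤o⇒n≤o K L KL≤n))
          (g m n (ℕ.m⊔n≤o⇒n≤o M N MN≤m) (ℕ.m⊔n≤o⇒n≤o M N MN≤n))
          (f m n (ℕ.m⊔n≤o⇒m≤o M N MN≤m) (ℕ.m⊔n≤o⇒m≤o M N MN≤n)))

infixl 6 _+ᴿ_
infixl 7 _*ᴿ_
infix  8 -ᴿ_

fromℚ : ℚ → ℝ
fromℚ q = mkℝ (λ _ → q) (const-cauchy q)

fromℕ : ℕ → ℝ
fromℕ n = fromℚ (+ n ℚ./ 1)

_+ᴿ_ : ℝ → ℝ → ℝ
mkℝ x cx +ᴿ mkℝ y cy = mkℝ (λ n → x n ℚ.+ y n) (+-cauchy x y cx cy)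

_*ᴿ_ : ℝ → ℝ → ℝ
mkℝ x cx *ᴿ mkℝ y cy = mkℝ (λ n → x n ℚ.* y n) (*-cauchy x y cx cy)

-ᴿ_ : ℝ → ℝ
-ᴿ mkℝ x cx = mkℝ (λ n → ℚ.- x n) (neg-cauchy x cx)

∣_∣ᴿ : ℝ → ℝ
∣ mkℝ x cx ∣ᴿ = mkℝ (λ n → ℚ.∣ x n ∣) (abs-cauchy x cx)

ℝ-rawRing : RawRing 0ℓ 0ℓ
ℝ-rawRing = record
  { Carrier = ℝ ; _≈_ = _≃ᴿ_ ; _+_ = _+ᴿ_ ; _*_ = _*ᴿ_ ; -_ = -ᴿ_
  ; 0# = fromℚ 0ℚ ; 1# = fromℚ 1ℚ }

IsSquareRoot : ℝ → ℝ → Set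
IsSquareRoot r x = fromℚ 0ℚ ≤ᴿ r × r *ᴿ r ≃ᴿ x

record ℂ : Set where
  constructor _+_i
  field
    re im : ℝ

open ℂ public

fromℝ : ℝ → ℂ
fromℝ x = x + fromℚ 0ℚ i

𝕚 : ℂ
𝕚 = fromℚ 0ℚ + fromℚ 1ℚ i

ℂ-rawRing : RawRing 0ℓ 0ℓ
ℂ-rawRing = record
  { Carrier = ℂ
  ; _≈_ = λ z w → re z ≃ᴿ re w × im z ≃ᴿ im w
  ; _+_ = λ z w → (re z +ᴿ re w) + (im z +ᴿ im w) i
  ; _*_ = λ z w → (re z *ᴿ re w +ᴿ -ᴿ (im z *ᴿ im w))
                + (re z *ᴿ im w +ᴿ im z *ᴿ re w) i
  ; -_  = λ z → (-ᴿ re z) + (-ᴿ im z) i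
  ; 0#  = fromℝ (fromℚ 0ℚ)
  ; 1#  = fromℝ (fromℚ 1ℚ) }

module Matrices {c ℓ} (R : RawRing c ℓ) where
  open RawRing R
  open RawSemiringDefinitions rawSemiring using (sum; _^_)

  Matrix : ℕ → Set c
  Matrix n = Fin n → Fin n → Carrier

  infix  4 _≈ᴹ_
  infixl 6 _-ᴹ_
  infixl 7 _·ᴹ_

  _≈ᴹ_ : ∀ {n} → Matrix n → Matrix n → Set ℓ
  A ≈ᴹ B = ∀ k l → A k l ≈ B k l

  scalar : ∀ {n} → Carrier → Matrix n
  scalar z k l = if does (k Fin.≟ l) then z else 0#

  _-ᴹ_ : ∀ {n} → Matrix n → Matrix n → Matrix n
  (A -ᴹ B) k l = A k l + - B k l

  _·ᴹ_ : ∀ {n} → Matrix n → Matrix n → Matrix n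
  (A ·ᴹ B) k l = sum (λ j → A k j * B j l)

  -- Laplace expansion along the first row.
  det : ∀ {n} → Matrix n → Carrier
  det {zero}  A = 1#
  det {suc n} A =
    sum (λ j → (- 1#) ^ toℕ j * (A zero j * det (λ k l → A (suc k) (punchIn j l))))

  charPoly : ∀ {n} → Matrix n → Carrier → Carrier
  charPoly A z = det (scalar z -ᴹ A)

  AreInverse : ∀ {n} → Matrix n → Matrix n → Set ℓ
  AreInverse A B = A ·ᴹ B ≈ᴹ scalar 1# × B ·ᴹ A ≈ᴹ scalar 1#

  IsDiagonal : ∀ {n} → Matrix n → Set ℓ
  IsDiagonal A = ∀ k l → ¬ k ≡ l → A k l ≈ 0#

open Matrices ℂ-rawRing public

-- The real numbers `ev 0, …, ev (n-1)` are the eigenvalues of `A`, listed with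
-- multiplicity: det(zI - A) = (z - ev 0) ⋯ (z - ev (n-1)) for every complex z.
-- For a Hermitian matrix such a list exists and is unique up to order.
AreEigenvalues : ∀ {n} → Matrix n → (Fin n → ℝ) → Set
AreEigenvalues A ev = ∀ z → charPoly A z ≈ product (λ k → z + - fromℝ (ev k))
  where
  open RawRing ℂ-rawRing
  open RawSemiringDefinitions rawSemiring using (product)

record Graph (V : Set) : Set where
  field
    adj        : V → V → Bool
    adj-sym    : ∀ u v → adj u v ≡ adj v u
    adj-irrefl : ∀ v → adj v v ≡ false

open Graph public

record _≅ᴳ_ {V W : Set} (G : Graph V) (H : Graph W) : Set where
  field
    bijection : V ↔ W
    pres-adj  : let open Inverse bijection in
                ∀ u v → adj H (to u) (to v) ≡ adj G u v

degree : ∀ {n} → Graph (Fin n) → Fin n → ℕ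
degree G v = Subset.∣ Vec.tabulate (adj G v) ∣

maxDegree : ∀ {n} → Graph (Fin n) → ℕ
maxDegree G = Vector.foldr _⊔_ 0 (degree G)

Regular : ∀ {n} → ℕ → Graph (Fin n) → Set
Regular k G = ∀ v → degree G v ≡ k

-- Vertices are bit strings, adjacent when they differ in exactly one position.
hypercube : ∀ d → Graph (Vec Bool d)
hypercube d = record
  { adj        = λ u v → Subset.∣ Vec.zipWith _xor_ u v ∣ ≡ᵇ 1
  ; adj-sym    = λ u v → cong (λ w → Subset.∣ w ∣ ≡ᵇ 1) (Vec.zipWith-comm xor-comm u v)
  ; adj-irrefl = λ v → cong (_≡ᵇ 1) (no-difference v)
  }
  where
  no-difference : ∀ {d} (v : Vec Bool d) → Subset.∣ Vec.zipWith _xor_ v v ∣ ≡ 0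
  no-difference Vec.[]            = refl
  no-difference (true  Vec.∷ v) = no-difference v
  no-difference (false Vec.∷ v) = no-difference v

-- `arc u v` means u → v; the set S of oriented edges is implicit, consisting of
-- the edges that carry an arc.
record MixedGraph (V : Set) : Set where
  field
    underlying : Graph V
    arc        : V → V → Bool
    arc⇒adj    : ∀ u v → arc u v ≡ true → adj underlying u v ≡ true
    arc-asym   : ∀ u v → arc u v ≡ true → arc v u ≡ false

  undirected : V → V → Bool
  undirected u v = adj underlying u v ∧ not (arc u v ∨ arc v u)

open MixedGraph public

record _≅_ {V W : Set} (G : MixedGraph V) (H : MixedGraph W) : Set where
  field
    bijection       : V ↔ W
    pres-undirected : let open Inverse bijection in
                      ∀ u v → undirected H (to u) (to v) ≡ undirected G u v
    pres-arc        : let open Inverse bijection in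
                      ∀ u v → arc H (to u) (to v) ≡ arc G u v

hermitianAdjacency : ∀ {n} → MixedGraph (Fin n) → Matrix n
hermitianAdjacency G k l =
  if undirected G k l then 1#
  else if arc G k l then 𝕚
  else if arc G l k then - 𝕚
  else 0#
  where open RawRing ℂ-rawRing

IsHermitianEnergy : ∀ {n} → MixedGraph (Fin n) → ℝ → Set
IsHermitianEnergy {n} G E = Σ[ ev ∈ (Fin n → ℝ) ]
  (AreEigenvalues (hermitianAdjacency G) ev × E ≃ᴿ sum (λ k → ∣ ev k ∣ᴿ))
  where open RawSemiringDefinitions (RawRing.rawSemiring ℝ-rawRing) using (sum)

OptimumHermitianEnergy : ∀ {n} → MixedGraph (Fin n) → Set
OptimumHermitianEnergy {n} G = ∃[ E ] ∃[ r ]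
  ( IsHermitianEnergy G E
  × IsSquareRoot r (fromℕ (maxDegree (underlying G)))
  × E ≃ᴿ fromℕ n *ᴿ r )

record SwitchingEquivalent {n} (G₁ G₂ : MixedGraph (Fin n)) : Set where
  open RawRing ℂ-rawRing
  field
    same-underlying : ∀ u v → adj (underlying G₁) u v ≡ adj (underlying G₂) u v
    D D⁻¹           : Matrix n
    D-diagonal      : IsDiagonal D
    D-±1            : ∀ k → D k k ≈ 1# ⊎ D k k ≈ - 1#
    D-inverse       : AreInverse D D⁻¹
    switched        : hermitianAdjacency G₂ ≈ᴹ D⁻¹ ·ᴹ hermitianAdjacency G₁ ·ᴹ D

infix 6 _⟷_ _⟶_

_⟷_ _⟶_ : Fin 8 → Fin 8 → Fin 8 × Fin 8
u ⟷ v = u , v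
u ⟶ v = u , v

v₁ v₂ v₃ v₄ v₅ v₆ v₇ v₈ : Fin 8
v₁ = 0F
v₂ = 1F
v₃ = 2F
v₄ = 3F
v₅ = 4F
v₆ = 5F
v₇ = 6F
v₈ = 7F

contains : List (Fin 8 × Fin 8) → Fin 8 → Fin 8 → Bool
contains ps u v = List.any (λ (a , b) → does (a Fin.≟ u) ∧ does (b Fin.≟ v)) ps

joins : List (Fin 8 × Fin 8) → Fin 8 → Fin 8 → Bool
joins ps u v = contains ps u v ∨ contains ps v u

cubeEdges : List (Fin 8 × Fin 8)
cubeEdges =
    v₁ ⟷ v₂ ∷ v₃ ⟷ v₄ ∷ v₅ ⟷ v₆ ∷ v₇ ⟷ v₈
  ∷ v₁ ⟷ v₃ ∷ v₂ ⟷ v₄ ∷ v₅ ⟷ v₇ ∷ v₆ ⟷ v₈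
  ∷ v₁ ⟷ v₅ ∷ v₂ ⟷ v₆ ∷ v₃ ⟷ v₇ ∷ v₄ ⟷ v₈ ∷ []

cube : Graph (Fin 8)
cube = record
  { adj        = joins cubeEdges
  ; adj-sym    = λ u v → ∨-comm (contains cubeEdges u v) (contains cubeEdges v u)
  ; adj-irrefl = toWitness {a? = Fin.all? λ v → joins cubeEdges v v Bool.≟ false} _
  }

-- `es` (undirected edges) and `as` (arcs) partition the twelve edges of the cube.
Valid : (es as : List (Fin 8 × Fin 8)) → Set
Valid es as = ∀ u v
  → adj cube u v ≡ joins es u v ∨ joins as u v
  × joins es u v ∧ joins as u v ≡ false
  × contains as u v ∧ contains as v u ≡ false

valid? : ∀ es as → Dec (Valid es as)
valid? es as = Fin.all? λ u → Fin.all? λ v →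
        (adj cube u v Bool.≟ joins es u v ∨ joins as u v)
  ×-dec (joins es u v ∧ joins as u v Bool.≟ false)
  ×-dec (contains as u v ∧ contains as v u Bool.≟ false)

mixedCube : ∀ es as {valid : True (valid? es as)} → MixedGraph (Fin 8)
mixedCube es as {valid} = record
  { underlying = cube
  ; arc        = contains as
  ; arc⇒adj    = λ u v uv → trans (proj₁ (toWitness valid u v))
                   (trans (cong (λ b → joins es u v ∨ (b ∨ contains as v u)) uv)
                          (∨-zeroʳ (joins es u v)))
  ; arc-asym   = λ u v uv → trans (sym (cong (_∧ contains as v u) uv))
                   (proj₂ (proj₂ (toWitness valid u v)))
  }

D₂ H₁ H₂ H₃ H₄ H₅ H₆ : MixedGraph (Fin 8)

D₂ = mixedCube []
  ( v₁ ⟶ v₂ ∷ v₄ ⟶ v₃ ∷ v₁ ⟶ v₃ ∷ v₂ ⟶ v₄ ∷ v₆ ⟶ v₅ ∷ v₇ ⟶ v₈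
  ∷ v₇ ⟶ v₅ ∷ v₈ ⟶ v₆ ∷ v₁ ⟶ v₅ ∷ v₂ ⟶ v₆ ∷ v₃ ⟶ v₇ ∷ v₄ ⟶ v₈ ∷ [])

H₁ = mixedCube
  ( v₁ ⟷ v₂ ∷ v₁ ⟷ v₃ ∷ v₁ ⟷ v₅ ∷ [])
  ( v₃ ⟶ v₄ ∷ v₄ ⟶ v₂ ∷ v₂ ⟶ v₆ ∷ v₆ ⟶ v₅ ∷ v₅ ⟶ v₇ ∷ v₇ ⟶ v₃
  ∷ v₄ ⟶ v₈ ∷ v₆ ⟶ v₈ ∷ v₇ ⟶ v₈ ∷ [])

H₂ = mixedCube
  ( v₁ ⟷ v₃ ∷ v₂ ⟷ v₄ ∷ v₅ ⟷ v₇ ∷ v₆ ⟷ v₈ ∷ [])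
  ( v₁ ⟶ v₂ ∷ v₂ ⟶ v₆ ∷ v₆ ⟶ v₅ ∷ v₁ ⟶ v₅ ∷ v₄ ⟶ v₃ ∷ v₈ ⟶ v₄
  ∷ v₇ ⟶ v₈ ∷ v₇ ⟶ v₃ ∷ [])

H₃ = mixedCube
  ( v₁ ⟷ v₃ ∷ v₁ ⟷ v₂ ∷ v₅ ⟷ v₇ ∷ v₅ ⟷ v₆ ∷ [])
  ( v₃ ⟶ v₄ ∷ v₄ ⟶ v₂ ∷ v₇ ⟶ v₈ ∷ v₈ ⟶ v₆ ∷ v₄ ⟶ v₈ ∷ v₆ ⟶ v₂
  ∷ v₁ ⟶ v₅ ∷ v₇ ⟶ v₃ ∷ [])

H₄ = mixedCube
  ( v₁ ⟷ v₃ ∷ v₁ ⟷ v₂ ∷ v₃ ⟷ v₇ ∷ v₅ ⟷ v₆ ∷ v₇ ⟷ v₈ ∷ [])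
  ( v₃ ⟶ v₄ ∷ v₄ ⟶ v₂ ∷ v₄ ⟶ v₈ ∷ v₇ ⟶ v₅ ∷ v₅ ⟶ v₁ ∷ v₂ ⟶ v₆
  ∷ v₆ ⟶ v₈ ∷ [])

H₅ = mixedCube
  ( v₁ ⟷ v₃ ∷ v₁ ⟷ v₂ ∷ v₃ ⟷ v₇ ∷ v₅ ⟷ v₆ ∷ v₆ ⟷ v₈ ∷ v₄ ⟷ v₈ ∷ [])
  ( v₃ ⟶ v₄ ∷ v₄ ⟶ v₂ ∷ v₂ ⟶ v₆ ∷ v₅ ⟶ v₁ ∷ v₇ ⟶ v₅ ∷ v₈ ⟶ v₇ ∷ [])

H₆ = mixedCube
  ( v₁ ⟷ v₃ ∷ v₁ ⟷ v₂ ∷ v₁ ⟷ v₅ ∷ v₆ ⟷ v₈ ∷ v₄ ⟷ v₈ ∷ v₇ ⟷ v₈ ∷ [])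
  ( v₃ ⟶ v₄ ∷ v₄ ⟶ v₂ ∷ v₂ ⟶ v₆ ∷ v₆ ⟶ v₅ ∷ v₅ ⟶ v₇ ∷ v₇ ⟶ v₃ ∷ [])

{-# OPTIONS --safe #-}
module Submission where

-- The squares of the eigenvalues sum to 24 (twice the number of edges), so an energy of
-- 8√3 is the equality case of Cauchy-Schwarz and every eigenvalue is ±√3. As the
-- characteristic polynomial P is even, P(z)² = P(z)P(-z) = (z² - 3)⁸, which forces the
-- coefficient of z⁴ in P to be 54. Expanding the determinant, this coefficient is
-- 42 - Σ 2 Re w(F) over the six faces F of the cube, where w(F) is the product of the
-- weights around F; hence every face has weight -1. The mixed cubes all of whose faces
-- have weight -1 are classified by exhaustive search.

open import Defs
open import Algebra.Bundles using (CommutativeRing)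
open import Algebra.Bundles.Raw using (RawRing)
import Algebra.Definitions.RawSemiring as RawSemiringDefinitions
import Algebra.Properties.CommutativeMonoid.Sum
import Algebra.Properties.Group
import Algebra.Properties.Ring
import Algebra.Properties.Semiring.Exp
import Algebra.Solver.Ring
open import Algebra.Solver.Ring.AlmostCommutativeRing using (_-Raw-AlmostCommutative⟶_; fromCommutativeRing)
open import Data.Bool.Base using (Bool; true; false; if_then_else_; _∧_; _∨_; not; _xor_)
import Data.Bool.Properties as Bool
open import Data.Fin.Base using (Fin; zero; suc; toℕ; punchIn; pinch)
open import Data.Fin.Patterns
open import Data.Fin.Permutation as Permutation
  using (Permutation′; permutation; _⟨$⟩ʳ_; _⟨$⟩ˡ_; _∘ₚ_)
import Data.Fin.Properties as Fin
open import Data.Integer.Base as ℤ using (ℤ; +_; -[1+_]; 0ℤ; 1ℤ)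
import Data.Integer.Properties as ℤ
open import Data.List.Base as List using (List; []; _∷_; _++_; map; foldr)
open import Data.List.Membership.Propositional using (_∈_; find)
open import Data.List.Relation.Binary.Pointwise using (Pointwise; []; _∷_)
open import Data.List.Relation.Unary.All as All using (All)
open import Data.List.Relation.Unary.Any as Any using (Any; here; there)
import Data.List.Relation.Unary.Any.Properties as Any
open import Data.Maybe.Base as Maybe using (Maybe; just; nothing)
import Data.Maybe.Properties as Maybe
open import Data.Nat.Base as ℕ using (ℕ; zero; suc)
import Data.Nat.Properties as ℕ
open import Data.Product.Base using (∃-syntax; _×_; _,_; proj₁; proj₂)
import Data.Product.Properties as Product
open import Data.Rational.Base as ℚ using (ℚ; 0ℚ; 1ℚ; ½)
import Data.Rational.Properties as ℚ
open import Data.Rational.Solver using (module +-*-Solver)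
import Data.Rational.Unnormalised.Base as ℚᵘ
import Data.Rational.Unnormalised.Properties as ℚᵘ
open import Data.Sum.Base using (_⊎_; inj₁; inj₂)
open import Data.Vec.Base as Vec using (Vec; []; _∷_; lookup; replicate; tabulate; zipWith)
import Data.Vec.Functional as Vector
import Data.Vec.Properties as Vec
open import Data.Vec.Relation.Unary.All as VecAll using ([]; _∷_)
open import Data.Vec.Relation.Unary.AllPairs using (AllPairs; []; _∷_; allPairs?)
open import Function.Base using (_∘_; id)
open import Function.Bundles using (_↔_; module Inverse; mk↔ₛ′)
open import Function.Construct.Composition using (_↔-∘_)
open import Function.Construct.Symmetry using (↔-sym)
open import Level using (0ℓ; _⊔_)
open import Relation.Binary.Definitions using (DecidableEquality)
open import Relation.Binary.PropositionalEquality as ≡ using (_≡_; _≢_; _≗_; cong; cong₂; subst)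
import Relation.Binary.Reasoning.Setoid
open import Relation.Nullary.Decidable
  using (Dec; True; yes; no; does; map′; toWitness; ¬?; _×-dec_; _→-dec_; dec-true; dec-false)
open import Relation.Nullary.Negation using (contradiction)

open RawRing ℂ-rawRing using () renaming
  (_≈_ to _≈ᶜ_; _+_ to _+ᶜ_; _*_ to _*ᶜ_; -_ to -ᶜ_; 0# to 0ᶜ; 1# to 1ᶜ)
open RawSemiringDefinitions (RawRing.rawSemiring ℝ-rawRing) using () renaming (sum to sumᴿ)

-- Determinants under relabelling

-- The spectral hypothesis is an equality of functions of `z` over Cauchy reals, where neither the
-- sign of an eigenvalue nor the vanishing of a number can be decided. Passing from `P(z)` to
-- `P(z)P(-z)` leaves only the squares of the eigenvalues, so no sign has to be known. Coefficients
-- are then recovered by interpolation at integer nodes, where the only divisions are by nonzero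
-- integers. Evenness of `P` reflects that the cube is bipartite; in the computation it appears as
-- the absence of odd powers. The determinant is expanded once, with twelve formal edge weights of
-- order four, instead of once for each of the 3¹² ways to orient the edges. In the coefficient of
-- `z⁴`, 42 counts the pairs of disjoint edges: C(12,2) - 8·C(3,2) = 66 - 24. Since 2 Re w(F) ≥ -2
-- for each of the six faces, the coefficient is at most 42 + 12 = 54, and the spectrum forces this
-- maximum.

swapAt : ∀ {n} → Fin n → Fin (suc n) → Fin (suc n)
swapAt zero    zero          = suc zero
swapAt zero    (suc zero)    = zero
swapAt zero    (suc (suc k)) = suc (suc k)
swapAt (suc p) zero          = zero
swapAt (suc p) (suc k)       = suc (swapAt p k)

-- `swapAt p` is the transposition of `p` and `p + 1`. Deleting an index outside this pair keeps the
-- pair adjacent, so the others again undergo an adjacent transposition; deleting a member of the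
-- pair leaves nothing to swap and shifts the cofactor sign by one. These are the two kinds of term
-- in a Laplace expansion.
swapAt-punchIn : ∀ {n} (p : Fin (suc n)) (m : Fin (suc (suc n))) →
    (swapAt p m ≡ m
      × ∃[ q ] (∀ l → swapAt p (punchIn m l) ≡ punchIn m (swapAt q l)))
  ⊎ ((toℕ (swapAt p m) ≡ suc (toℕ m) ⊎ toℕ m ≡ suc (toℕ (swapAt p m)))
      × (∀ l → swapAt p (punchIn m l) ≡ punchIn (swapAt p m) l))
swapAt-punchIn zero zero = inj₂ (inj₁ ≡.refl , λ { zero → ≡.refl ; (suc l) → ≡.refl })
swapAt-punchIn zero (suc zero) = inj₂ (inj₂ ≡.refl , λ { zero → ≡.refl ; (suc l) → ≡.refl })
swapAt-punchIn zero (suc (suc {suc n} m)) = inj₁ (≡.refl , zero ,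
  λ { zero → ≡.refl ; (suc zero) → ≡.refl ; (suc (suc l)) → ≡.refl })
swapAt-punchIn (suc p) zero = inj₁ (≡.refl , p , λ l → ≡.refl)
swapAt-punchIn {suc n} (suc p) (suc m) with swapAt-punchIn p m
... | inj₁ (fix , q , eq) = inj₁ (cong suc fix , suc q ,
  λ { zero → ≡.refl ; (suc l) → cong suc (eq l) })
... | inj₂ (inj₁ up , eq) = inj₂ (inj₁ (cong suc up) , λ { zero → ≡.refl ; (suc l) → cong suc (eq l) })
... | inj₂ (inj₂ down , eq) = inj₂ (inj₂ (cong suc down) , λ { zero → ≡.refl ; (suc l) → cong suc (eq l) })

-- (j , l) ↦ (punchIn j l , pinch l j) is the involution exchanging the two entries of
-- an ordered pair of distinct indices, when a pair is encoded as (j , l) with second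
-- entry punchIn j l.
punchIn-pinch : ∀ {n} (j : Fin (suc n)) l → punchIn (punchIn j l) (pinch l j) ≡ j
punchIn-pinch zero    zero    = ≡.refl
punchIn-pinch zero    (suc l) = ≡.refl
punchIn-pinch (suc j) zero    = ≡.refl
punchIn-pinch (suc j) (suc l) = cong suc (punchIn-pinch j l)

-- Both sides list in increasing order the indices other than `j` and `punchIn j l`; hence the minor
-- in a double Laplace expansion does not depend on which of its two columns is deleted first.
punchIn-punchIn : ∀ {n} (j : Fin (suc (suc n))) l m →
  punchIn j (punchIn l m) ≡ punchIn (punchIn j l) (punchIn (pinch l j) m)
punchIn-punchIn zero    zero    m       = ≡.refl
punchIn-punchIn zero    (suc l) m       = ≡.refl
punchIn-punchIn (suc j) zero    m       = ≡.refl
punchIn-punchIn (suc j) (suc l) zero    = ≡.refl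
punchIn-punchIn {suc n} (suc j) (suc l) (suc m) = cong suc (punchIn-punchIn j l m)

lift : ∀ {n} → (Fin n → Fin n) → Fin (suc n) → Fin (suc n)
lift σ zero    = zero
lift σ (suc k) = suc (σ k)

-- `gen-≗` is a constructor because a composite of adjacent transpositions agrees with a given map
-- only pointwise.
data Generated : ∀ {n} → (Fin n → Fin n) → Set where
  gen-id   : ∀ {n} → Generated {n} id
  gen-swap : ∀ {n} (p : Fin n) → Generated (swapAt p)
  gen-∘    : ∀ {n} {σ τ : Fin n → Fin n} → Generated σ → Generated τ → Generated (σ ∘ τ)
  gen-≗    : ∀ {n} {σ τ : Fin n → Fin n} → Generated σ → σ ≗ τ → Generated τ

lift-generated : ∀ {n} {σ : Fin n → Fin n} → Generated σ → Generated (lift σ)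
lift-generated gen-id       = gen-≗ gen-id λ { zero → ≡.refl ; (suc k) → ≡.refl }
lift-generated (gen-swap p) = gen-≗ (gen-swap (suc p)) λ { zero → ≡.refl ; (suc k) → ≡.refl }
lift-generated (gen-∘ g h)  = gen-≗ (gen-∘ (lift-generated g) (lift-generated h))
  λ { zero → ≡.refl ; (suc k) → ≡.refl }
lift-generated (gen-≗ g eq) = gen-≗ (lift-generated g) λ { zero → ≡.refl ; (suc k) → cong suc (eq k) }

cycle : ∀ {n} → Fin (suc n) → Fin (suc n) → Fin (suc n)
cycle m zero    = m
cycle m (suc l) = punchIn m l

-- The cycle to `suc m` exchanges 0 and 1 and then runs the cycle to `m` on the tail.
cycle-generated : ∀ {n} (m : Fin (suc n)) → Generated (cycle m)
cycle-generated zero = gen-≗ gen-id λ { zero → ≡.refl ; (suc l) → ≡.refl }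
cycle-generated {suc n} (suc m) = gen-≗ (gen-∘ (lift-generated (cycle-generated m)) (gen-swap zero))
  λ { zero → ≡.refl ; (suc zero) → ≡.refl ; (suc (suc l)) → ≡.refl }

-- Coset decomposition over the stabiliser of 0: `cycle` carries 0 to its image, and what remains is
-- the permutation with 0 and its image removed.
permutation-generated : ∀ {n} (π : Permutation′ n) → Generated (π ⟨$⟩ʳ_)
permutation-generated {zero} π = gen-≗ gen-id λ ()
permutation-generated {suc n} π =
  gen-≗ (gen-∘ (cycle-generated (π ⟨$⟩ʳ 0F)) (lift-generated (permutation-generated (Permutation.remove 0F π))))
    λ { zero → ≡.refl ; (suc l) → ≡.sym (Permutation.punchIn-permute π 0F l) }

module Determinant {c ℓ} (R : CommutativeRing c ℓ) where
  open CommutativeRing R hiding (zero)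
  open Algebra.Properties.CommutativeMonoid.Sum +-commutativeMonoid
  open Algebra.Properties.Ring ring
  open RawSemiringDefinitions (RawRing.rawSemiring rawRing) using (_^_)
  open Matrices rawRing using () renaming
    ( Matrix to Mat; det to Det; _≈ᴹ_ to _≋_; charPoly to CharPoly
    ; scalar to Scalar; _·ᴹ_ to _⊙_)
  open Relation.Binary.Reasoning.Setoid setoid

  sum-cong : ∀ n {f g : Fin n → Carrier} → (∀ k → f k ≈ g k) → sum f ≈ sum g
  sum-cong _ = sum-cong-≋

  sum-neg : ∀ n (f : Fin n → Carrier) → sum (λ k → - f k) ≈ - sum f
  sum-neg zero    f = sym -0#≈0#
  sum-neg (suc n) f = trans (+-congˡ (sum-neg n (f ∘ suc))) (-‿+-comm _ _)

  sum-*ˡ : ∀ n x (f : Fin n → Carrier) → x * sum f ≈ sum (λ k → x * f k)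
  sum-*ˡ zero    x f = zeroʳ x
  sum-*ˡ (suc n) x f = trans (distribˡ _ _ _) (+-congˡ (sum-*ˡ n x (f ∘ suc)))

  sum-0 : ∀ {n} {f : Fin n → Carrier} → (∀ k → f k ≈ 0#) → sum f ≈ 0#
  sum-0 {n} h = trans (sum-cong n h) (sum-replicate-zero n)

  sum-single : ∀ {n} (k : Fin n) {f : Fin n → Carrier} → (∀ j → k ≢ j → f j ≈ 0#) → sum f ≈ f k
  sum-single zero    h = trans (+-congˡ (sum-0 λ j → h (suc j) λ ())) (+-identityʳ _)
  sum-single (suc k) h =
    trans (+-cong (h zero λ ()) (sum-single k λ j k≢j → h (suc j) (k≢j ∘ Fin.suc-injective))) (+-identityˡ _)

  sum-swapAt : ∀ {n} (p : Fin n) (f : Fin (suc n) → Carrier) → sum (f ∘ swapAt p) ≈ sum f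
  sum-swapAt {suc n} zero f = begin
    f (suc zero) + (f zero + rest) ≈⟨ +-assoc _ _ _ ⟨
    (f (suc zero) + f zero) + rest ≈⟨ +-congʳ (+-comm _ _) ⟩
    (f zero + f (suc zero)) + rest ≈⟨ +-assoc _ _ _ ⟩
    f zero + (f (suc zero) + rest) ∎
    where rest = sum (λ k → f (suc (suc k)))
  sum-swapAt {suc n} (suc p) f = +-congˡ (sum-swapAt p (f ∘ suc))

  -- The involution exchanges the row `j = 0` with the column `l = 0` below it and acts on the
  -- remaining block as the same involution one size smaller.
  sum-exchange : ∀ n (F : Fin (suc n) → Fin n → Carrier) →
    sum (λ j → sum (λ l → F j l)) ≈ sum (λ j → sum (λ l → F (punchIn j l) (pinch l j)))
  sum-exchange zero    F = refl
  sum-exchange (suc n) F = begin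
    row + sum (λ j → F (suc j) zero + sum (λ l → F (suc j) (suc l)))
      ≈⟨ +-congˡ (∑-distrib-+ {suc n} (λ j → F (suc j) zero) (λ j → sum (λ l → F (suc j) (suc l)))) ⟩
    row + (col + sum (λ j → sum (λ l → F (suc j) (suc l))))
      ≈⟨ +-congˡ (+-congˡ (sum-exchange n (λ j l → F (suc j) (suc l)))) ⟩
    row + (col + rest)
      ≈⟨ +-assoc _ _ _ ⟨
    (row + col) + rest
      ≈⟨ +-congʳ (+-comm _ _) ⟩
    (col + row) + rest
      ≈⟨ +-assoc _ _ _ ⟩
    col + (row + rest)
      ≈⟨ +-congˡ (∑-distrib-+ {suc n} (λ j → F zero j) (λ j → sum (λ l → F (suc (punchIn j l)) (suc (pinch l j))))) ⟨
    col + sum (λ j → F zero j + sum (λ l → F (suc (punchIn j l)) (suc (pinch l j)))) ∎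
    where
    row  = sum (λ l → F zero l)
    col  = sum (λ j → F (suc j) zero)
    rest = sum (λ j → sum (λ l → F (suc (punchIn j l)) (suc (pinch l j))))

  sgn : ℕ → Carrier
  sgn k = (- 1#) ^ k

  sgn-suc : ∀ k → sgn (suc k) ≈ - sgn k
  sgn-suc k = -1*x≈-x (sgn k)

  -- The exchange changes the parity of `j + l`: it sends `(j , l)` to `(l + 1 , j)` when `l ≥ j`
  -- and to `(l , j - 1)` when `l < j`.
  sgn-punchIn : ∀ {n} (j : Fin (suc n)) l →
    sgn (toℕ j) * sgn (toℕ l) ≈ - (sgn (toℕ (punchIn j l)) * sgn (toℕ (pinch l j)))
  sgn-punchIn {suc n} zero l = begin
    1# * sgn (toℕ l)                              ≈⟨ *-identityˡ _ ⟩
    sgn (toℕ l)                                   ≈⟨ -‿involutive _ ⟨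
    - (- sgn (toℕ l))                             ≈⟨ -‿cong (sgn-suc (toℕ l)) ⟨
    - sgn (suc (toℕ l))                           ≈⟨ -‿cong (*-identityʳ _) ⟨
    - (sgn (suc (toℕ l)) * 1#)                    ≈⟨ -‿cong (*-congˡ (reflexive (cong (λ m → sgn (toℕ m)) (pinch-zero l)))) ⟨
    - (sgn (suc (toℕ l)) * sgn (toℕ (pinch l zero))) ∎
    where
    pinch-zero : ∀ {n} (l : Fin (suc n)) → pinch l zero ≡ zero
    pinch-zero zero    = ≡.refl
    pinch-zero (suc l) = ≡.refl
  sgn-punchIn (suc j) zero = begin
    sgn (suc (toℕ j)) * 1# ≈⟨ *-identityʳ _ ⟩
    sgn (suc (toℕ j))      ≈⟨ sgn-suc (toℕ j) ⟩
    - sgn (toℕ j)          ≈⟨ -‿cong (*-identityˡ _) ⟨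
    - (1# * sgn (toℕ j))   ∎
  sgn-punchIn (suc j) (suc l) = begin
    sgn (suc (toℕ j)) * sgn (suc (toℕ l))   ≈⟨ both (toℕ j) (toℕ l) ⟩
    sgn (toℕ j) * sgn (toℕ l)               ≈⟨ sgn-punchIn j l ⟩
    - (sgn (toℕ (punchIn j l)) * sgn (toℕ (pinch l j)))  ≈⟨ -‿cong (both (toℕ (punchIn j l)) (toℕ (pinch l j))) ⟨
    - (sgn (suc (toℕ (punchIn j l))) * sgn (suc (toℕ (pinch l j)))) ∎
    where
    both : ∀ a b → sgn (suc a) * sgn (suc b) ≈ sgn a * sgn b
    both a b = begin
      sgn (suc a) * sgn (suc b) ≈⟨ *-cong (sgn-suc a) (sgn-suc b) ⟩
      - sgn a * - sgn b         ≈⟨ -‿distribˡ-* _ _ ⟨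
      - (sgn a * - sgn b)       ≈⟨ -‿cong (-‿distribʳ-* _ _) ⟨
      - - (sgn a * sgn b)       ≈⟨ -‿involutive _ ⟩
      sgn a * sgn b             ∎

  det-cong : ∀ {n} {A B : Mat n} → A ≋ B → Det A ≈ Det B
  det-cong {zero}  eq = refl
  det-cong {suc n} eq = sum-cong (suc n) λ j →
    *-congˡ {x = sgn (toℕ j)} (*-cong (eq zero j) (det-cong (λ k l → eq (suc k) (punchIn j l))))

  -- In the expansion along the first row, a column outside the swapped pair contributes a minor
  -- that changes sign by induction, and the two terms of the pair trade places with opposite
  -- cofactor signs.
  det-swapCols : ∀ {n} (p : Fin n) (A : Mat (suc n)) → Det (λ k l → A k (swapAt p l)) ≈ - Det A
  det-swapCols {suc n} p A = begin
    sum (λ m → sgn (toℕ m) * (A zero (swapAt p m) * Det (λ k l → A (suc k) (swapAt p (punchIn m l)))))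
      ≈⟨ sum-cong (suc (suc n)) (λ m → term m (swapAt-punchIn p m)) ⟩
    sum (λ m → - t (swapAt p m))   ≈⟨ sum-neg (suc (suc n)) (t ∘ swapAt p) ⟩
    - sum (t ∘ swapAt p)           ≈⟨ -‿cong (sum-swapAt p t) ⟩
    - sum t                        ∎
    where
    minor : Fin (suc (suc n)) → Mat (suc n)
    minor m k l = A (suc k) (punchIn m l)
    t : Fin (suc (suc n)) → Carrier
    t m = sgn (toℕ m) * (A zero m * Det (minor m))
    term : ∀ m → _ → sgn (toℕ m) * (A zero (swapAt p m) * Det (λ k l → A (suc k) (swapAt p (punchIn m l))))
             ≈ - t (swapAt p m)
    term m (inj₁ (fix , q , eq)) = begin
      sgn (toℕ m) * (A zero (swapAt p m) * Det (λ k l → A (suc k) (swapAt p (punchIn m l))))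
        ≈⟨ *-congˡ (*-cong {A zero (swapAt p m)} (reflexive (cong (A zero) fix))
             (trans (det-cong λ k l → reflexive (cong (A (suc k)) (eq l))) (det-swapCols q (minor m)))) ⟩
      sgn (toℕ m) * (A zero m * - Det (minor m)) ≈⟨ *-congˡ (-‿distribʳ-* _ _) ⟨
      sgn (toℕ m) * - (A zero m * Det (minor m)) ≈⟨ -‿distribʳ-* _ _ ⟨
      - t m                                      ≡⟨ cong (λ m → - t m) fix ⟨
      - t (swapAt p m)                           ∎
    term m (inj₂ (flip , eq)) = begin
      sgn (toℕ m) * (A zero (swapAt p m) * Det (λ k l → A (suc k) (swapAt p (punchIn m l))))
        ≈⟨ *-cong (sign flip) (*-congˡ (det-cong λ k l → reflexive (cong (A (suc k)) (eq l)))) ⟩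
      - sgn (toℕ (swapAt p m)) * (A zero (swapAt p m) * Det (minor (swapAt p m)))
        ≈⟨ -‿distribˡ-* _ _ ⟨
      - t (swapAt p m) ∎
      where
      sign : _ → sgn (toℕ m) ≈ - sgn (toℕ (swapAt p m))
      sign (inj₁ up)   = trans (sym (-‿involutive _))
        (-‿cong (trans (sym (sgn-suc (toℕ m))) (reflexive (cong sgn (≡.sym up)))))
      sign (inj₂ down) = trans (reflexive (cong sgn down)) (sgn-suc (toℕ (swapAt p m)))

  private
    move-sgn : ∀ s a t b d → s * (a * (t * (b * d))) ≈ (s * t) * ((a * b) * d)
    move-sgn s a t b d = begin
      s * (a * (t * (b * d)))  ≈⟨ *-congˡ (*-assoc _ _ _) ⟨
      s * ((a * t) * (b * d))  ≈⟨ *-congˡ (*-congʳ (*-comm _ _)) ⟩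
      s * ((t * a) * (b * d))  ≈⟨ *-congˡ (*-assoc _ _ _) ⟩
      s * (t * (a * (b * d)))  ≈⟨ *-assoc _ _ _ ⟨
      (s * t) * (a * (b * d))  ≈⟨ *-congˡ (*-assoc _ _ _) ⟨
      (s * t) * ((a * b) * d)  ∎

  -- For `p > 0` the first row stays put and induction applies to every minor. For `p = 0` the first
  -- row itself moves, so a double expansion is used: a sum over ordered pairs of distinct columns,
  -- in which exchanging the pair reverses the sign and preserves the minor.
  det-swapRows : ∀ {n} (p : Fin n) (A : Mat (suc n)) → Det (λ k l → A (swapAt p k) l) ≈ - Det A
  det-swapRows {suc n} (suc p) A = begin
    sum (λ m → sgn (toℕ m) * (A zero m * Det (λ k l → A (suc (swapAt p k)) (punchIn m l))))
      ≈⟨ sum-cong (suc (suc n)) (λ m → *-congˡ {x = sgn (toℕ m)} (*-congˡ {x = A zero m} (det-swapRows p (λ k l → A (suc k) (punchIn m l))))) ⟩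
    sum (λ m → sgn (toℕ m) * (A zero m * - Det (λ k l → A (suc k) (punchIn m l))))
      ≈⟨ sum-cong (suc (suc n)) (λ m → trans (-‿distribʳ-* (sgn (toℕ m)) _)
           (*-congˡ {x = sgn (toℕ m)} (-‿distribʳ-* (A zero m) (Det (λ k l → A (suc k) (punchIn m l)))))) ⟨
    sum (λ m → - (sgn (toℕ m) * (A zero m * Det (λ k l → A (suc k) (punchIn m l)))))
      ≈⟨ sum-neg (suc (suc n)) (λ m → sgn (toℕ m) * (A zero m * Det (λ k l → A (suc k) (punchIn m l)))) ⟩
    - Det A ∎
  det-swapRows {suc n} zero A = begin
    Det (λ k l → A (swapAt zero k) l)            ≈⟨ expand (λ k l → A (swapAt zero k) l) (λ _ _ → ≡.refl) ⟩
    sum (λ j → sum (λ l → F (A (suc zero)) (A zero) j l))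
      ≈⟨ sum-cong (suc (suc n)) (λ j → sum-cong (suc n) (λ l → flip j l)) ⟩
    sum (λ j → sum (λ l → - F (A zero) (A (suc zero)) (punchIn j l) (pinch l j)))
      ≈⟨ sum-exchange _ (λ j l → - F (A zero) (A (suc zero)) j l) ⟨
    sum (λ j → sum (λ l → - F (A zero) (A (suc zero)) j l))
      ≈⟨ sum-cong (suc (suc n)) (λ j → sum-neg (suc n) (F (A zero) (A (suc zero)) j)) ⟩
    sum (λ j → - sum (λ l → F (A zero) (A (suc zero)) j l))
      ≈⟨ sum-neg (suc (suc n)) (λ j → sum (F (A zero) (A (suc zero)) j)) ⟩
    - sum (λ j → sum (λ l → F (A zero) (A (suc zero)) j l))
      ≈⟨ -‿cong (expand A (λ _ _ → ≡.refl)) ⟨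
    - Det A ∎
    where
    minor : Fin (suc (suc n)) → Fin (suc n) → Carrier
    minor j l = Det (λ k m → A (suc (suc k)) (punchIn j (punchIn l m)))
    F : (Fin (suc (suc n)) → Carrier) → (Fin (suc (suc n)) → Carrier) →
        Fin (suc (suc n)) → Fin (suc n) → Carrier
    F a b j l = (sgn (toℕ j) * sgn (toℕ l)) * ((a j * b (punchIn j l)) * minor j l)
    expand : ∀ (B : Mat (suc (suc n))) → (∀ k l → B (suc (suc k)) l ≡ A (suc (suc k)) l) →
      Det B ≈ sum (λ j → sum (λ l → F (B zero) (B (suc zero)) j l))
    expand B eq = sum-cong (suc (suc n)) λ j → begin
      sgn (toℕ j) * (B zero j * sum (λ l → sgn (toℕ l) * (B (suc zero) (punchIn j l)
          * Det (λ k m → B (suc (suc k)) (punchIn j (punchIn l m))))))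
        ≈⟨ *-congˡ {x = sgn (toℕ j)} (*-congˡ {x = B zero j} (sum-cong (suc n) λ l → *-congˡ {x = sgn (toℕ l)} (*-congˡ {x = B (suc zero) (punchIn j l)}
             (det-cong λ k m → reflexive (eq k (punchIn j (punchIn l m))))))) ⟩
      sgn (toℕ j) * (B zero j * sum (λ l → sgn (toℕ l) * (B (suc zero) (punchIn j l) * minor j l)))
        ≈⟨ *-congˡ (sum-*ˡ (suc n) (B zero j) (λ l → sgn (toℕ l) * (B (suc zero) (punchIn j l) * minor j l))) ⟩
      sgn (toℕ j) * sum (λ l → B zero j * (sgn (toℕ l) * (B (suc zero) (punchIn j l) * minor j l)))
        ≈⟨ sum-*ˡ (suc n) (sgn (toℕ j)) (λ l → B zero j * (sgn (toℕ l) * (B (suc zero) (punchIn j l) * minor j l))) ⟩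
      sum (λ l → sgn (toℕ j) * (B zero j * (sgn (toℕ l) * (B (suc zero) (punchIn j l) * minor j l))))
        ≈⟨ sum-cong (suc n) (λ l → move-sgn (sgn (toℕ j)) (B zero j) (sgn (toℕ l)) (B (suc zero) (punchIn j l)) (minor j l)) ⟩
      sum (λ l → F (B zero) (B (suc zero)) j l) ∎
    flip : ∀ j l → F (A (suc zero)) (A zero) j l ≈ - F (A zero) (A (suc zero)) (punchIn j l) (pinch l j)
    flip j l = begin
      (sgn (toℕ j) * sgn (toℕ l)) * ((A (suc zero) j * A zero (punchIn j l)) * minor j l)
        ≈⟨ *-cong (sgn-punchIn j l) (*-cong (trans (*-comm _ _)
             (*-congˡ (reflexive (cong (A (suc zero)) (≡.sym (punchIn-pinch j l))))))
             (det-cong λ k m → reflexive (cong (A (suc (suc k))) (punchIn-punchIn j l m)))) ⟩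
      - (sgn (toℕ j′) * sgn (toℕ l′)) * ((A zero j′ * A (suc zero) (punchIn j′ l′)) * minor j′ l′)
        ≈⟨ -‿distribˡ-* _ _ ⟨
      - F (A zero) (A (suc zero)) j′ l′ ∎
      where
      j′ = punchIn j l
      l′ = pinch l j

  -- Each adjacent transposition acts once on rows and once on columns, so its two signs cancel and
  -- the sign of a permutation need not be defined.
  det-generated : ∀ {n} {σ : Fin n → Fin n} → Generated σ → (A : Mat n) →
    Det (λ k l → A (σ k) (σ l)) ≈ Det A
  det-generated gen-id A = refl
  det-generated (gen-swap p) A = begin
    Det (λ k l → A (swapAt p k) (swapAt p l)) ≈⟨ det-swapCols p (λ k l → A (swapAt p k) l) ⟩
    - Det (λ k l → A (swapAt p k) l)          ≈⟨ -‿cong (det-swapRows p A) ⟩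
    - - Det A                                 ≈⟨ -‿involutive _ ⟩
    Det A                                     ∎
  det-generated (gen-∘ {σ = σ} g h) A =
    trans (det-generated h (λ k l → A (σ k) (σ l))) (det-generated g A)
  det-generated (gen-≗ g eq) A =
    trans (det-cong λ k l → reflexive (≡.cong₂ A (≡.sym (eq k)) (≡.sym (eq l)))) (det-generated g A)

  charPoly-cong : ∀ {n} {A B : Mat n} → A ≋ B → ∀ z → CharPoly A z ≈ CharPoly B z
  charPoly-cong eq z = det-cong λ k l → +-congˡ (-‿cong (eq k l))

  charPoly-congʳ : ∀ {n} (A : Mat n) {z w} → z ≈ w → CharPoly A z ≈ CharPoly A w
  charPoly-congʳ {n} A {z} {w} eq = det-cong {n} λ k l → +-congʳ { - A k l} (if-cong (does (k Fin.≟ l)))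
    where
    if-cong : ∀ b → (if b then z else 0#) ≈ (if b then w else 0#)
    if-cong true  = eq
    if-cong false = refl

  charPoly-permute : ∀ {n} (π : Permutation′ n) (A : Mat n) z →
    CharPoly (λ k l → A (π ⟨$⟩ʳ k) (π ⟨$⟩ʳ l)) z ≈ CharPoly A z
  charPoly-permute π A z = trans
    (det-cong λ k l → +-congʳ (reflexive (cong (λ b → if b then z else 0#) (does-eq k l))))
    (det-generated (permutation-generated π) (λ k l → Scalar z k l + - A k l))
    where
    injective : ∀ {k l} → π ⟨$⟩ʳ k ≡ π ⟨$⟩ʳ l → k ≡ l
    injective eq = ≡.trans (≡.sym (Permutation.inverseˡ π))
      (≡.trans (cong (π ⟨$⟩ˡ_) eq) (Permutation.inverseˡ π))
    does-eq : ∀ k l → does (k Fin.≟ l) ≡ does ((π ⟨$⟩ʳ k) Fin.≟ (π ⟨$⟩ʳ l))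
    does-eq k l with k Fin.≟ l
    ... | yes ≡.refl = ≡.sym (dec-true ((π ⟨$⟩ʳ k) Fin.≟ (π ⟨$⟩ʳ k)) ≡.refl)
    ... | no  k≢l    = ≡.sym (dec-false ((π ⟨$⟩ʳ k) Fin.≟ (π ⟨$⟩ʳ l)) (k≢l ∘ injective))

  -- The source is only a raw ring because formal polynomials stored as lists obey the ring laws
  -- only after evaluation. Laplace expansion uses nothing but the ring operations, so respecting
  -- these is enough.
  module Homomorphic {a b} (K : RawRing a b) (φ : RawRing.Carrier K → Carrier)
    (φ-0 : φ (RawRing.0# K) ≈ 0#) (φ-1 : φ (RawRing.1# K) ≈ 1#)
    (φ-+ : ∀ x y → φ (RawRing._+_ K x y) ≈ φ x + φ y)
    (φ-* : ∀ x y → φ (RawRing._*_ K x y) ≈ φ x * φ y)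
    (φ-- : ∀ x → φ (RawRing.-_ K x) ≈ - φ x)
    where

    private
      module K where
        open RawRing K public
        open RawSemiringDefinitions rawSemiring public using (sum; _^_)
        open Matrices K public using (Matrix; det; charPoly; scalar)

    φ-sum : ∀ {n} (f : Fin n → K.Carrier) → φ (K.sum f) ≈ sum (φ ∘ f)
    φ-sum {zero}  f = φ-0
    φ-sum {suc n} f = trans (φ-+ _ _) (+-congˡ (φ-sum (f ∘ suc)))

    φ-sgn : ∀ k → φ ((K.- K.1#) K.^ k) ≈ sgn k
    φ-sgn zero    = φ-1
    φ-sgn (suc k) = trans (φ-* _ _) (*-cong (trans (φ-- _) (-‿cong φ-1)) (φ-sgn k))

    φ-det : ∀ {n} (A : K.Matrix n) → φ (K.det A) ≈ Det (λ k l → φ (A k l))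
    φ-det {zero}  A = φ-1
    φ-det {suc n} A = trans (φ-sum term) (sum-cong (suc n) λ j →
      trans (φ-* (sign j) _) (*-cong (φ-sgn (toℕ j)) (trans (φ-* (A zero j) _) (*-congˡ (φ-det (minor j))))))
      where
      sign : Fin (suc n) → K.Carrier
      sign j = (K.- K.1#) K.^ toℕ j
      minor : Fin (suc n) → K.Matrix n
      minor j k l = A (suc k) (punchIn j l)
      term : Fin (suc n) → K.Carrier
      term j = sign j K.* (A zero j K.* K.det (minor j))

    φ-charPoly : ∀ {n} (A : K.Matrix n) z → φ (K.charPoly A z) ≈ CharPoly (λ k l → φ (A k l)) (φ z)
    φ-charPoly A z = trans (φ-det (λ k l → K.scalar z k l K.+ K.- A k l))
      (det-cong λ k l → trans (φ-+ (K.scalar z k l) (K.- A k l)) (+-cong (φ-scalar k l) (φ-- (A k l))))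
      where
      if-cong : ∀ b → φ (if b then z else K.0#) ≈ (if b then φ z else 0#)
      if-cong true  = refl
      if-cong false = φ-0
      φ-scalar : ∀ k l → φ (if does (k Fin.≟ l) then z else K.0#) ≈ (if does (k Fin.≟ l) then φ z else 0#)
      φ-scalar k l = if-cong (does (k Fin.≟ l))

  -- Diagonal matrices and conjugation by them

  diagonal : ∀ {n} → (Fin n → Carrier) → Mat n
  diagonal d k l = if does (k Fin.≟ l) then d k else 0#

  diagonal-on : ∀ {n} (d : Fin n → Carrier) k → diagonal d k k ≡ d k
  diagonal-on d k = cong (if_then d k else 0#) (dec-true (k Fin.≟ k) ≡.refl)

  diagonal-off : ∀ {n} (d : Fin n → Carrier) k l → k ≢ l → diagonal d k l ≈ 0#
  diagonal-off d k l k≢l = reflexive (cong (if_then d k else 0#) (dec-false (k Fin.≟ l) k≢l))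

  diagonal-*ˡ : ∀ {n} (d : Fin n → Carrier) (A : Mat n) k l → (diagonal d ⊙ A) k l ≈ d k * A k l
  diagonal-*ˡ d A k l = trans
    (sum-single k λ j k≢j → trans (*-congʳ (diagonal-off d k j k≢j)) (zeroˡ _))
    (*-congʳ (reflexive (diagonal-on d k)))

  diagonal-*ʳ : ∀ {n} (d : Fin n → Carrier) (A : Mat n) k l → (A ⊙ diagonal d) k l ≈ A k l * d l
  diagonal-*ʳ d A k l = trans
    (sum-single l λ j l≢j → trans (*-congˡ (diagonal-off d j l (l≢j ∘ ≡.sym))) (zeroʳ _))
    (*-congˡ (reflexive (diagonal-on d l)))

  diagonal-conjugate : ∀ {n} (d : Fin n → Carrier) (A : Mat n) k l →
    (diagonal d ⊙ A ⊙ diagonal d) k l ≈ d k * A k l * d l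
  diagonal-conjugate d A k l = trans (diagonal-*ʳ d (diagonal d ⊙ A) k l) (*-congʳ (diagonal-*ˡ d A k l))

  diagonal-involutive : ∀ {n} (d : Fin n → Carrier) → (∀ k → d k * d k ≈ 1#) →
    (diagonal d ⊙ diagonal d) ≋ Scalar 1#
  diagonal-involutive d d²≈1 k l = trans (diagonal-*ˡ d (diagonal d) k l) entry
    where
    entry : d k * diagonal d k l ≈ Scalar 1# k l
    entry with k Fin.≟ l
    ... | yes _ = d²≈1 k
    ... | no  _ = zeroʳ (d k)

-- Polynomial identities

-- Instantiated at ℂ for the characteristic polynomial and at ℝ for the Cauchy-Schwarz step; `ι`
-- supplies the integer constants of the ring solver.
module Polynomials {c ℓ} (R : CommutativeRing c ℓ)
  (ι : ℤ.+-*-rawRing -Raw-AlmostCommutative⟶ fromCommutativeRing R)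
  where

  open CommutativeRing R hiding (zero)
  open Algebra.Properties.Ring ring
  open Algebra.Properties.Semiring.Exp semiring using (_^_)
  open Relation.Binary.Reasoning.Setoid setoid
  open Algebra.Properties.CommutativeMonoid.Sum +-commutativeMonoid using (sum)
  open Algebra.Properties.CommutativeMonoid.Sum *-commutativeMonoid using () renaming
    (sum to product; sum-cong-≋ to product-cong; ∑-distrib-+ to product-*)
  open _-Raw-AlmostCommutative⟶_ ι public using (⟦_⟧; +-homo; *-homo; -‿homo; 0-homo; 1-homo)

  private
    decide : ∀ m n → Maybe (⟦ m ⟧ ≈ ⟦ n ⟧)
    decide m n with m ℤ.≟ n
    ... | yes eq = just (reflexive (cong ⟦_⟧ eq))
    ... | no  _  = nothing

  open Algebra.Solver.Ring ℤ.+-*-rawRing (fromCommutativeRing R) ι decide public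
    using (solve; _:+_; _:*_; _:-_; :-_; _:^_; _:=_; con)

  Separating : ∀ {n} → Vec ℤ n → Set
  Separating = AllPairs (λ m n → n ℤ.- m ≢ 0ℤ)

  val : ∀ {n} → Vec Carrier n → Carrier → Carrier
  val []                  w = 0#
  val (_∷_ {n = n} c cs) w = c * w ^ n + val cs w

  -- Synthetic division by w - a of the polynomial with leading coefficient q and
  -- further coefficients cs.
  divide : ∀ {n} → Carrier → Carrier → Vec Carrier n → Vec Carrier n
  divide a q []       = []
  divide a q (c ∷ cs) = q ∷ divide a (c + a * q) cs

  private
    0≈ : 0# ≈ ⟦ 0ℤ ⟧
    0≈ = sym 0-homo

  -- Factor theorem: the remainder of synthetic division is the value at `a`.
  val-divide : ∀ {n} a q (cs : Vec Carrier n) w →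
    val (q ∷ cs) w - val (q ∷ cs) a ≈ (w - a) * val (divide a q cs) w
  val-divide a q []                  w = trans (-‿inverseʳ _) (sym (zeroʳ _))
  val-divide a q (_∷_ {n = n} c cs) w = begin
    (q * (w * w ^ n) + (c * w ^ n + val cs w)) - (q * (a * a ^ n) + (c * a ^ n + val cs a))
      ≈⟨ solve 8 (λ a q c w wⁿ aⁿ v u →
           (q :* (w :* wⁿ) :+ (c :* wⁿ :+ v)) :- (q :* (a :* aⁿ) :+ (c :* aⁿ :+ u))
             := (w :- a) :* (q :* wⁿ)
                  :+ (((c :+ a :* q) :* wⁿ :+ v) :- ((c :+ a :* q) :* aⁿ :+ u)))
           refl a q c w (w ^ n) (a ^ n) (val cs w) (val cs a) ⟩
    (w - a) * (q * w ^ n) + (val ((c + a * q) ∷ cs) w - val ((c + a * q) ∷ cs) a)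
      ≈⟨ +-congˡ (val-divide a (c + a * q) cs w) ⟩
    (w - a) * (q * w ^ n) + (w - a) * val (divide a (c + a * q) cs) w
      ≈⟨ distribˡ _ _ _ ⟨
    (w - a) * val (divide a q (c ∷ cs)) w ∎

  -- Synthetic division run backwards: quotient and remainder determine the coefficients, so when
  -- both vanish everything does.
  divide-zero : ∀ {n} a q (cs : Vec Carrier n) → VecAll.All (_≈ 0#) (divide a q cs) →
    val (q ∷ cs) a ≈ 0# → VecAll.All (_≈ 0#) (q ∷ cs)
  divide-zero a q [] [] eq = trans (sym (trans (+-identityʳ _) (*-identityʳ q))) eq ∷ []
  divide-zero a q (_∷_ {n = n} c cs) (q≈0 ∷ qs≈0) eq
    with divide-zero a (c + a * q) cs qs≈0
           (trans (solve 5 (λ a q c aⁿ u → (c :+ a :* q) :* aⁿ :+ u := q :* (a :* aⁿ) :+ (c :* aⁿ :+ u))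
             refl a q c (a ^ n) (val cs a)) eq)
  ... | c+aq≈0 ∷ cs≈0 = q≈0 ∷ c≈0 ∷ cs≈0
    where
    c≈0 : c ≈ 0#
    c≈0 = begin
      c                   ≈⟨ solve 3 (λ a q c → c := (c :+ a :* q) :- a :* q) refl a q c ⟩
      (c + a * q) - a * q ≈⟨ +-cong c+aq≈0 (-‿cong (trans (*-congˡ q≈0) (zeroʳ a))) ⟩
      0# - 0#             ≈⟨ -‿inverseʳ 0# ⟩
      0#                  ∎

  -- Multiplication by `w - a`, where `b` is the coefficient just above `cs`, whose shifted copy
  -- contributes `- (a * b)`. With `b = 0` it is the whole product.
  times : ∀ {n} → Carrier → Carrier → Vec Carrier n → Vec Carrier (suc n)
  times a b []       = - (a * b) ∷ []
  times a b (c ∷ cs) = (c - a * b) ∷ times a c cs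

  val-times : ∀ {n} a b (cs : Vec Carrier n) w →
    val (times a b cs) w ≈ (w - a) * val cs w - a * b * w ^ n
  val-times a b [] w = begin
    - (a * b) * 1# + 0#            ≈⟨ +-identityʳ _ ⟩
    - (a * b) * 1#                 ≈⟨ -‿distribˡ-* _ _ ⟨
    - (a * b * 1#)                 ≈⟨ +-identityˡ _ ⟨
    0# - a * b * 1#                ≈⟨ +-congʳ (zeroʳ _) ⟨
    (w - a) * 0# - a * b * 1#      ∎
  val-times a b (_∷_ {n = n} c cs) w = begin
    (c - a * b) * (w * w ^ n) + val (times a c cs) w
      ≈⟨ +-congˡ (val-times a c cs w) ⟩
    (c - a * b) * (w * w ^ n) + ((w - a) * val cs w - a * c * w ^ n)
      ≈⟨ solve 6 (λ a b c w wⁿ v → (c :- a :* b) :* (w :* wⁿ) :+ ((w :- a) :* v :- a :* c :* wⁿ)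
           := (w :- a) :* (c :* wⁿ :+ v) :- a :* b :* (w :* wⁿ)) refl a b c w (w ^ n) (val cs w) ⟩
    (w - a) * (c * w ^ n + val cs w) - a * b * (w * w ^ n) ∎

  monic : ∀ {n} → (Fin n → Carrier) → Vec Carrier (suc n)
  monic {zero}  f = 1# ∷ []
  monic {suc n} f = times (f zero) 0# (monic (f ∘ suc))

  val-monic : ∀ {n} (f : Fin n → Carrier) w → val (monic f) w ≈ product (λ k → w - f k)
  val-monic {zero}  f w = trans (+-identityʳ _) (*-identityʳ 1#)
  val-monic {suc n} f w = begin
    val (times (f zero) 0# (monic (f ∘ suc))) w
      ≈⟨ val-times (f zero) 0# (monic (f ∘ suc)) w ⟩
    (w - f zero) * val (monic (f ∘ suc)) w - f zero * 0# * w ^ suc n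
      ≈⟨ +-congˡ (trans (-‿cong (trans (*-congʳ (zeroʳ _)) (zeroˡ _))) -0#≈0#) ⟩
    (w - f zero) * val (monic (f ∘ suc)) w + 0#
      ≈⟨ +-identityʳ _ ⟩
    (w - f zero) * val (monic (f ∘ suc)) w
      ≈⟨ *-congˡ (val-monic (f ∘ suc) w) ⟩
    product (λ k → w - f k) ∎

  private
    coefficient₀ : ∀ {n} a b (cs : Vec Carrier (suc n)) → lookup (times a b cs) 0F ≈ lookup cs 0F - a * b
    coefficient₀ a b (c ∷ cs) = refl

    coefficient₁ : ∀ {n} a b (cs : Vec Carrier (suc (suc n))) →
      lookup (times a b cs) 1F ≈ lookup cs 1F - a * lookup cs 0F
    coefficient₁ a b (c ∷ d ∷ cs) = refl

  monic-coefficient₀ : ∀ {n} (f : Fin n → Carrier) → lookup (monic f) 0F ≈ 1#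
  monic-coefficient₀ {zero}  f = refl
  monic-coefficient₀ {suc n} f = begin
    lookup (monic f) 0F                          ≈⟨ coefficient₀ (f 0F) 0# (monic (f ∘ suc)) ⟩
    lookup (monic (f ∘ suc)) 0F - f zero * 0#    ≈⟨ +-cong (monic-coefficient₀ (f ∘ suc)) (trans (-‿cong (zeroʳ _)) -0#≈0#) ⟩
    1# + 0#                                      ≈⟨ +-identityʳ 1# ⟩
    1#                                           ∎

  monic-coefficient₁ : ∀ {n} (f : Fin (suc n) → Carrier) → lookup (monic f) 1F ≈ - sum f
  monic-coefficient₁ {zero}  f = -‿cong (trans (*-identityʳ _) (sym (+-identityʳ _)))
  monic-coefficient₁ {suc n} f = begin
    lookup (monic f) 1F
      ≈⟨ coefficient₁ (f zero) 0# (monic (f ∘ suc)) ⟩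
    lookup (monic (f ∘ suc)) 1F - f zero * lookup (monic (f ∘ suc)) 0F
      ≈⟨ +-cong (monic-coefficient₁ (f ∘ suc)) (-‿cong (trans (*-congˡ (monic-coefficient₀ (f ∘ suc))) (*-identityʳ _))) ⟩
    - sum (f ∘ suc) - f zero
      ≈⟨ solve 2 (λ s a → :- s :- a := :- (a :+ s)) refl (sum (f ∘ suc)) (f zero) ⟩
    - sum f ∎

  -- Horner form of `z⁸ - 12 z⁶ + c₄ z⁴ + c₂ z² + c₀` with `w = z²`; 12 is the number of edges of
  -- the cube.
  evenOctic : (c₄ c₂ c₀ w : Carrier) → Carrier
  evenOctic c₄ c₂ c₀ w = (((w - ⟦ + 12 ⟧) * w + c₄) * w + c₂) * w + c₀

  record Factors {d} (c₄ c₂ c₀ : Carrier) (e : Fin d → Carrier) : Set (c ⊔ ℓ) where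
    constructor factors
    field
      factorisation : ∀ z → evenOctic c₄ c₂ c₀ (z * z) ≈ product (λ k → z - e k)

  open Factors

  module Interpolation (cancel : ∀ m x → m ≢ 0ℤ → ⟦ m ⟧ * x ≈ 0# → x ≈ 0#) where

    -- Induction on the roots: the quotient by `w - a` vanishes at the remaining nodes, since each
    -- difference of nodes is a nonzero integer and `cancel` applies.
    vanishing : ∀ {n} {ws : Vec ℤ n} → Separating ws → (cs : Vec Carrier n) →
      VecAll.All (λ w → val cs ⟦ w ⟧ ≈ 0#) ws → VecAll.All (_≈ 0#) cs
    vanishing [] [] [] = []
    vanishing {ws = a ∷ ws} (a≢ ∷ sep) (c ∷ cs) (root ∷ roots) =
      divide-zero ⟦ a ⟧ c cs (vanishing sep (divide ⟦ a ⟧ c cs) (VecAll.map quotient (VecAll.zip (a≢ , roots)))) root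
      where
      quotient : ∀ {w} → (w ℤ.- a ≢ 0ℤ) × val (c ∷ cs) ⟦ w ⟧ ≈ 0# → val (divide ⟦ a ⟧ c cs) ⟦ w ⟧ ≈ 0#
      quotient {w} (w≢a , root′) = cancel (w ℤ.- a) _ w≢a (begin
        ⟦ w ℤ.- a ⟧ * val (divide ⟦ a ⟧ c cs) ⟦ w ⟧     ≈⟨ *-congʳ (trans (+-homo w (ℤ.- a)) (+-congˡ (-‿homo a))) ⟩
        (⟦ w ⟧ - ⟦ a ⟧) * val (divide ⟦ a ⟧ c cs) ⟦ w ⟧ ≈⟨ val-divide ⟦ a ⟧ c cs ⟦ w ⟧ ⟨
        val (c ∷ cs) ⟦ w ⟧ - val (c ∷ cs) ⟦ a ⟧          ≈⟨ +-cong root′ (-‿cong root) ⟩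
        0# - 0#                                          ≈⟨ -‿inverseʳ 0# ⟩
        0#                                               ∎)

    val-difference : ∀ {n} (cs ds : Vec Carrier n) w → val (zipWith _-_ cs ds) w ≈ val cs w - val ds w
    val-difference []       []       w = sym (-‿inverseʳ 0#)
    val-difference (_∷_ {n = n} c cs) (d ∷ ds) w = trans (+-congˡ (val-difference cs ds w))
      (solve 5 (λ c d wⁿ v u → (c :- d) :* wⁿ :+ (v :- u) := (c :* wⁿ :+ v) :- (d :* wⁿ :+ u))
        refl c d (w ^ n) (val cs w) (val ds w))

    interpolation : ∀ {n} {ws : Vec ℤ n} → Separating ws → (cs ds : Vec Carrier n) →
      VecAll.All (λ w → val cs ⟦ w ⟧ ≈ val ds ⟦ w ⟧) ws → ∀ k → lookup cs k ≈ lookup ds k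
    interpolation sep cs ds same = coefficients cs ds (vanishing sep (zipWith _-_ cs ds)
      (VecAll.map (λ {w} eq → trans (val-difference cs ds ⟦ w ⟧) (trans (+-congʳ eq) (-‿inverseʳ _))) same))
      where
      coefficients : ∀ {n} (cs ds : Vec Carrier n) → VecAll.All (_≈ 0#) (zipWith _-_ cs ds) → ∀ k → lookup cs k ≈ lookup ds k
      coefficients (c ∷ cs) (d ∷ ds) (eq ∷ _) zero    = begin
        c           ≈⟨ solve 2 (λ c d → c := (c :- d) :+ d) refl c d ⟩
        (c - d) + d ≈⟨ +-congʳ eq ⟩
        0# + d      ≈⟨ +-identityˡ d ⟩
        d           ∎
      coefficients (c ∷ cs) (d ∷ ds) (_ ∷ eqs) (suc k) = coefficients cs ds eqs k

    -- Nine nodes for the nine coefficients of a polynomial of degree 8 in `w`; squares, because the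
    -- identities are available only at arguments `z * z`.
    squares : Vec ℤ 9
    squares = + 0 ∷ + 1 ∷ + 4 ∷ + 9 ∷ + 16 ∷ + 25 ∷ + 36 ∷ + 49 ∷ + 64 ∷ []

    squares-separating : Separating squares
    squares-separating = toWitness {a? = allPairs? (λ m n → ¬? (n ℤ.- m ℤ.≟ 0ℤ)) squares} _

    square-argument : ∀ {P : Carrier → Set ℓ} → (∀ {v w} → v ≈ w → P v → P w) →
      (∀ z → P (z * z)) → VecAll.All (λ w → P ⟦ w ⟧) squares
    square-argument {P} resp p = at (+ 0) ∷ at (+ 1) ∷ at (+ 2) ∷ at (+ 3) ∷ at (+ 4)
      ∷ at (+ 5) ∷ at (+ 6) ∷ at (+ 7) ∷ at (+ 8) ∷ []
      where
      at : ∀ m → P ⟦ m ℤ.* m ⟧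
      at m = resp (sym (*-homo m m)) (p ⟦ m ⟧)

    module EvenOctic (c₄ c₂ c₀ : Carrier) (e : Fin 8 → Carrier)
      (octic : Factors c₄ c₂ c₀ e)
      where

      private
        even : Carrier → Carrier
        even = evenOctic c₄ c₂ c₀

        f : Fin 8 → Carrier
        f k = e k * e k

      even-cong : ∀ {v w} → v ≈ w → even v ≈ even w
      even-cong eq = +-congʳ (*-cong (+-congʳ (*-cong (+-congʳ (*-cong (+-congʳ eq) eq)) eq)) eq)

      -- The expanded square of `evenOctic`, leading coefficient first. The entries at `1F` and
      -- `2F`, belonging to `w⁷` and `w⁶`, carry the argument: the first gives the sum of the
      -- squares, the second determines `c₄`.
      even² : Vec Carrier 9
      even² = ⟦ 1ℤ ⟧ ∷ ⟦ -[1+ 23 ] ⟧ ∷ (⟦ + 144 ⟧ + (c₄ + c₄)) ∷ (c₂ + c₂ - ⟦ + 24 ⟧ * c₄)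
        ∷ (c₀ + c₀ - ⟦ + 24 ⟧ * c₂ + c₄ * c₄) ∷ (⟦ + 2 ⟧ * (c₄ * c₂) - ⟦ + 24 ⟧ * c₀)
        ∷ (⟦ + 2 ⟧ * (c₄ * c₀) + c₂ * c₂) ∷ ⟦ + 2 ⟧ * (c₂ * c₀) ∷ c₀ * c₀ ∷ []

      val-even² : ∀ w → val even² w ≈ even w * even w
      val-even² w = trans (+-congˡ (+-congˡ (+-congˡ (+-congˡ (+-congˡ (+-congˡ (+-congˡ (+-congˡ (+-congˡ 0≈)))))))))
        (solve 4 (λ a b d w →
          let p = (((w :- con (+ 12)) :* w :+ a) :* w :+ b) :* w :+ d
          in con 1ℤ :* w :^ 8 :+ (con -[1+ 23 ] :* w :^ 7 :+ ((con (+ 144) :+ (a :+ a)) :* w :^ 6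
             :+ ((b :+ b :- con (+ 24) :* a) :* w :^ 5 :+ ((d :+ d :- con (+ 24) :* b :+ a :* a) :* w :^ 4
             :+ ((con (+ 2) :* (a :* b) :- con (+ 24) :* d) :* w :^ 3 :+ ((con (+ 2) :* (a :* d) :+ b :* b) :* w :^ 2
             :+ (con (+ 2) :* (b :* d) :* w :^ 1 :+ (d :* d :* w :^ 0 :+ con 0ℤ))))))))
             := p :* p) refl c₄ c₂ c₀ w)

      -- The left side is unchanged by `z ↦ -z`, so one factor may be expanded at `- z`. Then
      -- `(z - e)(-z - e) = -(z² - e²)`, and the eight minus signs cancel in pairs.
      even-square : ∀ z → even (z * z) * even (z * z) ≈ product (λ k → z * z - f k)
      even-square z = begin
        even w * even w
          ≈⟨ *-cong (factorisation octic z) (trans (even-cong (solve 1 (λ z → z :* z := :- z :* :- z) refl z)) (factorisation octic (- z))) ⟩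
        product (λ k → z - e k) * product (λ k → - z - e k)
          ≈⟨ product-* (λ k → z - e k) (λ k → - z - e k) ⟨
        product (λ k → (z - e k) * (- z - e k))
          ≈⟨ product-cong (λ k → solve 2 (λ z a → (z :- a) :* (:- z :- a) := :- (z :* z :- a :* a)) refl z (e k)) ⟩
        product (λ k → - (w - f k))
          ≈⟨ eight-negations (λ k → w - f k) ⟩
        product (λ k → w - f k) ∎
        where
        w = z * z
        pair : ∀ x y {u v} → u ≈ v → - x * (- y * u) ≈ x * (y * v)
        pair x y {u} eq = trans (solve 3 (λ x y u → :- x :* (:- y :* u) := x :* (y :* u)) refl x y u)
          (*-congˡ (*-congˡ eq))
        eight-negations : (g : Fin 8 → Carrier) → product (λ k → - g k) ≈ product g
        eight-negations g = pair _ _ (pair _ _ (pair _ _ (pair _ _ refl)))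

      even²-coefficients : (ds : Vec Carrier 9) → (∀ z → val ds (z * z) ≈ product (λ k → z * z - f k)) →
        ∀ k → lookup even² k ≈ lookup ds k
      even²-coefficients ds same = interpolation squares-separating even² ds
        (square-argument {λ w → val even² w ≈ val ds w}
          (λ eq same → trans (val-cong even² (sym eq)) (trans same (val-cong ds eq)))
          (λ z → trans (val-even² (z * z)) (trans (even-square z) (sym (same z)))))
        where
        ^-cong : ∀ n {v w} → v ≈ w → v ^ n ≈ w ^ n
        ^-cong zero    eq = refl
        ^-cong (suc n) eq = *-cong eq (^-cong n eq)
        val-cong : ∀ {n} (cs : Vec Carrier n) {v w} → v ≈ w → val cs v ≈ val cs w
        val-cong []                 eq = refl
        val-cong (_∷_ {n = n} c cs) eq = +-cong (*-congˡ (^-cong n eq)) (val-cong cs eq)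

      -- Vieta's formula for the coefficient of `w⁷`, which is -2·12 on the other side.
      sum-squares : sum (λ k → e k * e k) ≈ ⟦ + 24 ⟧
      sum-squares = begin
        sum f           ≈⟨ -‿involutive _ ⟨
        - - sum f       ≈⟨ -‿cong (trans (even²-coefficients (monic f) (λ z → val-monic f (z * z)) 1F) (monic-coefficient₁ f)) ⟨
        - ⟦ -[1+ 23 ] ⟧ ≈⟨ -‿homo -[1+ 23 ] ⟨
        ⟦ + 24 ⟧        ∎

      -- Comparing coefficients of `w⁶` gives `144 + 2 c₄ = 9·C(8,2) = 252`.
      equal-squares⇒c₄ : (∀ k → e k * e k ≈ ⟦ + 3 ⟧) → c₄ ≈ ⟦ + 54 ⟧
      equal-squares⇒c₄ f≈3 = begin
        c₄ ≈⟨ solve 1 (λ c → c := c :- con (+ 54) :+ con (+ 54)) refl c₄ ⟩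
        c₄ - ⟦ + 54 ⟧ + ⟦ + 54 ⟧ ≈⟨ +-congʳ (cancel (+ 2) _ (λ ()) (begin
          ⟦ + 2 ⟧ * (c₄ - ⟦ + 54 ⟧)
            ≈⟨ solve 1 (λ c → con (+ 2) :* (c :- con (+ 54)) := (con (+ 144) :+ (c :+ c)) :- con (+ 252)) refl c₄ ⟩
          (⟦ + 144 ⟧ + (c₄ + c₄)) - ⟦ + 252 ⟧
            ≈⟨ +-congʳ (even²-coefficients [w-3]⁸ (λ z → trans (val-[w-3]⁸ (z * z))
                 (product-cong {8} (λ k → +-congˡ {x = z * z} (-‿cong (sym (f≈3 k)))))) 2F) ⟩
          ⟦ + 252 ⟧ - ⟦ + 252 ⟧
            ≈⟨ -‿inverseʳ _ ⟩
          0# ∎)) ⟩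
        0# + ⟦ + 54 ⟧ ≈⟨ +-identityˡ _ ⟩
        ⟦ + 54 ⟧ ∎
        where
        [w-3]⁸ : Vec Carrier 9
        [w-3]⁸ = ⟦ + 1 ⟧ ∷ ⟦ -[1+ 23 ] ⟧ ∷ ⟦ + 252 ⟧ ∷ ⟦ -[1+ 1511 ] ⟧ ∷ ⟦ + 5670 ⟧ ∷ ⟦ -[1+ 13607 ] ⟧ ∷ ⟦ + 20412 ⟧ ∷ ⟦ -[1+ 17495 ] ⟧ ∷ ⟦ + 6561 ⟧ ∷ []
        val-[w-3]⁸ : ∀ w → val [w-3]⁸ w ≈ product {8} (λ _ → w - ⟦ + 3 ⟧)
        val-[w-3]⁸ w = trans
          (+-congˡ (+-congˡ (+-congˡ (+-congˡ (+-congˡ (+-congˡ (+-congˡ (+-congˡ (+-congˡ 0≈)))))))))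
          (solve 1 (λ w → con (+ 1) :* w :^ 8 :+ (con -[1+ 23 ] :* w :^ 7 :+ (con (+ 252) :* w :^ 6 :+ (con -[1+ 1511 ] :* w :^ 5 
            :+ (con (+ 5670) :* w :^ 4 :+ (con -[1+ 13607 ] :* w :^ 3 :+ (con (+ 20412) :* w :^ 2 :+ (con -[1+ 17495 ] :* w :^ 1 
            :+ (con (+ 6561) :* w :^ 0 :+ con 0ℤ))))))))
            := (w :- con (+ 3)) :^ 8) refl w)

  -- Equality in the Cauchy-Schwarz inequality for x and the constant vector r.
  sum-deviations : (x : Fin 8 → Carrier) (r : Carrier) → sum (λ k → x k * x k) ≈ ⟦ + 24 ⟧ →
    sum x ≈ ⟦ + 8 ⟧ * r → r * r ≈ ⟦ + 3 ⟧ → sum (λ k → (x k - r) * (x k - r)) ≈ 0#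
  sum-deviations x r Σx² Σx r² = begin
    sum (λ k → (x k - r) * (x k - r))
      ≈⟨ expand {8} x ⟩
    sum (λ k → x k * x k) - ⟦ + 2 ⟧ * r * sum x + sum {8} (λ _ → r * r)
      ≈⟨ +-cong (+-cong Σx² (-‿cong (*-congˡ Σx))) (trans (eight (r * r)) (*-congˡ r²)) ⟩
    ⟦ + 24 ⟧ - ⟦ + 2 ⟧ * r * (⟦ + 8 ⟧ * r) + ⟦ + 8 ⟧ * ⟦ + 3 ⟧
      ≈⟨ solve 1 (λ r → con (+ 24) :- con (+ 2) :* r :* (con (+ 8) :* r) :+ con (+ 8) :* con (+ 3)
           := con (+ 48) :- con (+ 16) :* (r :* r)) refl r ⟩
    ⟦ + 48 ⟧ - ⟦ + 16 ⟧ * (r * r)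
      ≈⟨ +-congˡ (-‿cong (*-congˡ r²)) ⟩
    ⟦ + 48 ⟧ - ⟦ + 16 ⟧ * ⟦ + 3 ⟧
      ≈⟨ solve 0 (con (+ 48) :- con (+ 16) :* con (+ 3) := con 0ℤ) refl ⟩
    ⟦ 0ℤ ⟧
      ≈⟨ 0-homo ⟩
    0# ∎
    where
    expand : ∀ {n} (x : Fin n → Carrier) → sum (λ k → (x k - r) * (x k - r))
      ≈ sum (λ k → x k * x k) - ⟦ + 2 ⟧ * r * sum x + sum {n} (λ _ → r * r)
    expand {zero} x = sym (trans (+-cong (trans (+-congˡ (trans (-‿cong (zeroʳ _)) -0#≈0#)) (+-identityʳ _)) refl) (+-identityʳ _))
    expand {suc n} x = trans (+-congˡ (expand (x ∘ suc)))
      (solve 5 (λ r a s t u → (a :- r) :* (a :- r) :+ (s :- con (+ 2) :* r :* t :+ u)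
        := (a :* a :+ s) :- con (+ 2) :* r :* (a :+ t) :+ (r :* r :+ u)) refl
        r (x zero) (sum (λ k → x (suc k) * x (suc k))) (sum (x ∘ suc)) (sum {n} (λ _ → r * r)))
    eight : ∀ a → sum {8} (λ _ → a) ≈ ⟦ + 8 ⟧ * a
    eight a = trans (+-congˡ (+-congˡ (+-congˡ (+-congˡ (+-congˡ (+-congˡ (+-congˡ (+-congˡ 0≈))))))))
      (solve 1 (λ a → a :+ (a :+ (a :+ (a :+ (a :+ (a :+ (a :+ (a :+ con 0ℤ)))))))
        := con (+ 8) :* a) refl a)

-- The characteristic polynomial of a generic mixed cube

-- The exponents of the powers of the imaginary unit, modulo 4.
data ℤ₄ : Set where
  𝟘 𝟙 𝟚 𝟛 : ℤ₄

infixl 6 _⊕_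
infixl 7 _⊗_

sucℤ₄ : ℤ₄ → ℤ₄
sucℤ₄ 𝟘 = 𝟙
sucℤ₄ 𝟙 = 𝟚
sucℤ₄ 𝟚 = 𝟛
sucℤ₄ 𝟛 = 𝟘

_⊕_ : ℤ₄ → ℤ₄ → ℤ₄
𝟘 ⊕ b = b
𝟙 ⊕ b = sucℤ₄ b
𝟚 ⊕ b = sucℤ₄ (sucℤ₄ b)
𝟛 ⊕ b = sucℤ₄ (sucℤ₄ (sucℤ₄ b))

⊖_ : ℤ₄ → ℤ₄
⊖ 𝟘 = 𝟘
⊖ 𝟙 = 𝟛
⊖ 𝟚 = 𝟚
⊖ 𝟛 = 𝟙

_⊗_ : ℤ₄ → ℤ₄ → ℤ₄
𝟘 ⊗ b = 𝟘
𝟙 ⊗ b = b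
𝟚 ⊗ b = b ⊕ b
𝟛 ⊗ b = ⊖ b

∀ℤ₄ : {P : ℤ₄ → Set} → P 𝟘 → P 𝟙 → P 𝟚 → P 𝟛 → ∀ a → P a
∀ℤ₄ p q r s 𝟘 = p
∀ℤ₄ p q r s 𝟙 = q
∀ℤ₄ p q r s 𝟚 = r
∀ℤ₄ p q r s 𝟛 = s

infix 4 _≟₄_

_≟₄_ : DecidableEquality ℤ₄
𝟘 ≟₄ 𝟘 = yes ≡.refl
𝟘 ≟₄ 𝟙 = no λ ()
𝟘 ≟₄ 𝟚 = no λ ()
𝟘 ≟₄ 𝟛 = no λ ()
𝟙 ≟₄ 𝟘 = no λ ()
𝟙 ≟₄ 𝟙 = yes ≡.refl
𝟙 ≟₄ 𝟚 = no λ ()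
𝟙 ≟₄ 𝟛 = no λ ()
𝟚 ≟₄ 𝟘 = no λ ()
𝟚 ≟₄ 𝟙 = no λ ()
𝟚 ≟₄ 𝟚 = yes ≡.refl
𝟚 ≟₄ 𝟛 = no λ ()
𝟛 ≟₄ 𝟘 = no λ ()
𝟛 ≟₄ 𝟙 = no λ ()
𝟛 ≟₄ 𝟚 = no λ ()
𝟛 ≟₄ 𝟛 = yes ≡.refl

⊕-identityʳ : ∀ a → a ⊕ 𝟘 ≡ a
⊕-identityʳ = ∀ℤ₄ ≡.refl ≡.refl ≡.refl ≡.refl

⊕-comm : ∀ a b → a ⊕ b ≡ b ⊕ a
⊕-comm = ∀ℤ₄ (∀ℤ₄ ≡.refl ≡.refl ≡.refl ≡.refl) (∀ℤ₄ ≡.refl ≡.refl ≡.refl ≡.refl)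
  (∀ℤ₄ ≡.refl ≡.refl ≡.refl ≡.refl) (∀ℤ₄ ≡.refl ≡.refl ≡.refl ≡.refl)

sucℤ₄-⊕ : ∀ a b → sucℤ₄ a ⊕ b ≡ sucℤ₄ (a ⊕ b)
sucℤ₄-⊕ 𝟘 b = ≡.refl
sucℤ₄-⊕ 𝟙 b = ≡.refl
sucℤ₄-⊕ 𝟚 b = ≡.refl
sucℤ₄-⊕ 𝟛 b = ∀ℤ₄ {λ b → b ≡ sucℤ₄ (sucℤ₄ (sucℤ₄ (sucℤ₄ b)))} ≡.refl ≡.refl ≡.refl ≡.refl b

⊕-assoc : ∀ a b c → (a ⊕ b) ⊕ c ≡ a ⊕ (b ⊕ c)
⊕-assoc 𝟘 b c = ≡.refl
⊕-assoc 𝟙 b c = sucℤ₄-⊕ b c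
⊕-assoc 𝟚 b c = ≡.trans (sucℤ₄-⊕ (sucℤ₄ b) c) (cong sucℤ₄ (sucℤ₄-⊕ b c))
⊕-assoc 𝟛 b c = ≡.trans (sucℤ₄-⊕ (sucℤ₄ (sucℤ₄ b)) c)
  (cong sucℤ₄ (≡.trans (sucℤ₄-⊕ (sucℤ₄ b) c) (cong sucℤ₄ (sucℤ₄-⊕ b c))))

⊖-⊕ : ∀ a b → ⊖ (a ⊕ b) ≡ ⊖ a ⊕ ⊖ b
⊖-⊕ = ∀ℤ₄ (∀ℤ₄ ≡.refl ≡.refl ≡.refl ≡.refl) (∀ℤ₄ ≡.refl ≡.refl ≡.refl ≡.refl)
  (∀ℤ₄ ≡.refl ≡.refl ≡.refl ≡.refl) (∀ℤ₄ ≡.refl ≡.refl ≡.refl ≡.refl)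

⊗-distribʳ : ∀ c a b → (a ⊕ b) ⊗ c ≡ a ⊗ c ⊕ b ⊗ c
⊗-distribʳ 𝟘 = ∀ℤ₄ (∀ℤ₄ ≡.refl ≡.refl ≡.refl ≡.refl) (∀ℤ₄ ≡.refl ≡.refl ≡.refl ≡.refl)
  (∀ℤ₄ ≡.refl ≡.refl ≡.refl ≡.refl) (∀ℤ₄ ≡.refl ≡.refl ≡.refl ≡.refl)
⊗-distribʳ 𝟙 = ∀ℤ₄ (∀ℤ₄ ≡.refl ≡.refl ≡.refl ≡.refl) (∀ℤ₄ ≡.refl ≡.refl ≡.refl ≡.refl)
  (∀ℤ₄ ≡.refl ≡.refl ≡.refl ≡.refl) (∀ℤ₄ ≡.refl ≡.refl ≡.refl ≡.refl)
⊗-distribʳ 𝟚 = ∀ℤ₄ (∀ℤ₄ ≡.refl ≡.refl ≡.refl ≡.refl) (∀ℤ₄ ≡.refl ≡.refl ≡.refl ≡.refl)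
  (∀ℤ₄ ≡.refl ≡.refl ≡.refl ≡.refl) (∀ℤ₄ ≡.refl ≡.refl ≡.refl ≡.refl)
⊗-distribʳ 𝟛 = ∀ℤ₄ (∀ℤ₄ ≡.refl ≡.refl ≡.refl ≡.refl) (∀ℤ₄ ≡.refl ≡.refl ≡.refl ≡.refl)
  (∀ℤ₄ ≡.refl ≡.refl ≡.refl ≡.refl) (∀ℤ₄ ≡.refl ≡.refl ≡.refl ≡.refl)

⊖-⊗ : ∀ a c → (⊖ a) ⊗ c ≡ ⊖ (a ⊗ c)
⊖-⊗ = ∀ℤ₄ (∀ℤ₄ ≡.refl ≡.refl ≡.refl ≡.refl) (∀ℤ₄ ≡.refl ≡.refl ≡.refl ≡.refl)
  (∀ℤ₄ ≡.refl ≡.refl ≡.refl ≡.refl) (∀ℤ₄ ≡.refl ≡.refl ≡.refl ≡.refl)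

-- If edge `k` has weight `i` to the power `s_k`, the monomial with exponent vector `m` takes the
-- value `i` to the power `m · s`.
_·_ : ∀ {n} → Vec ℤ₄ n → Vec ℤ₄ n → ℤ₄
[]       · []       = 𝟘
(a ∷ as) · (b ∷ bs) = a ⊗ b ⊕ as · bs

·-⊕ : ∀ {n} (as bs cs : Vec ℤ₄ n) → zipWith _⊕_ as bs · cs ≡ as · cs ⊕ bs · cs
·-⊕ []       []       []       = ≡.refl
·-⊕ (a ∷ as) (b ∷ bs) (c ∷ cs) = begin
  (a ⊕ b) ⊗ c ⊕ zipWith _⊕_ as bs · cs       ≡⟨ cong₂ _⊕_ (⊗-distribʳ c a b) (·-⊕ as bs cs) ⟩
  (a ⊗ c ⊕ b ⊗ c) ⊕ (as · cs ⊕ bs · cs)      ≡⟨ ⊕-assoc (a ⊗ c) (b ⊗ c) _ ⟩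
  a ⊗ c ⊕ (b ⊗ c ⊕ (as · cs ⊕ bs · cs))      ≡⟨ cong (a ⊗ c ⊕_) (⊕-assoc (b ⊗ c) (as · cs) _) ⟨
  a ⊗ c ⊕ ((b ⊗ c ⊕ as · cs) ⊕ bs · cs)      ≡⟨ cong (λ d → a ⊗ c ⊕ (d ⊕ bs · cs)) (⊕-comm (b ⊗ c) (as · cs)) ⟩
  a ⊗ c ⊕ ((as · cs ⊕ b ⊗ c) ⊕ bs · cs)      ≡⟨ cong (a ⊗ c ⊕_) (⊕-assoc (as · cs) (b ⊗ c) _) ⟩
  a ⊗ c ⊕ (as · cs ⊕ (b ⊗ c ⊕ bs · cs))      ≡⟨ ⊕-assoc (a ⊗ c) (as · cs) _ ⟨
  (a ⊗ c ⊕ as · cs) ⊕ (b ⊗ c ⊕ bs · cs)      ∎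
  where open ≡.≡-Reasoning

·-zero : ∀ {n} (cs : Vec ℤ₄ n) → replicate n 𝟘 · cs ≡ 𝟘
·-zero []       = ≡.refl
·-zero (c ∷ cs) = ·-zero cs

·-⊖ : ∀ {n} (as cs : Vec ℤ₄ n) → Vec.map ⊖_ as · cs ≡ ⊖ (as · cs)
·-⊖ []       []       = ≡.refl
·-⊖ (a ∷ as) (c ∷ cs) = ≡.trans (cong₂ _⊕_ (⊖-⊗ a c) (·-⊖ as cs)) (≡.sym (⊖-⊕ (a ⊗ c) (as · cs)))

unit : ∀ {n} → Fin n → ℤ₄ → Vec ℤ₄ n
unit zero    a = a ∷ replicate _ 𝟘
unit (suc k) a = 𝟘 ∷ unit k a

·-unit : ∀ {n} (k : Fin n) a (cs : Vec ℤ₄ n) → unit k a · cs ≡ a ⊗ lookup cs k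
·-unit zero    a (c ∷ cs) = ≡.trans (cong (a ⊗ c ⊕_) (·-zero cs)) (⊕-identityʳ (a ⊗ c))
·-unit (suc k) a (c ∷ cs) = ·-unit k a cs

-- The group ring ℤ[ℤ₄ⁿ][z]: the term (c , k , m) is c zᵏ xᵐ.
Monomial : ℕ → Set
Monomial n = Vec ℤ₄ n

Term : ℕ → Set
Term n = ℤ × ℕ × Monomial n

module _ {n : ℕ} where

  _·ₜ_ : Term n → Term n → Term n
  (c , k , m) ·ₜ (c′ , k′ , m′) = c ℤ.* c′ , k ℕ.+ k′ , zipWith _⊕_ m m′

  -ₜ_ : Term n → Term n
  -ₜ (c , k , m) = ℤ.- c , k , m

  _·ₗ_ : List (Term n) → List (Term n) → List (Term n)
  []       ·ₗ ys = []
  (t ∷ xs) ·ₗ ys = map (t ·ₜ_) ys ++ xs ·ₗ ys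

  addTerm : ℤ → Monomial n → List (ℤ × Monomial n) → List (ℤ × Monomial n)
  addTerm c m []             = (c , m) ∷ []
  addTerm c m ((d , m′) ∷ p) with Vec.≡-dec _≟₄_ m m′
  ... | yes _ = (c ℤ.+ d , m′) ∷ p
  ... | no  _ = (d , m′) ∷ addTerm c m p

  addPower : Term n → List (List (ℤ × Monomial n)) → List (List (ℤ × Monomial n))
  addPower (c , zero  , m) []       = ((c , m) ∷ []) ∷ []
  addPower (c , zero  , m) (p ∷ ps) = addTerm c m p ∷ ps
  addPower (c , suc k , m) []       = [] ∷ addPower (c , k , m) []
  addPower (c , suc k , m) (p ∷ ps) = p ∷ addPower (c , k , m) ps

  -- The outer list is indexed by the power of `z`, lowest first. Multiplication and addition merge
  -- nothing, so like terms meet only here.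
  collect : List (Term n) → List (List (ℤ × Monomial n))
  collect = foldr addPower []

formalRing : ℕ → RawRing 0ℓ 0ℓ
formalRing n = record
  { Carrier = List (Term n) ; _≈_ = _≡_ ; _+_ = _++_ ; _*_ = _·ₗ_ ; -_ = map -ₜ_
  ; 0# = [] ; 1# = (1ℤ , 0 , replicate n 𝟘) ∷ [] }

-- The position of an edge in `cubeEdges`, with `true` when it is traversed in the
-- direction in which it is listed there.
edgeAt : Fin 8 → Fin 8 → Maybe (Fin 12 × Bool)
edgeAt 0F 1F = just (0F , true)
edgeAt 1F 0F = just (0F , false)
edgeAt 2F 3F = just (1F , true)
edgeAt 3F 2F = just (1F , false)
edgeAt 4F 5F = just (2F , true)
edgeAt 5F 4F = just (2F , false)
edgeAt 6F 7F = just (3F , true)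
edgeAt 7F 6F = just (3F , false)
edgeAt 0F 2F = just (4F , true)
edgeAt 2F 0F = just (4F , false)
edgeAt 1F 3F = just (5F , true)
edgeAt 3F 1F = just (5F , false)
edgeAt 4F 6F = just (6F , true)
edgeAt 6F 4F = just (6F , false)
edgeAt 5F 7F = just (7F , true)
edgeAt 7F 5F = just (7F , false)
edgeAt 0F 4F = just (8F , true)
edgeAt 4F 0F = just (8F , false)
edgeAt 1F 5F = just (9F , true)
edgeAt 5F 1F = just (9F , false)
edgeAt 2F 6F = just (suc 9F , true)
edgeAt 6F 2F = just (suc 9F , false)
edgeAt 3F 7F = just (suc (suc 9F) , true)
edgeAt 7F 3F = just (suc (suc 9F) , false)
edgeAt _ _ = nothing

-- The exponent `𝟛` is -1 modulo 4: the Hermitian matrix has the conjugate, that is inverse, weight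
-- in the opposite direction.
edgeEntry : Maybe (Fin 12 × Bool) → List (Term 12)
edgeEntry nothing            = []
edgeEntry (just (k , true))  = (1ℤ , 0 , unit k 𝟙) ∷ []
edgeEntry (just (k , false)) = (1ℤ , 0 , unit k 𝟛) ∷ []

formalVariable : List (Term 12)
formalVariable = (1ℤ , 1 , replicate 12 𝟘) ∷ []

formalAdjacency : Matrices.Matrix (formalRing 12) 8
formalAdjacency u v = edgeEntry (edgeAt u v)

-- Exponent vectors of the closed walks around the faces, each run against the order of its
-- subscripts: `face₁₂₄₃` is the walk 1, 3, 4, 2, 1.
face₁₂₄₃ face₁₂₆₅ face₁₃₇₅ face₂₄₈₆ face₃₄₈₇ face₅₆₈₇ : Monomial 12
face₁₂₄₃ = 𝟛 ∷ 𝟙 ∷ 𝟘 ∷ 𝟘 ∷ 𝟙 ∷ 𝟛 ∷ 𝟘 ∷ 𝟘 ∷ 𝟘 ∷ 𝟘 ∷ 𝟘 ∷ 𝟘 ∷ []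
face₁₂₆₅ = 𝟛 ∷ 𝟘 ∷ 𝟙 ∷ 𝟘 ∷ 𝟘 ∷ 𝟘 ∷ 𝟘 ∷ 𝟘 ∷ 𝟙 ∷ 𝟛 ∷ 𝟘 ∷ 𝟘 ∷ []
face₁₃₇₅ = 𝟘 ∷ 𝟘 ∷ 𝟘 ∷ 𝟘 ∷ 𝟛 ∷ 𝟘 ∷ 𝟙 ∷ 𝟘 ∷ 𝟙 ∷ 𝟘 ∷ 𝟛 ∷ 𝟘 ∷ []
face₂₄₈₆ = 𝟘 ∷ 𝟘 ∷ 𝟘 ∷ 𝟘 ∷ 𝟘 ∷ 𝟛 ∷ 𝟘 ∷ 𝟙 ∷ 𝟘 ∷ 𝟙 ∷ 𝟘 ∷ 𝟛 ∷ []
face₃₄₈₇ = 𝟘 ∷ 𝟛 ∷ 𝟘 ∷ 𝟙 ∷ 𝟘 ∷ 𝟘 ∷ 𝟘 ∷ 𝟘 ∷ 𝟘 ∷ 𝟘 ∷ 𝟙 ∷ 𝟛 ∷ []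
face₅₆₈₇ = 𝟘 ∷ 𝟘 ∷ 𝟛 ∷ 𝟙 ∷ 𝟘 ∷ 𝟘 ∷ 𝟙 ∷ 𝟛 ∷ 𝟘 ∷ 𝟘 ∷ 𝟘 ∷ 𝟘 ∷ []

-- The coefficient -1 is the sign of a 4-cycle, and each face occurs once in each direction. The
-- terms stand in the order in which `collect` produces them, so that comparison is by `refl`.
quartic : List (ℤ × Monomial 12)
quartic = (+ 42 , replicate 12 𝟘)
  ∷ (-[1+ 0 ] , face₁₃₇₅)
  ∷ (-[1+ 0 ] , face₁₂₆₅)
  ∷ (-[1+ 0 ] , Vec.map ⊖_ face₁₃₇₅)
  ∷ (-[1+ 0 ] , face₁₂₄₃)
  ∷ (-[1+ 0 ] , Vec.map ⊖_ face₁₂₆₅)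
  ∷ (-[1+ 0 ] , Vec.map ⊖_ face₁₂₄₃)
  ∷ (-[1+ 0 ] , face₂₄₈₆)
  ∷ (-[1+ 0 ] , Vec.map ⊖_ face₂₄₈₆)
  ∷ (-[1+ 0 ] , face₃₄₈₇)
  ∷ (-[1+ 0 ] , Vec.map ⊖_ face₃₄₈₇)
  ∷ (-[1+ 0 ] , face₅₆₈₇)
  ∷ (-[1+ 0 ] , Vec.map ⊖_ face₅₆₈₇) ∷ []

-- Powers ascend, and `[]` marks the odd ones, for which the bipartite cube yields no terms.
CollectsToEvenOctic : List (Term 12) → Set
CollectsToEvenOctic p = ∃[ c₀ ] ∃[ c₂ ] (collect p ≡ c₀ ∷ [] ∷ c₂ ∷ [] ∷ quartic ∷ []
  ∷ ((-[1+ 11 ] , replicate 12 𝟘) ∷ []) ∷ [] ∷ ((1ℤ , replicate 12 𝟘) ∷ []) ∷ [])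

abstract
  -- The symbolic 8 × 8 determinant is normalised here, in the check of the last `refl`. Being
  -- abstract, it is afterwards known only through the two recorded properties and is not expanded
  -- again.
  formalCharPoly : ∃[ p ]
    (p ≡ Matrices.charPoly (formalRing 12) formalAdjacency formalVariable × CollectsToEvenOctic p)
  formalCharPoly = Matrices.charPoly (formalRing 12) formalAdjacency formalVariable , ≡.refl , _ , _ , ≡.refl

entryOf : Vec ℤ₄ 12 → Maybe (Fin 12 × Bool) → Maybe ℤ₄
entryOf s nothing            = nothing
entryOf s (just (k , true))  = just (lookup s k)
entryOf s (just (k , false)) = just (⊖ lookup s k)

entry : Vec ℤ₄ 12 → Fin 8 → Fin 8 → Maybe ℤ₄
entry s u v = entryOf s (edgeAt u v)

-- iᵃ + i⁻ᵃ
twiceRe : ℤ₄ → ℤ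
twiceRe 𝟘 = + 2
twiceRe 𝟙 = + 0
twiceRe 𝟚 = -[1+ 1 ]
twiceRe 𝟛 = + 0

sign : Bool → ℤ₄
sign true  = 𝟚
sign false = 𝟘

switch : Bool → Bool → Maybe ℤ₄ → Maybe ℤ₄
switch a b = Maybe.map (λ k → sign a ⊕ k ⊕ sign b)

-- `ρ` stands for the character `a ↦ iᵃ` of ℤ₄.
module Evaluation {c ℓ} (R : CommutativeRing c ℓ)
  (ι : ℤ.+-*-rawRing -Raw-AlmostCommutative⟶ fromCommutativeRing R)
  (ρ : ℤ₄ → CommutativeRing.Carrier R)
  (ρ-𝟘 : CommutativeRing._≈_ R (ρ 𝟘) (CommutativeRing.1# R))
  (ρ-⊕ : ∀ a b → CommutativeRing._≈_ R (ρ (a ⊕ b)) (CommutativeRing._*_ R (ρ a) (ρ b)))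
  where

  open CommutativeRing R hiding (zero)
  open Algebra.Properties.Ring ring
  open Algebra.Properties.Semiring.Exp semiring using (_^_; ^-homo-*)
  open Relation.Binary.Reasoning.Setoid setoid
  open Polynomials R ι
  open Determinant R
  open Matrices rawRing using () renaming
    (Matrix to Mat; charPoly to CharPoly; scalar to Scalar; _≈ᴹ_ to _≋_; _·ᴹ_ to _⊙_)

  evaluateCoefficient : ∀ {n} → Vec ℤ₄ n → List (ℤ × Monomial n) → Carrier
  evaluateCoefficient s = foldr (λ (c , m) x → ⟦ c ⟧ * ρ (m · s) + x) 0#

  module _ {n} (s : Vec ℤ₄ n) (z : Carrier) where

    term : Term n → Carrier
    term (c , k , m) = ⟦ c ⟧ * (z ^ k * ρ (m · s))

    evaluate : List (Term n) → Carrier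
    evaluate = foldr (λ t x → term t + x) 0#

    evaluatePolynomial : List (List (ℤ × Monomial n)) → Carrier
    evaluatePolynomial = foldr (λ p x → evaluateCoefficient s p + z * x) 0#

    ρ-zero : ρ (replicate n 𝟘 · s) ≈ 1#
    ρ-zero = trans (reflexive (cong ρ (·-zero s))) ρ-𝟘

    evaluate-1 : evaluate (RawRing.1# (formalRing n)) ≈ 1#
    evaluate-1 = begin
      ⟦ 1ℤ ⟧ * (1# * ρ (replicate n 𝟘 · s)) + 0# ≈⟨ +-identityʳ _ ⟩
      ⟦ 1ℤ ⟧ * (1# * ρ (replicate n 𝟘 · s))      ≈⟨ *-cong 1-homo (trans (*-identityˡ _) ρ-zero) ⟩
      1# * 1#                                    ≈⟨ *-identityʳ _ ⟩
      1#                                         ∎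

    evaluate-++ : ∀ xs ys → evaluate (xs ++ ys) ≈ evaluate xs + evaluate ys
    evaluate-++ []       ys = sym (+-identityˡ _)
    evaluate-++ (t ∷ xs) ys = trans (+-congˡ (evaluate-++ xs ys)) (sym (+-assoc _ _ _))

    term-· : ∀ t u → term (t ·ₜ u) ≈ term t * term u
    term-· (c , k , m) (c′ , k′ , m′) = begin
      ⟦ c ℤ.* c′ ⟧ * (z ^ (k ℕ.+ k′) * ρ (zipWith _⊕_ m m′ · s))
        ≈⟨ *-cong (*-homo c c′) (*-cong (^-homo-* z k k′)
             (trans (reflexive (cong ρ (·-⊕ m m′ s))) (ρ-⊕ (m · s) (m′ · s)))) ⟩
      (⟦ c ⟧ * ⟦ c′ ⟧) * ((z ^ k * z ^ k′) * (ρ (m · s) * ρ (m′ · s)))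
        ≈⟨ solve 6 (λ a b x y u v → (a :* b) :* ((x :* y) :* (u :* v)) := (a :* (x :* u)) :* (b :* (y :* v)))
             refl ⟦ c ⟧ ⟦ c′ ⟧ (z ^ k) (z ^ k′) (ρ (m · s)) (ρ (m′ · s)) ⟩
      term (c , k , m) * term (c′ , k′ , m′) ∎

    evaluate-map-· : ∀ t ys → evaluate (map (t ·ₜ_) ys) ≈ term t * evaluate ys
    evaluate-map-· t []       = sym (zeroʳ _)
    evaluate-map-· t (u ∷ ys) = trans (+-cong (term-· t u) (evaluate-map-· t ys)) (sym (distribˡ _ _ _))

    evaluate-· : ∀ xs ys → evaluate (xs ·ₗ ys) ≈ evaluate xs * evaluate ys
    evaluate-· []       ys = sym (zeroˡ _)
    evaluate-· (t ∷ xs) ys = begin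
      evaluate (map (t ·ₜ_) ys ++ xs ·ₗ ys)              ≈⟨ evaluate-++ (map (t ·ₜ_) ys) (xs ·ₗ ys) ⟩
      evaluate (map (t ·ₜ_) ys) + evaluate (xs ·ₗ ys)    ≈⟨ +-cong (evaluate-map-· t ys) (evaluate-· xs ys) ⟩
      term t * evaluate ys + evaluate xs * evaluate ys  ≈⟨ distribʳ _ _ _ ⟨
      evaluate (t ∷ xs) * evaluate ys                   ∎

    evaluate-- : ∀ xs → evaluate (map -ₜ_ xs) ≈ - evaluate xs
    evaluate-- []                 = sym -0#≈0#
    evaluate-- ((c , k , m) ∷ xs) = begin
      ⟦ ℤ.- c ⟧ * (z ^ k * ρ (m · s)) + evaluate (map -ₜ_ xs)
        ≈⟨ +-cong (trans (*-congʳ (-‿homo c)) (sym (-‿distribˡ-* _ _))) (evaluate-- xs) ⟩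
      - term (c , k , m) - evaluate xs
        ≈⟨ -‿+-comm _ _ ⟩
      - evaluate ((c , k , m) ∷ xs) ∎

    evaluate-addTerm : ∀ c m p →
      evaluateCoefficient s (addTerm c m p) ≈ ⟦ c ⟧ * ρ (m · s) + evaluateCoefficient s p
    evaluate-addTerm c m [] = refl
    evaluate-addTerm c m ((d , m′) ∷ p) with Vec.≡-dec _≟₄_ m m′
    ... | yes ≡.refl = begin
      ⟦ c ℤ.+ d ⟧ * ρ (m · s) + evaluateCoefficient s p           ≈⟨ +-congʳ (*-congʳ (+-homo c d)) ⟩
      (⟦ c ⟧ + ⟦ d ⟧) * ρ (m · s) + evaluateCoefficient s p       ≈⟨ +-congʳ (distribʳ _ _ _) ⟩
      (⟦ c ⟧ * ρ (m · s) + ⟦ d ⟧ * ρ (m · s)) + evaluateCoefficient s p ≈⟨ +-assoc _ _ _ ⟩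
      ⟦ c ⟧ * ρ (m · s) + (⟦ d ⟧ * ρ (m · s) + evaluateCoefficient s p) ∎
    ... | no _ = trans (+-congˡ (evaluate-addTerm c m p))
      (solve 3 (λ x y w → x :+ (y :+ w) := y :+ (x :+ w)) refl
        (⟦ d ⟧ * ρ (m′ · s)) (⟦ c ⟧ * ρ (m · s)) (evaluateCoefficient s p))

    evaluate-addPower : ∀ t ps → evaluatePolynomial (addPower t ps) ≈ term t + evaluatePolynomial ps
    evaluate-addPower (c , zero , m) [] = begin
      (⟦ c ⟧ * ρ (m · s) + 0#) + z * 0#   ≈⟨ +-cong (+-identityʳ _) (zeroʳ z) ⟩
      ⟦ c ⟧ * ρ (m · s) + 0#              ≈⟨ +-congʳ (*-congˡ (*-identityˡ _)) ⟨
      ⟦ c ⟧ * (1# * ρ (m · s)) + 0#       ∎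
    evaluate-addPower (c , zero , m) (p ∷ ps) = begin
      evaluateCoefficient s (addTerm c m p) + z * evaluatePolynomial ps
        ≈⟨ +-congʳ (evaluate-addTerm c m p) ⟩
      (⟦ c ⟧ * ρ (m · s) + evaluateCoefficient s p) + z * evaluatePolynomial ps
        ≈⟨ +-assoc _ _ _ ⟩
      ⟦ c ⟧ * ρ (m · s) + (evaluateCoefficient s p + z * evaluatePolynomial ps)
        ≈⟨ +-congʳ (*-congˡ (*-identityˡ _)) ⟨
      ⟦ c ⟧ * (1# * ρ (m · s)) + evaluatePolynomial (p ∷ ps) ∎
    evaluate-addPower (c , suc k , m) [] = begin
      0# + z * evaluatePolynomial (addPower (c , k , m) [])  ≈⟨ +-identityˡ _ ⟩
      z * evaluatePolynomial (addPower (c , k , m) [])       ≈⟨ *-congˡ (evaluate-addPower (c , k , m) []) ⟩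
      z * (⟦ c ⟧ * (z ^ k * ρ (m · s)) + 0#)                 ≈⟨ *-congˡ (+-identityʳ _) ⟩
      z * (⟦ c ⟧ * (z ^ k * ρ (m · s)))
        ≈⟨ solve 4 (λ z a w r → z :* (a :* (w :* r)) := a :* (z :* w :* r)) refl z ⟦ c ⟧ (z ^ k) (ρ (m · s)) ⟩
      ⟦ c ⟧ * (z * z ^ k * ρ (m · s))                        ≈⟨ +-identityʳ _ ⟨
      ⟦ c ⟧ * (z * z ^ k * ρ (m · s)) + 0#                   ∎
    evaluate-addPower (c , suc k , m) (p ∷ ps) = begin
      evaluateCoefficient s p + z * evaluatePolynomial (addPower (c , k , m) ps)
        ≈⟨ +-congˡ (*-congˡ (evaluate-addPower (c , k , m) ps)) ⟩
      evaluateCoefficient s p + z * (⟦ c ⟧ * (z ^ k * ρ (m · s)) + evaluatePolynomial ps)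
        ≈⟨ solve 6 (λ q z a w r v → q :+ z :* (a :* (w :* r) :+ v) := a :* (z :* w :* r) :+ (q :+ z :* v)) refl
             (evaluateCoefficient s p) z ⟦ c ⟧ (z ^ k) (ρ (m · s)) (evaluatePolynomial ps) ⟩
      ⟦ c ⟧ * (z * z ^ k * ρ (m · s)) + evaluatePolynomial (p ∷ ps) ∎

    evaluate-collect : ∀ xs → evaluatePolynomial (collect xs) ≈ evaluate xs
    evaluate-collect []       = refl
    evaluate-collect (t ∷ xs) = trans (evaluate-addPower t (collect xs)) (+-congˡ (evaluate-collect xs))

    evaluate-charPoly : ∀ {d} (A : Matrices.Matrix (formalRing n) d) x {p} (B : Mat d) {w} →
      (∀ u v → evaluate (A u v) ≈ B u v) → evaluate x ≈ w →
      p ≡ Matrices.charPoly (formalRing n) A x → evaluate p ≈ CharPoly B w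
    evaluate-charPoly {d} A x {p} B {w} A≈B x≈w ≡.refl = begin
      evaluate p
        ≈⟨ Homomorphic.φ-charPoly (formalRing n) evaluate refl evaluate-1 evaluate-++ evaluate-· evaluate-- A x ⟩
      CharPoly (λ u v → evaluate (A u v)) (evaluate x)
        ≈⟨ charPoly-cong {d} {λ u v → evaluate (A u v)} {B} A≈B (evaluate x) ⟩
      CharPoly B (evaluate x)
        ≈⟨ charPoly-congʳ B x≈w ⟩
      CharPoly B w ∎

  value : Maybe ℤ₄ → Carrier
  value nothing  = 0#
  value (just a) = ρ a

  value-switch : ∀ a b e → value (switch a b e) ≈ ρ (sign a) * value e * ρ (sign b)
  value-switch a b nothing  = sym (trans (*-congʳ (zeroʳ _)) (zeroˡ _))
  value-switch a b (just k) = trans (ρ-⊕ (sign a ⊕ k) (sign b)) (*-congʳ (ρ-⊕ (sign a) k))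

  signDiagonal : ∀ {n} → (Fin n → Bool) → Mat n
  signDiagonal ε = diagonal (λ k → ρ (sign (ε k)))

  signDiagonal-involutive : ∀ {n} (ε : Fin n → Bool) → (signDiagonal ε ⊙ signDiagonal ε) ≋ Scalar 1#
  signDiagonal-involutive ε = diagonal-involutive (λ k → ρ (sign (ε k))) λ k →
    trans (sym (ρ-⊕ (sign (ε k)) (sign (ε k)))) (trans (reflexive (cong ρ (sign² (ε k)))) ρ-𝟘)
    where
    sign² : ∀ b → sign b ⊕ sign b ≡ 𝟘
    sign² true  = ≡.refl
    sign² false = ≡.refl

  signDiagonal-conjugate : ∀ {n} (ε : Fin n → Bool) (h : Fin n → Fin n → Maybe ℤ₄) (A B : Mat n) →
    (∀ u v → A u v ≡ value (h u v)) → (∀ u v → B u v ≡ value (switch (ε u) (ε v) (h u v))) →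
    B ≋ (signDiagonal ε ⊙ A ⊙ signDiagonal ε)
  signDiagonal-conjugate ε h A B A≡ B≡ u v = begin
    B u v                                        ≡⟨ B≡ u v ⟩
    value (switch (ε u) (ε v) (h u v))           ≈⟨ value-switch (ε u) (ε v) (h u v) ⟩
    ρ (sign (ε u)) * value (h u v) * ρ (sign (ε v)) ≡⟨ cong (λ a → ρ (sign (ε u)) * a * ρ (sign (ε v))) (A≡ u v) ⟨
    ρ (sign (ε u)) * A u v * ρ (sign (ε v))      ≈⟨ diagonal-conjugate (λ k → ρ (sign (ε k))) A u v ⟨
    (signDiagonal ε ⊙ A ⊙ signDiagonal ε) u v    ∎

  module _ (s : Vec ℤ₄ 12) where

    evaluate-unit : ∀ z k a → evaluate s z ((1ℤ , 0 , unit k a) ∷ []) ≈ ρ (a ⊗ lookup s k)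
    evaluate-unit z k a = begin
      ⟦ 1ℤ ⟧ * (1# * ρ (unit k a · s)) + 0# ≈⟨ +-identityʳ _ ⟩
      ⟦ 1ℤ ⟧ * (1# * ρ (unit k a · s))      ≈⟨ *-cong 1-homo (*-identityˡ _) ⟩
      1# * ρ (unit k a · s)                 ≈⟨ *-identityˡ _ ⟩
      ρ (unit k a · s)                      ≡⟨ cong ρ (·-unit k a s) ⟩
      ρ (a ⊗ lookup s k)                    ∎

    evaluate-entry : ∀ z u v → evaluate s z (edgeEntry (edgeAt u v)) ≈ value (entry s u v)
    evaluate-entry z u v with edgeAt u v
    ... | nothing          = refl
    ... | just (k , true)  = evaluate-unit z k 𝟙
    ... | just (k , false) = evaluate-unit z k 𝟛

    evaluate-variable : ∀ z → evaluate s z formalVariable ≈ z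
    evaluate-variable z = begin
      ⟦ 1ℤ ⟧ * (z * 1# * ρ (replicate 12 𝟘 · s)) + 0# ≈⟨ +-identityʳ _ ⟩
      ⟦ 1ℤ ⟧ * (z * 1# * ρ (replicate 12 𝟘 · s))      ≈⟨ *-cong 1-homo (*-cong (*-identityʳ z) (ρ-zero s z)) ⟩
      1# * (z * 1#)                                    ≈⟨ trans (*-identityˡ _) (*-identityʳ z) ⟩
      z                                                ∎

    private
      simplify : ∀ q₀ q₂ q₄ z {r} → r ≈ 1# →
        q₀ + z * (0# + z * (q₂ + z * (0# + z * (q₄ + z * (0# + z * (⟦ -[1+ 11 ] ⟧ * r + 0#
          + z * (0# + z * (⟦ 1ℤ ⟧ * r + 0# + z * 0#)))))))) ≈ evenOctic q₄ q₂ q₀ (z * z)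
      simplify q₀ q₂ q₄ z {r} r≈1 = begin
        q₀ + z * (0# + z * (q₂ + z * (0# + z * (q₄ + z * (0# + z * (⟦ -[1+ 11 ] ⟧ * r + 0#
          + z * (0# + z * (⟦ 1ℤ ⟧ * r + 0# + z * 0#))))))))
          ≈⟨ +-congˡ (odd (+-congˡ (odd (+-congˡ (odd (+-cong (times-r _) (odd leading))))))) ⟩
        q₀ + z * (z * (q₂ + z * (z * (q₄ + z * (z * (⟦ -[1+ 11 ] ⟧ + z * (z * ⟦ 1ℤ ⟧)))))))
          ≈⟨ solve 4 (λ a b c z → a :+ z :* (z :* (b :+ z :* (z :* (c :+ z :* (z :* (con -[1+ 11 ] :+ z :* (z :* con 1ℤ)))))))
               := ((((z :* z :- con (+ 12)) :* (z :* z) :+ c) :* (z :* z) :+ b) :* (z :* z) :+ a)) refl q₀ q₂ q₄ z ⟩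
        evenOctic q₄ q₂ q₀ (z * z) ∎
        where
        odd : ∀ {x y} → x ≈ y → z * (0# + z * x) ≈ z * (z * y)
        odd eq = *-congˡ (trans (+-identityˡ _) (*-congˡ eq))
        times-r : ∀ x → x * r + 0# ≈ x
        times-r x = trans (+-identityʳ _) (trans (*-congˡ r≈1) (*-identityʳ x))
        leading : ⟦ 1ℤ ⟧ * r + 0# + z * 0# ≈ ⟦ 1ℤ ⟧
        leading = trans (+-cong (times-r _) (zeroʳ z)) (+-identityʳ _)

    -- Evaluation at `s` and `z` respects the ring operations, hence the determinant; so the one
    -- formal expansion specialises to every assignment of phases.
    evenOctic-charPoly : ∀ {d} (A : Matrices.Matrix (formalRing 12) d) (B : Mat d) →
      (∀ z u v → evaluate s z (A u v) ≈ B u v) →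
      ∀ p → p ≡ Matrices.charPoly (formalRing 12) A formalVariable → CollectsToEvenOctic p →
      ∃[ c₂ ] ∃[ c₀ ] (∀ z → CharPoly B z ≈ evenOctic (evaluateCoefficient s quartic) c₂ c₀ (z * z))
    evenOctic-charPoly A B A≈B p p≡ (p₀ , p₂ , eq) = evaluateCoefficient s p₂ , evaluateCoefficient s p₀ , λ z → begin
      CharPoly B z
        ≈⟨ evaluate-charPoly s z A formalVariable B (A≈B z) (evaluate-variable z) p≡ ⟨
      evaluate s z p                           ≈⟨ evaluate-collect s z p ⟨
      evaluatePolynomial s z (collect p)       ≡⟨ cong (evaluatePolynomial s z) eq ⟩
      q₀ + z * (0# + z * (q₂ + z * (0# + z * (q₄ + z * (0# + z * (⟦ -[1+ 11 ] ⟧ * r + 0#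
        + z * (0# + z * (⟦ 1ℤ ⟧ * r + 0# + z * 0#))))))))
        ≈⟨ simplify q₀ q₂ q₄ z (ρ-zero s z) ⟩
      evenOctic q₄ q₂ q₀ (z * z) ∎
      where
      q₀ = evaluateCoefficient s p₀
      q₂ = evaluateCoefficient s p₂
      q₄ = evaluateCoefficient s quartic
      r = ρ (replicate 12 𝟘 · s)

    -- The two directions around a face have conjugate weights, so together they contribute twice
    -- the real part, which is an integer.
    quartic-value : (∀ a → ρ a + ρ (⊖ a) ≈ ⟦ twiceRe a ⟧) →
      evaluateCoefficient s quartic ≈ ⟦ + 42 ℤ.- (twiceRe (face₁₂₄₃ · s) ℤ.+ (twiceRe (face₁₂₆₅ · s) ℤ.+
        (twiceRe (face₁₃₇₅ · s) ℤ.+ (twiceRe (face₂₄₈₆ · s) ℤ.+ (twiceRe (face₃₄₈₇ · s) ℤ.+ twiceRe (face₅₆₈₇ · s)))))) ⟧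
    quartic-value pair = begin
      evaluateCoefficient s quartic
        ≈⟨ solve 14 (λ p₁ p₂ p₃ p₄ p₅ p₆ n₁ n₂ n₃ n₄ n₅ n₆ r o →
             con (+ 42) :* r :+ (con -[1+ 0 ] :* p₃ :+ (con -[1+ 0 ] :* p₂ :+ (con -[1+ 0 ] :* n₃ :+ (con -[1+ 0 ] :* p₁ :+ (con -[1+ 0 ] :* n₂ :+ (con -[1+ 0 ] :* n₁ :+ (con -[1+ 0 ] :* p₄ :+ (con -[1+ 0 ] :* n₄ :+ (con -[1+ 0 ] :* p₅ :+ (con -[1+ 0 ] :* n₅ :+ (con -[1+ 0 ] :* p₆ :+ (con -[1+ 0 ] :* n₆ :+ o))))))))))))
               := con (+ 42) :* r :- ((p₁ :+ n₁) :+ ((p₂ :+ n₂) :+ ((p₃ :+ n₃) :+ ((p₄ :+ n₄) :+ ((p₅ :+ n₅) :+ ((p₆ :+ n₆))))))) :+ o) refl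
             (w face₁₂₄₃) (w face₁₂₆₅) (w face₁₃₇₅) (w face₂₄₈₆) (w face₃₄₈₇) (w face₅₆₈₇)
             (w (Vec.map ⊖_ face₁₂₄₃)) (w (Vec.map ⊖_ face₁₂₆₅)) (w (Vec.map ⊖_ face₁₃₇₅)) (w (Vec.map ⊖_ face₂₄₈₆)) (w (Vec.map ⊖_ face₃₄₈₇)) (w (Vec.map ⊖_ face₅₆₈₇))
             (w (replicate 12 𝟘)) 0# ⟩
      ⟦ + 42 ⟧ * w (replicate 12 𝟘) - ((w face₁₂₄₃ + w (Vec.map ⊖_ face₁₂₄₃)) + ((w face₁₂₆₅ + w (Vec.map ⊖_ face₁₂₆₅)) + ((w face₁₃₇₅ + w (Vec.map ⊖_ face₁₃₇₅)) + ((w face₂₄₈₆ + w (Vec.map ⊖_ face₂₄₈₆)) + ((w face₃₄₈₇ + w (Vec.map ⊖_ face₃₄₈₇)) + ((w face₅₆₈₇ + w (Vec.map ⊖_ face₅₆₈₇)))))))) + 0#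
        ≈⟨ +-identityʳ _ ⟩
      ⟦ + 42 ⟧ * w (replicate 12 𝟘) - ((w face₁₂₄₃ + w (Vec.map ⊖_ face₁₂₄₃)) + ((w face₁₂₆₅ + w (Vec.map ⊖_ face₁₂₆₅)) + ((w face₁₃₇₅ + w (Vec.map ⊖_ face₁₃₇₅)) + ((w face₂₄₈₆ + w (Vec.map ⊖_ face₂₄₈₆)) + ((w face₃₄₈₇ + w (Vec.map ⊖_ face₃₄₈₇)) + ((w face₅₆₈₇ + w (Vec.map ⊖_ face₅₆₈₇))))))))
        ≈⟨ +-cong (trans (*-congˡ (ρ-zero s 0#)) (*-identityʳ _))
             (-‿cong (plus face₁₂₄₃ (plus face₁₂₆₅ (plus face₁₃₇₅ (plus face₂₄₈₆ (plus face₃₄₈₇ (flux face₅₆₈₇))))))) ⟩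
      ⟦ + 42 ⟧ - ⟦ total ⟧
        ≈⟨ trans (+-homo (+ 42) (ℤ.- total)) (+-congˡ (-‿homo total)) ⟨
      ⟦ + 42 ℤ.- total ⟧ ∎
      where
      w : Monomial 12 → Carrier
      w m = ρ (m · s)
      total : ℤ
      total = twiceRe (face₁₂₄₃ · s) ℤ.+ (twiceRe (face₁₂₆₅ · s) ℤ.+
        (twiceRe (face₁₃₇₅ · s) ℤ.+ (twiceRe (face₂₄₈₆ · s) ℤ.+ (twiceRe (face₃₄₈₇ · s) ℤ.+ twiceRe (face₅₆₈₇ · s)))))
      flux : ∀ m → w m + w (Vec.map ⊖_ m) ≈ ⟦ twiceRe (m · s) ⟧
      flux m = trans (+-congˡ (reflexive (cong ρ (·-⊖ m s)))) (pair (m · s))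
      plus : ∀ m {x b} → x ≈ ⟦ b ⟧ → (w m + w (Vec.map ⊖_ m)) + x ≈ ⟦ twiceRe (m · s) ℤ.+ b ⟧
      plus m {b = b} eq = trans (+-cong (flux m) eq) (sym (+-homo (twiceRe (m · s)) b))

-- Classification of the mixed cubes with negative faces

∀ℤ₄? : {P : ℤ₄ → Set} → (∀ a → Dec (P a)) → Dec (∀ a → P a)
∀ℤ₄? P? = map′ (λ (p , q , r , s) → ∀ℤ₄ p q r s) (λ h → h 𝟘 , h 𝟙 , h 𝟚 , h 𝟛)
  (P? 𝟘 ×-dec P? 𝟙 ×-dec P? 𝟚 ×-dec P? 𝟛)

-- Each `twiceRe` is at least -2, so 54 = 42 + 6·2 is the maximum; checked over all 4⁶ cases.
extremal-fluxes : ∀ a b c d e f →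
  + 42 ℤ.- (twiceRe a ℤ.+ (twiceRe b ℤ.+ (twiceRe c ℤ.+ (twiceRe d ℤ.+ (twiceRe e ℤ.+ twiceRe f))))) ≡ + 54 →
  a ≡ 𝟚 × b ≡ 𝟚 × c ≡ 𝟚 × d ≡ 𝟚 × e ≡ 𝟚 × f ≡ 𝟚
extremal-fluxes = toWitness {a? = ∀ℤ₄? λ a → ∀ℤ₄? λ b → ∀ℤ₄? λ c → ∀ℤ₄? λ d → ∀ℤ₄? λ e → ∀ℤ₄? λ f →
  (_ ℤ.≟ + 54) →-dec (a ≟₄ 𝟚 ×-dec b ≟₄ 𝟚 ×-dec c ≟₄ 𝟚 ×-dec d ≟₄ 𝟚 ×-dec e ≟₄ 𝟚 ×-dec f ≟₄ 𝟚)} _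

NegativeFaces : Vec ℤ₄ 12 → Set
NegativeFaces s = face₁₂₄₃ · s ≡ 𝟚 × face₁₂₆₅ · s ≡ 𝟚 × face₁₃₇₅ · s ≡ 𝟚
  × face₂₄₈₆ · s ≡ 𝟚 × face₃₄₈₇ · s ≡ 𝟚 × face₅₆₈₇ · s ≡ 𝟚

-- The exponent `𝟚` is missing because no edge of a mixed graph has weight -1. This restricts both
-- the search and the sign changes that can lead back to a mixed graph.
data EdgeState : Set where
  undirectedEdge forward backward : EdgeState

phase : EdgeState → ℤ₄
phase undirectedEdge = 𝟘
phase forward        = 𝟙
phase backward       = 𝟛

∀state? : {P : EdgeState → Set} → (∀ a → Dec (P a)) → Dec (∀ a → P a)
∀state? P? = map′ (λ { (p , q , r) undirectedEdge → p ; (p , q , r) forward → q ; (p , q , r) backward → r })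
  (λ h → h undirectedEdge , h forward , h backward)
  (P? undirectedEdge ×-dec P? forward ×-dec P? backward)

-- With vertex indices 0 to 7 written in binary, the three flips toggle the bits of value 1, 2 and
-- 4.
flip₁ : Fin 8 → Fin 8
flip₁ 0F = 1F
flip₁ 1F = 0F
flip₁ 2F = 3F
flip₁ 3F = 2F
flip₁ 4F = 5F
flip₁ 5F = 4F
flip₁ 6F = 7F
flip₁ 7F = 6F

flip₂ : Fin 8 → Fin 8
flip₂ 0F = 2F
flip₂ 1F = 3F
flip₂ 2F = 0F
flip₂ 3F = 1F
flip₂ 4F = 6F
flip₂ 5F = 7F
flip₂ 6F = 4F
flip₂ 7F = 5F

flip₃ : Fin 8 → Fin 8
flip₃ 0F = 4F
flip₃ 1F = 5F
flip₃ 2F = 6F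
flip₃ 3F = 7F
flip₃ 4F = 0F
flip₃ 5F = 1F
flip₃ 6F = 2F
flip₃ 7F = 3F

-- Permutes the three bits of the index cyclically: 1 to 2, 2 to 4, 4 to 1.
rotate : Fin 8 → Fin 8
rotate 0F = 0F
rotate 1F = 2F
rotate 2F = 4F
rotate 3F = 6F
rotate 4F = 1F
rotate 5F = 3F
rotate 6F = 5F
rotate 7F = 7F

rotate⁻¹ : Fin 8 → Fin 8
rotate⁻¹ 0F = 0F
rotate⁻¹ 1F = 4F
rotate⁻¹ 2F = 1F
rotate⁻¹ 3F = 5F
rotate⁻¹ 4F = 2F
rotate⁻¹ 5F = 6F
rotate⁻¹ 6F = 3F
rotate⁻¹ 7F = 7F

flips : List (Permutation′ 8)
flips = List.cartesianProductWith _∘ₚ_ (Permutation.id ∷ involution flip₁ ∷ [])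
  (List.cartesianProductWith _∘ₚ_ (Permutation.id ∷ involution flip₂ ∷ []) (Permutation.id ∷ involution flip₃ ∷ []))
  where
  involution : (f : Fin 8 → Fin 8) {_ : True (Fin.all? λ v → f (f v) Fin.≟ v)} → Permutation′ 8
  involution f {ff} = permutation f f (toWitness ff) (toWitness ff)

rotation : Permutation′ 8
rotation = permutation rotate rotate⁻¹
  (toWitness {a? = Fin.all? λ v → rotate (rotate⁻¹ v) Fin.≟ v} _)
  (toWitness {a? = Fin.all? λ v → rotate⁻¹ (rotate v) Fin.≟ v} _)

-- The automorphisms of the cube preserving the cyclic order of its three directions.
automorphisms : List (Permutation′ 8)
automorphisms = List.cartesianProductWith _∘ₚ_ (Permutation.id ∷ rotation ∷ Permutation.flip rotation ∷ []) flips

automorphisms-pres-adj : All (λ σ → ∀ u v → adj cube (σ ⟨$⟩ʳ u) (σ ⟨$⟩ʳ v) ≡ adj cube u v) automorphisms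
automorphisms-pres-adj = toWitness
  {a? = All.all? (λ σ → Fin.all? λ u → Fin.all? λ v → _ Bool.≟ adj cube u v) automorphisms} _

-- The only possible signs, up to a global one, read off along a spanning tree.
signs : Vec ℤ₄ 12 → Permutation′ 8 → Vec ℤ₄ 12 → Fin 8 → Bool
signs s σ t = go
  where
  changed : Fin 8 → Fin 8 → Bool
  -- Any mismatch is read as a change of sign; a mismatch of another kind is caught by `Switched`,
  -- which compares all entries.
  changed u v = not (does (Maybe.≡-dec _≟₄_ (entry s (σ ⟨$⟩ʳ u) (σ ⟨$⟩ʳ v)) (entry t u v)))
  go : Fin 8 → Bool
  go 0F = false
  go 1F = changed 0F 1F
  go 2F = changed 0F 2F
  go 3F = changed 0F 1F xor changed 1F 3F
  go 4F = changed 0F 4F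
  go 5F = changed 0F 1F xor changed 1F 5F
  go 6F = changed 0F 2F xor changed 2F 6F
  go 7F = changed 0F 1F xor (changed 1F 3F xor changed 3F 7F)

Switched : Vec ℤ₄ 12 → Vec ℤ₄ 12 → Permutation′ 8 → Set
Switched s t σ = ∀ u v →
  entry s (σ ⟨$⟩ʳ u) (σ ⟨$⟩ʳ v) ≡ switch (signs s σ t u) (signs s σ t v) (entry t u v)

switched? : ∀ s t σ → Dec (Switched s t σ)
switched? s t σ = Fin.all? λ u → Fin.all? λ v → Maybe.≡-dec _≟₄_ _ _

-- Written out so that the search compares literal vectors; `sevenGraphs-phases` matches them with
-- the seven graphs.
D₂-phases H₁-phases H₂-phases H₃-phases H₄-phases H₅-phases H₆-phases : Vec ℤ₄ 12
D₂-phases = 𝟙 ∷ 𝟛 ∷ 𝟛 ∷ 𝟙 ∷ 𝟙 ∷ 𝟙 ∷ 𝟛 ∷ 𝟛 ∷ 𝟙 ∷ 𝟙 ∷ 𝟙 ∷ 𝟙 ∷ []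
H₁-phases = 𝟘 ∷ 𝟙 ∷ 𝟛 ∷ 𝟙 ∷ 𝟘 ∷ 𝟛 ∷ 𝟙 ∷ 𝟙 ∷ 𝟘 ∷ 𝟙 ∷ 𝟛 ∷ 𝟙 ∷ []
H₂-phases = 𝟙 ∷ 𝟛 ∷ 𝟛 ∷ 𝟙 ∷ 𝟘 ∷ 𝟘 ∷ 𝟘 ∷ 𝟘 ∷ 𝟙 ∷ 𝟙 ∷ 𝟛 ∷ 𝟛 ∷ []
H₃-phases = 𝟘 ∷ 𝟙 ∷ 𝟘 ∷ 𝟙 ∷ 𝟘 ∷ 𝟛 ∷ 𝟘 ∷ 𝟛 ∷ 𝟙 ∷ 𝟛 ∷ 𝟛 ∷ 𝟙 ∷ []
H₄-phases = 𝟘 ∷ 𝟙 ∷ 𝟘 ∷ 𝟘 ∷ 𝟘 ∷ 𝟛 ∷ 𝟛 ∷ 𝟙 ∷ 𝟛 ∷ 𝟙 ∷ 𝟘 ∷ 𝟙 ∷ []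
H₅-phases = 𝟘 ∷ 𝟙 ∷ 𝟘 ∷ 𝟛 ∷ 𝟘 ∷ 𝟛 ∷ 𝟛 ∷ 𝟘 ∷ 𝟛 ∷ 𝟙 ∷ 𝟘 ∷ 𝟘 ∷ []
H₆-phases = 𝟘 ∷ 𝟙 ∷ 𝟛 ∷ 𝟘 ∷ 𝟘 ∷ 𝟛 ∷ 𝟙 ∷ 𝟘 ∷ 𝟘 ∷ 𝟙 ∷ 𝟛 ∷ 𝟘 ∷ []

sevenPhases : List (Vec ℤ₄ 12)
sevenPhases = D₂-phases ∷ H₁-phases ∷ H₂-phases ∷ H₃-phases ∷ H₄-phases ∷ H₅-phases ∷ H₆-phases ∷ []

-- The search ranges over 24 of the 48 automorphisms of the cube; that they suffice is established
-- by the evaluation itself.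
Classified : Vec ℤ₄ 12 → Set
Classified s = Any (λ t → Any (Switched s t) automorphisms) sevenPhases

classified? : ∀ s → Dec (Classified s)
classified? s = Any.any? (λ t → Any.any? (switched? s t) automorphisms) sevenPhases

-- The edges are ordered so that faces are completed early; the decision procedure then
-- abandons a partial assignment as soon as one face is not negative.
classification-by-faces : ∀ e₀ e₅ e₁ e₄ →
  face₁₂₄₃ · (phase e₀ ∷ phase e₁ ∷ 𝟘 ∷ 𝟘 ∷ phase e₄ ∷ phase e₅ ∷ 𝟘 ∷ 𝟘 ∷ 𝟘 ∷ 𝟘 ∷ 𝟘 ∷ 𝟘 ∷ []) ≡ 𝟚 →
  ∀ e₈ e₂ e₉ →
  face₁₂₆₅ · (phase e₀ ∷ phase e₁ ∷ phase e₂ ∷ 𝟘 ∷ phase e₄ ∷ phase e₅ ∷ 𝟘 ∷ 𝟘 ∷ phase e₈ ∷ phase e₉ ∷ 𝟘 ∷ 𝟘 ∷ []) ≡ 𝟚 →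
  ∀ e₆ e₁₀ →
  face₁₃₇₅ · (phase e₀ ∷ phase e₁ ∷ phase e₂ ∷ 𝟘 ∷ phase e₄ ∷ phase e₅ ∷ phase e₆ ∷ 𝟘 ∷ phase e₈ ∷ phase e₉ ∷ phase e₁₀ ∷ 𝟘 ∷ []) ≡ 𝟚 →
  ∀ e₁₁ e₇ →
  face₂₄₈₆ · (phase e₀ ∷ phase e₁ ∷ phase e₂ ∷ 𝟘 ∷ phase e₄ ∷ phase e₅ ∷ phase e₆ ∷ phase e₇ ∷ phase e₈ ∷ phase e₉ ∷ phase e₁₀ ∷ phase e₁₁ ∷ []) ≡ 𝟚 →
  ∀ e₃ →
  face₃₄₈₇ · (phase e₀ ∷ phase e₁ ∷ phase e₂ ∷ phase e₃ ∷ phase e₄ ∷ phase e₅ ∷ phase e₆ ∷ phase e₇ ∷ phase e₈ ∷ phase e₉ ∷ phase e₁₀ ∷ phase e₁₁ ∷ []) ≡ 𝟚 →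
  Classified (phase e₀ ∷ phase e₁ ∷ phase e₂ ∷ phase e₃ ∷ phase e₄ ∷ phase e₅ ∷ phase e₆ ∷ phase e₇ ∷ phase e₈ ∷ phase e₉ ∷ phase e₁₀ ∷ phase e₁₁ ∷ [])
classification-by-faces = toWitness {a? = ∀state? λ e₀ → ∀state? λ e₅ → ∀state? λ e₁ → ∀state? λ e₄ → (_ ≟₄ 𝟚) →-dec
  (∀state? λ e₈ → ∀state? λ e₂ → ∀state? λ e₉ → (_ ≟₄ 𝟚) →-dec
  (∀state? λ e₆ → ∀state? λ e₁₀ → (_ ≟₄ 𝟚) →-dec
  (∀state? λ e₁₁ → ∀state? λ e₇ → (_ ≟₄ 𝟚) →-dec
  (∀state? λ e₃ → (_ ≟₄ 𝟚) →-dec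
  (classified? _)))))} _

-- Real and complex numbers

open +-*-Solver using (solve; _:+_; _:*_; _:-_; :-_; _:=_; con)

pointwise⇒≃ : ∀ x y → (∀ n → seq x n ≡ seq y n) → x ≃ᴿ y
pointwise⇒≃ x y eq ε 0<ε = 0 , λ n _ →
  subst (ℚ._≤ ε) (≡.sym (cong ℚ.∣_∣ (≡.trans (cong (λ q → seq x n ℚ.- q) (≡.sym (eq n))) (ℚ.+-inverseʳ (seq x n)))))
    (ℚ.<⇒≤ 0<ε)

private
  ½-positive : ∀ {ε} → 0ℚ ℚ.< ε → 0ℚ ℚ.< ½ ℚ.* ε
  ½-positive {ε} p = ℚ.positive⁻¹ _ {{ℚ.pos*pos⇒pos ½ ε {{ℚ.positive p}}}}

  ½+½ : ∀ ε → ½ ℚ.* ε ℚ.+ ½ ℚ.* ε ≡ ε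
  ½+½ ε = ≡.trans (≡.sym (ℚ.*-distribʳ-+ ε ½ ½)) (ℚ.*-identityˡ ε)

  ∣+∣≤ : ∀ {c ε} a b → c ≡ a ℚ.+ b → ℚ.∣ a ∣ ℚ.≤ ½ ℚ.* ε → ℚ.∣ b ∣ ℚ.≤ ½ ℚ.* ε → ℚ.∣ c ∣ ℚ.≤ ε
  ∣+∣≤ {_} {ε} a b ≡.refl p q = ℚ.≤-trans (ℚ.∣p+q∣≤∣p∣+∣q∣ a b)
    (subst (ℚ.∣ a ∣ ℚ.+ ℚ.∣ b ∣ ℚ.≤_) (½+½ ε) (ℚ.+-mono-≤ p q))

≃-refl : ∀ {x} → x ≃ᴿ x
≃-refl {x} = pointwise⇒≃ x x λ _ → ≡.refl

≃-sym : ∀ {x y} → x ≃ᴿ y → y ≃ᴿ x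
≃-sym {x} {y} h ε 0<ε with h ε 0<ε
... | N , p = N , λ n N≤n → subst (ℚ._≤ ε)
  (≡.trans (≡.sym (ℚ.∣-p∣≡∣p∣ (seq x n ℚ.- seq y n)))
    (cong ℚ.∣_∣ (solve 2 (λ a b → :- (a :- b) := b :- a) ≡.refl (seq x n) (seq y n)))) (p n N≤n)

≃-trans : ∀ {x y z} → x ≃ᴿ y → y ≃ᴿ z → x ≃ᴿ z
≃-trans {x} {y} {z} h k ε 0<ε with h _ (½-positive 0<ε) | k _ (½-positive 0<ε)
... | M , p | N , q = M ℕ.⊔ N , λ n le →
  ∣+∣≤ (seq x n ℚ.- seq y n) (seq y n ℚ.- seq z n)
    (solve 3 (λ a b c → a :- c := (a :- b) :+ (b :- c)) ≡.refl (seq x n) (seq y n) (seq z n))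
    (p n (ℕ.m⊔n≤o⇒m≤o M N le)) (q n (ℕ.m⊔n≤o⇒n≤o M N le))

+ᴿ-cong : ∀ {x y u v} → x ≃ᴿ y → u ≃ᴿ v → x +ᴿ u ≃ᴿ y +ᴿ v
+ᴿ-cong {x} {y} {u} {v} h k ε 0<ε with h _ (½-positive 0<ε) | k _ (½-positive 0<ε)
... | M , p | N , q = M ℕ.⊔ N , λ n le →
  ∣+∣≤ (seq x n ℚ.- seq y n) (seq u n ℚ.- seq v n)
    (solve 4 (λ a b c d → (a :+ c) :- (b :+ d) := (a :- b) :+ (c :- d)) ≡.refl (seq x n) (seq y n) (seq u n) (seq v n))
    (p n (ℕ.m⊔n≤o⇒m≤o M N le)) (q n (ℕ.m⊔n≤o⇒n≤o M N le))

-ᴿ-cong : ∀ {x y} → x ≃ᴿ y → -ᴿ x ≃ᴿ -ᴿ y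
-ᴿ-cong {x} {y} h ε 0<ε with h ε 0<ε
... | N , p = N , λ n N≤n → subst (ℚ._≤ ε)
  (≡.trans (≡.sym (ℚ.∣-p∣≡∣p∣ (seq x n ℚ.- seq y n)))
    (cong ℚ.∣_∣ (solve 2 (λ a b → :- (a :- b) := (:- a) :- (:- b)) ≡.refl (seq x n) (seq y n)))) (p n N≤n)

private
  scaled : ∀ B ε → 0ℚ ℚ.< B → 0ℚ ℚ.< ε → ∃[ δ ] (0ℚ ℚ.< δ × B ℚ.* δ ≡ ε)
  scaled B ε 0<B 0<ε = B⁻¹ ℚ.* ε
    , ℚ.positive⁻¹ _ {{ℚ.pos*pos⇒pos B⁻¹ {{ℚ.1/pos⇒pos B {{B⁺}}}} ε {{ℚ.positive 0<ε}}}}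
    , ≡.trans (≡.sym (ℚ.*-assoc B B⁻¹ ε))
        (≡.trans (cong (ℚ._* ε) (ℚ.*-inverseʳ B {{B≠0}})) (ℚ.*-identityˡ ε))
    where
    B⁺ = ℚ.positive 0<B
    B≠0 = ℚ.pos⇒nonZero B {{B⁺}}
    B⁻¹ = ℚ.1/_ B {{B≠0}}

-- The fixed factor is eventually bounded by some `B`, so a tolerance `δ` with `B δ = ε` on the
-- other factor is enough.
*ᴿ-congˡ : ∀ x {y z} → y ≃ᴿ z → x *ᴿ y ≃ᴿ x *ᴿ z
*ᴿ-congˡ x {y} {z} h ε 0<ε =
  let B , 0<B , M , b = eventually-bounded (seq x) (cauchy x)
      δ , 0<δ , eq    = scaled B ε 0<B 0<ε
      N , p           = h δ 0<δ
  in M ℕ.⊔ N , λ n le → let open ℚ.≤-Reasoning in begin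
    ℚ.∣ seq x n ℚ.* seq y n ℚ.- seq x n ℚ.* seq z n ∣
      ≡⟨ cong ℚ.∣_∣ (solve 3 (λ a b c → a :* b :- a :* c := a :* (b :- c)) ≡.refl (seq x n) (seq y n) (seq z n)) ⟩
    ℚ.∣ seq x n ℚ.* (seq y n ℚ.- seq z n) ∣
      ≡⟨ ℚ.∣p*q∣≡∣p∣*∣q∣ (seq x n) _ ⟩
    ℚ.∣ seq x n ∣ ℚ.* ℚ.∣ seq y n ℚ.- seq z n ∣
      ≤⟨ ℚ.*-monoʳ-≤-nonNeg ℚ.∣ seq y n ℚ.- seq z n ∣ {{ℚ.nonNegative (ℚ.0≤∣p∣ (seq y n ℚ.- seq z n))}}
           (b n (ℕ.m⊔n≤o⇒m≤o M N le)) ⟩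
    B ℚ.* ℚ.∣ seq y n ℚ.- seq z n ∣
      ≤⟨ ℚ.*-monoˡ-≤-nonNeg B {{ℚ.nonNegative (ℚ.<⇒≤ 0<B)}} (p n (ℕ.m⊔n≤o⇒n≤o M N le)) ⟩
    B ℚ.* δ
      ≡⟨ eq ⟩
    ε ∎

*ᴿ-comm : ∀ x y → x *ᴿ y ≃ᴿ y *ᴿ x
*ᴿ-comm x y = pointwise⇒≃ (x *ᴿ y) (y *ᴿ x) λ n → ℚ.*-comm (seq x n) (seq y n)

*ᴿ-cong : ∀ {x y u v} → x ≃ᴿ y → u ≃ᴿ v → x *ᴿ u ≃ᴿ y *ᴿ v
*ᴿ-cong {x} {y} {u} {v} h k = ≃-trans {x *ᴿ u} {x *ᴿ v} {y *ᴿ v} (*ᴿ-congˡ x {u} {v} k)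
  (≃-trans {x *ᴿ v} {v *ᴿ x} {y *ᴿ v} (*ᴿ-comm x v)
    (≃-trans {v *ᴿ x} {v *ᴿ y} {y *ᴿ v} (*ᴿ-congˡ v {x} {y} h) (*ᴿ-comm v y)))

ℝ-commutativeRing : CommutativeRing 0ℓ 0ℓ
ℝ-commutativeRing = record
  { Carrier = ℝ ; _≈_ = _≃ᴿ_ ; _+_ = _+ᴿ_ ; _*_ = _*ᴿ_ ; -_ = -ᴿ_ ; 0# = fromℚ 0ℚ ; 1# = fromℚ 1ℚ
  ; isCommutativeRing = record
    { isRing = record
      { +-isAbelianGroup = record
        { isGroup = record
          { isMonoid = record
            { isSemigroup = record
              { isMagma = record
                { isEquivalence = record
                  { refl = λ {x} → ≃-refl {x} ; sym = λ {x} {y} → ≃-sym {x} {y} ; trans = λ {x} {y} {z} → ≃-trans {x} {y} {z} }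
                ; ∙-cong = λ {x} {y} {u} {v} → +ᴿ-cong {x} {y} {u} {v} }
              ; assoc = λ x y z → pointwise⇒≃ (x +ᴿ y +ᴿ z) (x +ᴿ (y +ᴿ z)) λ n → ℚ.+-assoc (seq x n) (seq y n) (seq z n) }
            ; identity = (λ x → pointwise⇒≃ (fromℚ 0ℚ +ᴿ x) x λ n → ℚ.+-identityˡ (seq x n))
                       , (λ x → pointwise⇒≃ (x +ᴿ fromℚ 0ℚ) x λ n → ℚ.+-identityʳ (seq x n)) }
          ; inverse = (λ x → pointwise⇒≃ (-ᴿ x +ᴿ x) (fromℚ 0ℚ) λ n → ℚ.+-inverseˡ (seq x n))
                    , (λ x → pointwise⇒≃ (x +ᴿ -ᴿ x) (fromℚ 0ℚ) λ n → ℚ.+-inverseʳ (seq x n))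
          ; ⁻¹-cong = λ {x} {y} → -ᴿ-cong {x} {y} }
        ; comm = λ x y → pointwise⇒≃ (x +ᴿ y) (y +ᴿ x) λ n → ℚ.+-comm (seq x n) (seq y n) }
      ; *-cong = λ {x} {y} {u} {v} → *ᴿ-cong {x} {y} {u} {v}
      ; *-assoc = λ x y z → pointwise⇒≃ (x *ᴿ y *ᴿ z) (x *ᴿ (y *ᴿ z)) λ n → ℚ.*-assoc (seq x n) (seq y n) (seq z n)
      ; *-identity = (λ x → pointwise⇒≃ (fromℚ 1ℚ *ᴿ x) x λ n → ℚ.*-identityˡ (seq x n))
                   , (λ x → pointwise⇒≃ (x *ᴿ fromℚ 1ℚ) x λ n → ℚ.*-identityʳ (seq x n))
      ; distrib = (λ x y z → pointwise⇒≃ (x *ᴿ (y +ᴿ z)) (x *ᴿ y +ᴿ x *ᴿ z) λ n → ℚ.*-distribˡ-+ (seq x n) (seq y n) (seq z n))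
                , (λ x y z → pointwise⇒≃ ((y +ᴿ z) *ᴿ x) (y *ᴿ x +ᴿ z *ᴿ x) λ n → ℚ.*-distribʳ-+ (seq x n) (seq y n) (seq z n)) }
    ; *-comm = *ᴿ-comm } }

module ℝᵣ = CommutativeRing ℝ-commutativeRing

pointwiseᶜ : ∀ z w → (∀ n → seq (re z) n ≡ seq (re w) n) → (∀ n → seq (im z) n ≡ seq (im w) n) → z ≈ᶜ w
pointwiseᶜ z w p q = pointwise⇒≃ (re z) (re w) p , pointwise⇒≃ (im z) (im w) q

private
  *ᶜ-identityˡ : ∀ z → 1ᶜ *ᶜ z ≈ᶜ z
  *ᶜ-identityˡ z = pointwiseᶜ (1ᶜ *ᶜ z) z
    (λ n → solve 2 (λ a b → con 1ℚ :* a :+ :- (con 0ℚ :* b) := a) ≡.refl (seq (re z) n) (seq (im z) n))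
    (λ n → solve 2 (λ a b → con 1ℚ :* b :+ con 0ℚ :* a := b) ≡.refl (seq (re z) n) (seq (im z) n))

  *ᶜ-comm : ∀ z w → z *ᶜ w ≈ᶜ w *ᶜ z
  *ᶜ-comm z w = pointwiseᶜ (z *ᶜ w) (w *ᶜ z)
    (λ n → solve 4 (λ a b c d → a :* c :+ :- (b :* d) := c :* a :+ :- (d :* b)) ≡.refl
             (seq (re z) n) (seq (im z) n) (seq (re w) n) (seq (im w) n))
    (λ n → solve 4 (λ a b c d → a :* d :+ b :* c := c :* b :+ d :* a) ≡.refl
             (seq (re z) n) (seq (im z) n) (seq (re w) n) (seq (im w) n))

  *ᶜ-assoc : ∀ z w v → (z *ᶜ w) *ᶜ v ≈ᶜ z *ᶜ (w *ᶜ v)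
  *ᶜ-assoc z w v = pointwiseᶜ ((z *ᶜ w) *ᶜ v) (z *ᶜ (w *ᶜ v))
    (λ n → solve 6 (λ a b c d e f →
        (a :* c :+ :- (b :* d)) :* e :+ :- ((a :* d :+ b :* c) :* f)
          := a :* (c :* e :+ :- (d :* f)) :+ :- (b :* (c :* f :+ d :* e))) ≡.refl
        (seq (re z) n) (seq (im z) n) (seq (re w) n) (seq (im w) n) (seq (re v) n) (seq (im v) n))
    (λ n → solve 6 (λ a b c d e f →
        (a :* c :+ :- (b :* d)) :* f :+ (a :* d :+ b :* c) :* e
          := a :* (c :* f :+ d :* e) :+ b :* (c :* e :+ :- (d :* f))) ≡.refl
        (seq (re z) n) (seq (im z) n) (seq (re w) n) (seq (im w) n) (seq (re v) n) (seq (im v) n))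

  distribˡᶜ : ∀ z w v → z *ᶜ (w +ᶜ v) ≈ᶜ z *ᶜ w +ᶜ z *ᶜ v
  distribˡᶜ z w v = pointwiseᶜ (z *ᶜ (w +ᶜ v)) (z *ᶜ w +ᶜ z *ᶜ v)
    (λ n → solve 6 (λ a b c d e f →
        a :* (c :+ e) :+ :- (b :* (d :+ f)) := (a :* c :+ :- (b :* d)) :+ (a :* e :+ :- (b :* f))) ≡.refl
        (seq (re z) n) (seq (im z) n) (seq (re w) n) (seq (im w) n) (seq (re v) n) (seq (im v) n))
    (λ n → solve 6 (λ a b c d e f →
        a :* (d :+ f) :+ b :* (c :+ e) := (a :* d :+ b :* c) :+ (a :* f :+ b :* e)) ≡.refl
        (seq (re z) n) (seq (im z) n) (seq (re w) n) (seq (im w) n) (seq (re v) n) (seq (im v) n))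

  ≈ᶜ-trans : ∀ {z w v} → z ≈ᶜ w → w ≈ᶜ v → z ≈ᶜ v
  ≈ᶜ-trans {z} {w} {v} (a , b) (c , d) = ℝᵣ.trans {re z} {re w} {re v} a c , ℝᵣ.trans {im z} {im w} {im v} b d

  +ᶜ-cong : ∀ {z w u v} → z ≈ᶜ w → u ≈ᶜ v → z +ᶜ u ≈ᶜ w +ᶜ v
  +ᶜ-cong {z} {w} {u} {v} (a , b) (c , d) =
    ℝᵣ.+-cong {re z} {re w} {re u} {re v} a c , ℝᵣ.+-cong {im z} {im w} {im u} {im v} b d

  *ᶜ-cong : ∀ {z w u v} → z ≈ᶜ w → u ≈ᶜ v → z *ᶜ u ≈ᶜ w *ᶜ v
  *ᶜ-cong {z} {w} {u} {v} (a , b) (c , d) =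
      ℝᵣ.+-cong {re z *ᴿ re u} {re w *ᴿ re v} { -ᴿ (im z *ᴿ im u)} { -ᴿ (im w *ᴿ im v)}
        (*ᴿ-cong {re z} {re w} {re u} {re v} a c)
        (-ᴿ-cong {im z *ᴿ im u} {im w *ᴿ im v} (*ᴿ-cong {im z} {im w} {im u} {im v} b d))
    , ℝᵣ.+-cong {re z *ᴿ im u} {re w *ᴿ im v} {im z *ᴿ re u} {im w *ᴿ re v}
        (*ᴿ-cong {re z} {re w} {im u} {im v} a d) (*ᴿ-cong {im z} {im w} {re u} {re v} b c)

ℂ-commutativeRing : CommutativeRing 0ℓ 0ℓ
ℂ-commutativeRing = record
  { Carrier = ℂ ; _≈_ = _≈ᶜ_ ; _+_ = _+ᶜ_ ; _*_ = _*ᶜ_ ; -_ = -ᶜ_ ; 0# = 0ᶜ ; 1# = 1ᶜ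
  ; isCommutativeRing = record
    { isRing = record
      { +-isAbelianGroup = record
        { isGroup = record
          { isMonoid = record
            { isSemigroup = record
              { isMagma = record
                { isEquivalence = record
                  { refl  = λ {z} → ≃-refl {re z} , ≃-refl {im z}
                  ; sym   = λ {z} {w} (a , b) → ≃-sym {re z} {re w} a , ≃-sym {im z} {im w} b
                  ; trans = λ {z} {w} {v} → ≈ᶜ-trans {z} {w} {v} }
                ; ∙-cong = λ {z} {w} {u} {v} → +ᶜ-cong {z} {w} {u} {v} }
              ; assoc = λ z w v → ℝᵣ.+-assoc (re z) (re w) (re v) , ℝᵣ.+-assoc (im z) (im w) (im v) }
            ; identity = (λ z → ℝᵣ.+-identityˡ (re z) , ℝᵣ.+-identityˡ (im z))
                       , (λ z → ℝᵣ.+-identityʳ (re z) , ℝᵣ.+-identityʳ (im z)) }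
          ; inverse = (λ z → ℝᵣ.-‿inverseˡ (re z) , ℝᵣ.-‿inverseˡ (im z))
                    , (λ z → ℝᵣ.-‿inverseʳ (re z) , ℝᵣ.-‿inverseʳ (im z))
          ; ⁻¹-cong = λ {z} {w} (a , b) → -ᴿ-cong {re z} {re w} a , -ᴿ-cong {im z} {im w} b }
        ; comm = λ z w → ℝᵣ.+-comm (re z) (re w) , ℝᵣ.+-comm (im z) (im w) }
      ; *-cong = λ {z} {w} {u} {v} → *ᶜ-cong {z} {w} {u} {v}
      ; *-assoc = *ᶜ-assoc
      ; *-identity = *ᶜ-identityˡ
                   , λ z → ≈ᶜ-trans {z *ᶜ 1ᶜ} {1ᶜ *ᶜ z} {z} (*ᶜ-comm z 1ᶜ) (*ᶜ-identityˡ z)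
      ; distrib = distribˡᶜ
                , λ z w v → ≈ᶜ-trans {(w +ᶜ v) *ᶜ z} {z *ᶜ (w +ᶜ v)} {w *ᶜ z +ᶜ v *ᶜ z} (*ᶜ-comm (w +ᶜ v) z)
                    (≈ᶜ-trans {z *ᶜ (w +ᶜ v)} {z *ᶜ w +ᶜ z *ᶜ v} {w *ᶜ z +ᶜ v *ᶜ z} (distribˡᶜ z w v)
                      (+ᶜ-cong {z *ᶜ w} {w *ᶜ z} {z *ᶜ v} {v *ᶜ z} (*ᶜ-comm z w) (*ᶜ-comm z v))) }
    ; *-comm = *ᶜ-comm } }

module ℂᵣ = CommutativeRing ℂ-commutativeRing

-- Order on ℚ is decidable: a positive distance `d` between two constant sequences would exceed the
-- tolerance `½ d`.
fromℚ-injective : ∀ {p q} → fromℚ p ≃ᴿ fromℚ q → p ≡ q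
fromℚ-injective {p} {q} h with ℚ.∣ p ℚ.- q ∣ ℚ.≤? 0ℚ
... | yes ≤0 = ≡.trans (solve 2 (λ p q → p := (p :- q) :+ q) ≡.refl p q)
  (≡.trans (cong (ℚ._+ q) (ℚ.∣p∣≡0⇒p≡0 (p ℚ.- q) (ℚ.≤-antisym ≤0 (ℚ.0≤∣p∣ (p ℚ.- q))))) (ℚ.+-identityˡ q))
... | no ≰0 = contradiction (proj₂ (h (½ ℚ.* d) (½-positive 0<d)) _ ℕ.≤-refl) (λ d≤½d → ℚ.<-irrefl ≡.refl (ℚ.<-≤-trans ½d<d d≤½d))
  where
  d = ℚ.∣ p ℚ.- q ∣
  0<d : 0ℚ ℚ.< d
  0<d = ℚ.≰⇒> ≰0
  ½d<d : ½ ℚ.* d ℚ.< d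
  ½d<d = subst (½ ℚ.* d ℚ.<_) (½+½ d)
    (subst (ℚ._< ½ ℚ.* d ℚ.+ ½ ℚ.* d) (ℚ.+-identityʳ (½ ℚ.* d)) (ℚ.+-monoʳ-< (½ ℚ.* d) (½-positive 0<d)))

-- Integers and fourth roots of unity among the real and complex numbers

fromℤ : ℤ → ℚ
fromℤ m = m ℚ./ 1

-- `_/_` reduces its fraction to lowest terms; among unnormalised rationals the denominator is
-- visibly 1, and arithmetic becomes that of the numerators.
toℚᵘ-fromℤ : ∀ m → ℚ.toℚᵘ (fromℤ m) ℚᵘ.≃ ℚᵘ.mkℚᵘ m 0
toℚᵘ-fromℤ m = ℚ.toℚᵘ-fromℚᵘ (ℚᵘ.mkℚᵘ m 0)

fromℤ-+ : ∀ m n → fromℤ (m ℤ.+ n) ≡ fromℤ m ℚ.+ fromℤ n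
fromℤ-+ m n = ℚ.toℚᵘ-injective (begin-equality
  ℚ.toℚᵘ (fromℤ (m ℤ.+ n))                       ≃⟨ toℚᵘ-fromℤ (m ℤ.+ n) ⟩
  ℚᵘ.mkℚᵘ (m ℤ.+ n) 0
    ≃⟨ ℚᵘ.≃-reflexive (cong (λ k → ℚᵘ.mkℚᵘ k 0) (cong₂ ℤ._+_ (≡.sym (ℤ.*-identityʳ m)) (≡.sym (ℤ.*-identityʳ n)))) ⟩
  ℚᵘ.mkℚᵘ m 0 ℚᵘ.+ ℚᵘ.mkℚᵘ n 0                    ≃⟨ ℚᵘ.+-cong (toℚᵘ-fromℤ m) (toℚᵘ-fromℤ n) ⟨
  ℚ.toℚᵘ (fromℤ m) ℚᵘ.+ ℚ.toℚᵘ (fromℤ n)         ≃⟨ ℚ.toℚᵘ-homo-+ (fromℤ m) (fromℤ n) ⟨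
  ℚ.toℚᵘ (fromℤ m ℚ.+ fromℤ n)                   ∎)
  where open ℚᵘ.≤-Reasoning

fromℤ-* : ∀ m n → fromℤ (m ℤ.* n) ≡ fromℤ m ℚ.* fromℤ n
fromℤ-* m n = ℚ.toℚᵘ-injective (begin-equality
  ℚ.toℚᵘ (fromℤ (m ℤ.* n))                       ≃⟨ toℚᵘ-fromℤ (m ℤ.* n) ⟩
  ℚᵘ.mkℚᵘ m 0 ℚᵘ.* ℚᵘ.mkℚᵘ n 0                    ≃⟨ ℚᵘ.*-cong (toℚᵘ-fromℤ m) (toℚᵘ-fromℤ n) ⟨
  ℚ.toℚᵘ (fromℤ m) ℚᵘ.* ℚ.toℚᵘ (fromℤ n)         ≃⟨ ℚ.toℚᵘ-homo-* (fromℤ m) (fromℤ n) ⟨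
  ℚ.toℚᵘ (fromℤ m ℚ.* fromℤ n)                   ∎)
  where open ℚᵘ.≤-Reasoning

open RawSemiringDefinitions (RawRing.rawSemiring ℂ-rawRing) using (product)
open Algebra.Properties.CommutativeMonoid.Sum (CommutativeRing.+-commutativeMonoid ℝ-commutativeRing)
  using () renaming (sum-cong-≋ to sumᴿ-cong)

fromℤ-neg : ∀ m → fromℤ (ℤ.- m) ≡ ℚ.- fromℤ m
fromℤ-neg m = Algebra.Properties.Group.inverseˡ-unique ℚ.+-0-group (fromℤ (ℤ.- m)) (fromℤ m)
  (≡.trans (≡.sym (fromℤ-+ (ℤ.- m) m)) (cong fromℤ (ℤ.+-inverseˡ m)))

fromℤ-injective : ∀ {m n} → fromℤ m ≡ fromℤ n → m ≡ n
fromℤ-injective {m} {n} eq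
  with ℚᵘ.≃-trans (ℚᵘ.≃-sym (toℚᵘ-fromℤ m)) (ℚᵘ.≃-trans (ℚᵘ.≃-reflexive (cong ℚ.toℚᵘ eq)) (toℚᵘ-fromℤ n))
... | ℚᵘ.*≡* m1≡n1 = ≡.trans (≡.sym (ℤ.*-identityʳ m)) (≡.trans m1≡n1 (ℤ.*-identityʳ n))

ℤ⟶ℝ : ℤ.+-*-rawRing -Raw-AlmostCommutative⟶ fromCommutativeRing ℝ-commutativeRing
ℤ⟶ℝ = record
  { ⟦_⟧    = λ m → fromℚ (fromℤ m)
  ; +-homo = λ m n → pointwise⇒≃ (fromℚ (fromℤ (m ℤ.+ n))) (fromℚ (fromℤ m) +ᴿ fromℚ (fromℤ n)) λ _ → fromℤ-+ m n
  ; *-homo = λ m n → pointwise⇒≃ (fromℚ (fromℤ (m ℤ.* n))) (fromℚ (fromℤ m) *ᴿ fromℚ (fromℤ n)) λ _ → fromℤ-* m n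
  ; -‿homo = λ m → pointwise⇒≃ (fromℚ (fromℤ (ℤ.- m))) (-ᴿ fromℚ (fromℤ m)) λ _ → fromℤ-neg m
  ; 0-homo = pointwise⇒≃ (fromℚ (fromℤ 0ℤ)) (fromℚ 0ℚ) λ _ → ≡.refl
  ; 1-homo = pointwise⇒≃ (fromℚ (fromℤ 1ℤ)) (fromℚ 1ℚ) λ _ → ≡.refl
  }

fromℤᶜ : ℤ → ℂ
fromℤᶜ m = fromℝ (fromℚ (fromℤ m))

ℤ⟶ℂ : ℤ.+-*-rawRing -Raw-AlmostCommutative⟶ fromCommutativeRing ℂ-commutativeRing
ℤ⟶ℂ = record
  { ⟦_⟧    = fromℤᶜ
  ; +-homo = λ m n → pointwiseᶜ (fromℤᶜ (m ℤ.+ n)) (fromℤᶜ m +ᶜ fromℤᶜ n) (λ _ → fromℤ-+ m n) (λ _ → ≡.refl)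
  ; *-homo = λ m n → pointwiseᶜ (fromℤᶜ (m ℤ.* n)) (fromℤᶜ m *ᶜ fromℤᶜ n)
      (λ _ → ≡.trans (fromℤ-* m n) (≡.sym (ℚ.+-identityʳ (fromℤ m ℚ.* fromℤ n))))
      (λ _ → solve 2 (λ a b → con 0ℚ := a :* con 0ℚ :+ con 0ℚ :* b) ≡.refl (fromℤ m) (fromℤ n))
  ; -‿homo = λ m → pointwiseᶜ (fromℤᶜ (ℤ.- m)) (-ᶜ fromℤᶜ m) (λ _ → fromℤ-neg m) (λ _ → ≡.refl)
  ; 0-homo = pointwiseᶜ (fromℤᶜ 0ℤ) 0ᶜ (λ _ → ≡.refl) (λ _ → ≡.refl)
  ; 1-homo = pointwiseᶜ (fromℤᶜ 1ℤ) 1ᶜ (λ _ → ≡.refl) (λ _ → ≡.refl)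
  }

-- Both components are multiplied by the rational inverse of `m`, so no inverse of a real or complex
-- number is ever formed.
fromℤᶜ-cancel : ∀ m z → m ≢ 0ℤ → fromℤᶜ m *ᶜ z ≈ᶜ 0ᶜ → z ≈ᶜ 0ᶜ
fromℤᶜ-cancel m z m≢0 (p , q) =
    part (re z) (re (fromℤᶜ m *ᶜ z)) p
      (λ n → solve 3 (λ a x y → a :* x :+ :- (con 0ℚ :* y) := a :* x) ≡.refl (fromℤ m) (seq (re z) n) (seq (im z) n))
  , part (im z) (im (fromℤᶜ m *ᶜ z)) q
      (λ n → solve 3 (λ a x y → a :* y :+ con 0ℚ :* x := a :* y) ≡.refl (fromℤ m) (seq (re z) n) (seq (im z) n))
  where
  instance
    m≠0 : ℚ.NonZero (fromℤ m)
    m≠0 = ℚ.≢-nonZero (m≢0 ∘ fromℤ-injective)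
  m⁻¹ : ℚ
  m⁻¹ = ℚ.1/ fromℤ m
  part : ∀ x y → y ≃ᴿ fromℚ 0ℚ → (∀ n → seq y n ≡ fromℤ m ℚ.* seq x n) → x ≃ᴿ fromℚ 0ℚ
  part x y y≃0 eq = ≃-trans {x} {fromℚ m⁻¹ *ᴿ y} {fromℚ 0ℚ}
    (pointwise⇒≃ x (fromℚ m⁻¹ *ᴿ y) λ n → ≡.sym (≡.trans (cong (m⁻¹ ℚ.*_) (eq n))
      (≡.trans (≡.sym (ℚ.*-assoc m⁻¹ (fromℤ m) (seq x n)))
        (≡.trans (cong (ℚ._* seq x n) (ℚ.*-inverseˡ (fromℤ m))) (ℚ.*-identityˡ (seq x n))))))
    (≃-trans {fromℚ m⁻¹ *ᴿ y} {fromℚ m⁻¹ *ᴿ fromℚ 0ℚ} {fromℚ 0ℚ} (*ᴿ-congˡ (fromℚ m⁻¹) {y} {fromℚ 0ℚ} y≃0)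
      (pointwise⇒≃ (fromℚ m⁻¹ *ᴿ fromℚ 0ℚ) (fromℚ 0ℚ) λ _ → ℚ.*-zeroʳ m⁻¹))

𝕚^ : ℤ₄ → ℂ
𝕚^ 𝟘 = 1ᶜ
𝕚^ 𝟙 = 𝕚
𝕚^ 𝟚 = -ᶜ 1ᶜ
𝕚^ 𝟛 = -ᶜ 𝕚

𝕚^-⊕ : ∀ a b → 𝕚^ (a ⊕ b) ≈ᶜ 𝕚^ a *ᶜ 𝕚^ b
𝕚^-⊕ a b = pointwiseᶜ (𝕚^ (a ⊕ b)) (𝕚^ a *ᶜ 𝕚^ b) (λ n → real n a b) (λ n → imaginary n a b)
  where
  real : ∀ n a b → seq (re (𝕚^ (a ⊕ b))) n ≡ seq (re (𝕚^ a *ᶜ 𝕚^ b)) n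
  real n = ∀ℤ₄ (∀ℤ₄ ≡.refl ≡.refl ≡.refl ≡.refl) (∀ℤ₄ ≡.refl ≡.refl ≡.refl ≡.refl)
    (∀ℤ₄ ≡.refl ≡.refl ≡.refl ≡.refl) (∀ℤ₄ ≡.refl ≡.refl ≡.refl ≡.refl)
  imaginary : ∀ n a b → seq (im (𝕚^ (a ⊕ b))) n ≡ seq (im (𝕚^ a *ᶜ 𝕚^ b)) n
  imaginary n = ∀ℤ₄ (∀ℤ₄ ≡.refl ≡.refl ≡.refl ≡.refl) (∀ℤ₄ ≡.refl ≡.refl ≡.refl ≡.refl)
    (∀ℤ₄ ≡.refl ≡.refl ≡.refl ≡.refl) (∀ℤ₄ ≡.refl ≡.refl ≡.refl ≡.refl)

𝕚^-pair : ∀ a → 𝕚^ a +ᶜ 𝕚^ (⊖ a) ≈ᶜ fromℤᶜ (twiceRe a)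
𝕚^-pair a = pointwiseᶜ (𝕚^ a +ᶜ 𝕚^ (⊖ a)) (fromℤᶜ (twiceRe a))
  (λ n → ∀ℤ₄ {λ a → seq (re (𝕚^ a +ᶜ 𝕚^ (⊖ a))) n ≡ fromℤ (twiceRe a)} ≡.refl ≡.refl ≡.refl ≡.refl a)
  (λ n → ∀ℤ₄ {λ a → seq (im (𝕚^ a +ᶜ 𝕚^ (⊖ a))) n ≡ 0ℚ} ≡.refl ≡.refl ≡.refl ≡.refl a)

open Determinant ℂ-commutativeRing
open Evaluation ℂ-commutativeRing ℤ⟶ℂ 𝕚^ (ℂᵣ.refl {1ᶜ}) 𝕚^-⊕
module ℂPolynomials = Polynomials ℂ-commutativeRing ℤ⟶ℂ
module ℝPolynomials = Polynomials ℝ-commutativeRing ℤ⟶ℝ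
open ℂPolynomials.Interpolation fromℤᶜ-cancel using (module EvenOctic)

-- The record and the statements for an arbitrary dimension prevent Agda from comparing
-- characteristic polynomials of 8 × 8 matrices by expanding the determinants.
record HasSpectrum {d} (A : Matrix d) (ev : Fin d → ℝ) : Set where
  constructor hasSpectrum
  field
    eigenvalues : AreEigenvalues A ev

HasSpectrum-permute : ∀ {d} (A B : Matrix d) ev (π : Permutation′ d) →
  (∀ u v → A (π ⟨$⟩ʳ u) (π ⟨$⟩ʳ v) ≡ B u v) → HasSpectrum A ev → HasSpectrum B ev
HasSpectrum-permute A B ev π eq (hasSpectrum spectrum) = hasSpectrum λ z →
  ℂᵣ.trans {charPoly B z} {charPoly A z} {product (λ k → z +ᶜ -ᶜ fromℝ (ev k))}
    (ℂᵣ.trans {charPoly B z} {charPoly (λ u v → A (π ⟨$⟩ʳ u) (π ⟨$⟩ʳ v)) z} {charPoly A z}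
      (charPoly-cong {A = B} {B = λ u v → A (π ⟨$⟩ʳ u) (π ⟨$⟩ʳ v)} (λ u v → ℂᵣ.reflexive (≡.sym (eq u v))) z)
      (charPoly-permute π A z))
    (spectrum z)

evenOctic-factors : ∀ {d} (s : Vec ℤ₄ 12) (A : Matrices.Matrix (formalRing 12) d) (B : Matrix d) ev →
  (∀ z u v → evaluate s z (A u v) ≈ᶜ B u v) →
  ∀ p → p ≡ Matrices.charPoly (formalRing 12) A formalVariable → CollectsToEvenOctic p →
  HasSpectrum B ev →
  ∃[ c₂ ] ∃[ c₀ ] ℂPolynomials.Factors (evaluateCoefficient s quartic) c₂ c₀ (λ k → fromℝ (ev k))
evenOctic-factors s A B ev A≈B p p≡ collects (hasSpectrum spectrum) =
  let c₂ , c₀ , eq = evenOctic-charPoly s A B A≈B p p≡ collects in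
  c₂ , c₀ , ℂPolynomials.factors λ z → ℂᵣ.trans
    {ℂPolynomials.evenOctic (evaluateCoefficient s quartic) c₂ c₀ (z *ᶜ z)} {charPoly B z}
    {product (λ k → z +ᶜ -ᶜ fromℝ (ev k))}
    (ℂᵣ.sym {charPoly B z} {ℂPolynomials.evenOctic (evaluateCoefficient s quartic) c₂ c₀ (z *ᶜ z)} (eq z)) (spectrum z)

-- Optimum energy implies negative faces

∣p∣*∣p∣≡p*p : ∀ p → ℚ.∣ p ∣ ℚ.* ℚ.∣ p ∣ ≡ p ℚ.* p
∣p∣*∣p∣≡p*p p with ℚ.∣p∣≡p∨∣p∣≡-p p
... | inj₁ eq = cong₂ ℚ._*_ eq eq
... | inj₂ eq = ≡.trans (cong₂ ℚ._*_ eq eq) (solve 1 (λ p → (:- p) :* (:- p) := p :* p) ≡.refl p)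

0≤p*p : ∀ p → 0ℚ ℚ.≤ p ℚ.* p
0≤p*p p = subst (0ℚ ℚ.≤_) (≡.trans (ℚ.∣p*q∣≡∣p∣*∣q∣ p p) (∣p∣*∣p∣≡p*p p)) (ℚ.0≤∣p∣ (p ℚ.* p))

p*p≤q*q⇒∣p∣≤q : ∀ p {q} → 0ℚ ℚ.< q → p ℚ.* p ℚ.≤ q ℚ.* q → ℚ.∣ p ∣ ℚ.≤ q
p*p≤q*q⇒∣p∣≤q p {q} 0<q p²≤q² with ℚ.∣ p ∣ ℚ.≤? q
... | yes ∣p∣≤q = ∣p∣≤q
... | no  ∣p∣≰q = contradiction p²≤q² (λ p²≤q² → ℚ.<-irrefl ≡.refl (ℚ.<-≤-trans q²<p² p²≤q²))
  where
  q<∣p∣ : q ℚ.< ℚ.∣ p ∣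
  q<∣p∣ = ℚ.≰⇒> ∣p∣≰q
  q²<p² : q ℚ.* q ℚ.< p ℚ.* p
  q²<p² = subst (q ℚ.* q ℚ.<_) (∣p∣*∣p∣≡p*p p) (ℚ.<-trans
    (ℚ.*-monoʳ-<-pos q {{ℚ.positive 0<q}} q<∣p∣)
    (ℚ.*-monoˡ-<-pos ℚ.∣ p ∣ {{ℚ.positive (ℚ.<-trans 0<q q<∣p∣)}} q<∣p∣))

summand≤sum : ∀ {d} (f : Fin d → ℝ) n → (∀ k → 0ℚ ℚ.≤ seq (f k) n) → ∀ k → seq (f k) n ℚ.≤ seq (sumᴿ f) n
summand≤sum {suc d} f n f≥0 k = go k
  where
  nonNegative : ∀ {d} (f : Fin d → ℝ) → (∀ k → 0ℚ ℚ.≤ seq (f k) n) → 0ℚ ℚ.≤ seq (sumᴿ f) n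
  nonNegative {zero}  f h = ℚ.≤-refl
  nonNegative {suc d} f h = ℚ.+-mono-≤ (h zero) (nonNegative (f ∘ suc) (h ∘ suc))
  go : ∀ k → seq (f k) n ℚ.≤ seq (sumᴿ f) n
  go zero    = subst (ℚ._≤ seq (sumᴿ f) n) (ℚ.+-identityʳ _)
    (ℚ.+-monoʳ-≤ (seq (f zero) n) (nonNegative (f ∘ suc) (f≥0 ∘ suc)))
  go (suc k) = subst (ℚ._≤ seq (sumᴿ f) n) (ℚ.+-identityˡ _)
    (ℚ.+-mono-≤ (f≥0 zero) (summand≤sum (f ∘ suc) n (f≥0 ∘ suc) k))

-- At every index of the Cauchy sequences each square is at most the sum, so tolerance `ε * ε` for
-- the sum gives tolerance `ε` for each `x k`.
sum-of-squares≃0 : ∀ {d} (x : Fin d → ℝ) → sumᴿ (λ k → x k *ᴿ x k) ≃ᴿ fromℚ 0ℚ → ∀ k → x k ≃ᴿ fromℚ 0ℚ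
sum-of-squares≃0 x Σ≃0 k ε 0<ε
  with Σ≃0 (ε ℚ.* ε) (ℚ.positive⁻¹ _ {{ℚ.pos*pos⇒pos ε {{ℚ.positive 0<ε}} ε {{ℚ.positive 0<ε}}}})
... | N , bound = N , λ n N≤n → subst (ℚ._≤ ε) (cong ℚ.∣_∣ (≡.sym (ℚ.+-identityʳ (seq (x k) n))))
  (p*p≤q*q⇒∣p∣≤q (seq (x k) n) 0<ε (ℚ.≤-trans
    (summand≤sum (λ k → x k *ᴿ x k) n (λ k → 0≤p*p (seq (x k) n)) k)
    (ℚ.≤-trans (p≤∣p∣ _) (subst (λ q → ℚ.∣ q ∣ ℚ.≤ ε ℚ.* ε) (ℚ.+-identityʳ _) (bound n N≤n)))))
  where
  p≤∣p∣ : ∀ p → p ℚ.≤ ℚ.∣ p ∣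
  p≤∣p∣ p with ℚ.∣p∣≡p∨∣p∣≡-p p
  ... | inj₁ eq = ℚ.≤-reflexive (≡.sym eq)
  ... | inj₂ eq with ℚ.≤-total p 0ℚ
  ...   | inj₁ p≤0 = ℚ.≤-trans p≤0 (ℚ.0≤∣p∣ p)
  ...   | inj₂ 0≤p = ℚ.≤-reflexive (≡.sym (ℚ.0≤p⇒∣p∣≡p 0≤p))

module _ (ev : Fin 8 → ℝ) (E r : ℝ)
  (energy : E ≃ᴿ sumᴿ (λ k → ∣ ev k ∣ᴿ)) (r² : r *ᴿ r ≃ᴿ fromℕ 3) (optimum : E ≃ᴿ fromℕ 8 *ᴿ r)
  (sum-squares : sumᴿ (λ k → ev k *ᴿ ev k) ≃ᴿ fromℕ 24)
  where

  private
    x : Fin 8 → ℝ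
    x k = ∣ ev k ∣ᴿ

    x² : ∀ k → x k *ᴿ x k ≃ᴿ ev k *ᴿ ev k
    x² k = pointwise⇒≃ (x k *ᴿ x k) (ev k *ᴿ ev k) λ n → ∣p∣*∣p∣≡p*p (seq (ev k) n)

    deviation : ℝ
    deviation = sumᴿ (λ k → (x k +ᴿ -ᴿ r) *ᴿ (x k +ᴿ -ᴿ r))

    deviation≃0 : deviation ≃ᴿ fromℚ 0ℚ
    deviation≃0 = ℝPolynomials.sum-deviations x r
      (≃-trans {sumᴿ (λ k → x k *ᴿ x k)} {sumᴿ (λ k → ev k *ᴿ ev k)} {fromℕ 24}
        (sumᴿ-cong {8} {λ k → x k *ᴿ x k} {λ k → ev k *ᴿ ev k} x²) sum-squares)
      (≃-trans {sumᴿ x} {E} {fromℕ 8 *ᴿ r} (≃-sym {E} {sumᴿ x} energy) optimum)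
      r²

  -- The squared deviations of the absolute values from `r` sum to 0, so each absolute value equals
  -- `r`; squaring removes the absolute value without deciding a sign.
  eigenvalue-squares : ∀ k → ev k *ᴿ ev k ≃ᴿ fromℕ 3
  eigenvalue-squares k =
    ≃-trans {ev k *ᴿ ev k} {x k *ᴿ x k} {fromℕ 3} (≃-sym {x k *ᴿ x k} {ev k *ᴿ ev k} (x² k))
      (≃-trans {x k *ᴿ x k} {r *ᴿ r} {fromℕ 3} (*ᴿ-cong {x k} {r} {x k} {r} x≃r x≃r) r²)
    where
    x≃r : x k ≃ᴿ r
    x≃r = ≃-trans {x k} {(x k +ᴿ -ᴿ r) +ᴿ r} {r}
      (pointwise⇒≃ (x k) ((x k +ᴿ -ᴿ r) +ᴿ r) λ n →
        solve 2 (λ a b → a := (a :+ :- b) :+ b) ≡.refl (seq (x k) n) (seq r n))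
      (≃-trans {(x k +ᴿ -ᴿ r) +ᴿ r} {fromℚ 0ℚ +ᴿ r} {r}
        (+ᴿ-cong {x k +ᴿ -ᴿ r} {fromℚ 0ℚ} {r} {r}
          (sum-of-squares≃0 (λ k → x k +ᴿ -ᴿ r) deviation≃0 k) (≃-refl {r}))
        (ℝᵣ.+-identityˡ r))

coefficient≈54 : ∀ (c₄ c₂ c₀ : ℂ) (ev : Fin 8 → ℝ) E r →
  ℂPolynomials.Factors c₄ c₂ c₀ (λ k → fromℝ (ev k)) →
  E ≃ᴿ sumᴿ (λ k → ∣ ev k ∣ᴿ) → r *ᴿ r ≃ᴿ fromℕ 3 → E ≃ᴿ fromℕ 8 *ᴿ r → c₄ ≈ᶜ fromℤᶜ (+ 54)
coefficient≈54 c₄ c₂ c₀ ev E r octic energy r² optimum = Spectrum.equal-squares⇒c₄ square≈3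
  where
  module Spectrum = EvenOctic c₄ c₂ c₀ (λ k → fromℝ (ev k)) octic
  square : Fin 8 → ℂ
  square k = fromℝ (ev k) *ᶜ fromℝ (ev k)
  re-square : ∀ k → ev k *ᴿ ev k ≃ᴿ re (square k)
  re-square k = pointwise⇒≃ (ev k *ᴿ ev k) (re (square k)) λ n → ≡.sym (ℚ.+-identityʳ (seq (ev k) n ℚ.* seq (ev k) n))
  sum-squares : sumᴿ (λ k → ev k *ᴿ ev k) ≃ᴿ fromℕ 24
  sum-squares = ≃-trans {sumᴿ (λ k → ev k *ᴿ ev k)} {sumᴿ (λ k → re (square k))} {fromℕ 24}
    (sumᴿ-cong {8} {λ k → ev k *ᴿ ev k} {λ k → re (square k)} re-square) (proj₁ Spectrum.sum-squares)
  square≈3 : ∀ k → square k ≈ᶜ fromℤᶜ (+ 3)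
  square≈3 k =
      ≃-trans {re (square k)} {ev k *ᴿ ev k} {fromℕ 3} (≃-sym {ev k *ᴿ ev k} {re (square k)} (re-square k))
        (eigenvalue-squares ev E r energy r² optimum sum-squares k)
    , pointwise⇒≃ (im (square k)) (fromℚ 0ℚ) λ n →
        solve 1 (λ a → a :* con 0ℚ :+ con 0ℚ :* a := con 0ℚ) ≡.refl (seq (ev k) n)

fromℤᶜ-unique : ∀ z m n → z ≈ᶜ fromℤᶜ m → z ≈ᶜ fromℤᶜ n → m ≡ n
fromℤᶜ-unique z m n (z≃m , _) (z≃n , _) = fromℤ-injective (fromℚ-injective
  (≃-trans {fromℚ (fromℤ m)} {re z} {fromℚ (fromℤ n)} (≃-sym {re z} {fromℚ (fromℤ m)} z≃m) z≃n))

-- The coefficient of `z⁴` is found twice, as an integer from the faces and as 54 from the spectrum.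
-- Injectivity of ℤ into ℂ turns this into an equation of integers, which the finite check settles.
negativeFaces : ∀ (s : Vec ℤ₄ 12) ev E r →
  HasSpectrum (λ u v → value (entry s u v)) ev →
  E ≃ᴿ sumᴿ (λ k → ∣ ev k ∣ᴿ) → r *ᴿ r ≃ᴿ fromℕ 3 → E ≃ᴿ fromℕ 8 *ᴿ r → NegativeFaces s
negativeFaces s ev E r spectrum energy r² optimum =
  let c₂ , c₀ , octic = evenOctic-factors s formalAdjacency (λ u v → value (entry s u v)) ev (evaluate-entry s)
        (proj₁ formalCharPoly) (proj₁ (proj₂ formalCharPoly)) (proj₂ (proj₂ formalCharPoly)) spectrum
  in extremal-fluxes (face₁₂₄₃ · s) (face₁₂₆₅ · s) (face₁₃₇₅ · s) (face₂₄₈₆ · s) (face₃₄₈₇ · s) (face₅₆₈₇ · s)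
       (fromℤᶜ-unique (evaluateCoefficient s quartic) _ (+ 54) (quartic-value s 𝕚^-pair)
         (coefficient≈54 (evaluateCoefficient s quartic) c₂ c₀ ev E r octic energy r² optimum))

-- From edge states back to mixed graphs

relabel : ∀ {V W} → V ↔ W → MixedGraph V → MixedGraph W
relabel f G = record
  { underlying = record
    { adj        = λ u v → adj (underlying G) (from u) (from v)
    ; adj-sym    = λ u v → adj-sym (underlying G) (from u) (from v)
    ; adj-irrefl = λ v → adj-irrefl (underlying G) (from v) }
  ; arc      = λ u v → arc G (from u) (from v)
  ; arc⇒adj  = λ u v → arc⇒adj G (from u) (from v)
  ; arc-asym = λ u v → arc-asym G (from u) (from v) }
  where open Inverse f

relabel-≅ : ∀ {V W} (f : V ↔ W) (G : MixedGraph V) → G ≅ relabel f G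
relabel-≅ f G = record
  { bijection       = f
  ; pres-undirected = λ u v → cong₂ (undirected G) (strictlyInverseʳ u) (strictlyInverseʳ v)
  ; pres-arc        = λ u v → cong₂ (arc G) (strictlyInverseʳ u) (strictlyInverseʳ v) }
  where open Inverse f

endpoints : Fin 12 → Fin 8 × Fin 8
endpoints = lookup (
    (v₁ , v₂) ∷ (v₃ , v₄) ∷ (v₅ , v₆) ∷ (v₇ , v₈) ∷ (v₁ , v₃) ∷ (v₂ , v₄)
  ∷ (v₅ , v₇) ∷ (v₆ , v₈) ∷ (v₁ , v₅) ∷ (v₂ , v₆) ∷ (v₃ , v₇) ∷ (v₄ , v₈) ∷ [])

EdgeSpec : Fin 8 → Fin 8 → Maybe (Fin 12 × Bool) → Set
EdgeSpec u v nothing            = adj cube u v ≡ false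
EdgeSpec u v (just (k , true))  = adj cube u v ≡ true × endpoints k ≡ (u , v)
EdgeSpec u v (just (k , false)) = adj cube u v ≡ true × endpoints k ≡ (v , u)

-- Ties the hand-written table to the cube by checking all 64 pairs.
edgeAt-spec : ∀ u v → EdgeSpec u v (edgeAt u v)
edgeAt-spec = toWitness {a? = Fin.all? λ u → Fin.all? λ v → spec? u v (edgeAt u v)} _
  where
  spec? : ∀ u v e → Dec (EdgeSpec u v e)
  spec? u v nothing            = adj cube u v Bool.≟ false
  spec? u v (just (k , true))  = adj cube u v Bool.≟ true ×-dec Product.≡-dec Fin._≟_ Fin._≟_ (endpoints k) (u , v)
  spec? u v (just (k , false)) = adj cube u v Bool.≟ true ×-dec Product.≡-dec Fin._≟_ Fin._≟_ (endpoints k) (v , u)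

-- Meant for the two directions along an edge, where the absence of both arcs does mean an
-- undirected edge.
edgeState : Bool → Bool → EdgeState
edgeState true  _     = forward
edgeState false true  = backward
edgeState false false = undirectedEdge

state : MixedGraph (Fin 8) → Fin 12 → EdgeState
state G k = let u , v = endpoints k in edgeState (arc G u v) (arc G v u)

phases : MixedGraph (Fin 8) → Vec ℤ₄ 12
phases G = tabulate (phase ∘ state G)

CubeLike : MixedGraph (Fin 8) → Set
CubeLike G = ∀ u v → adj (underlying G) u v ≡ adj cube u v

hermitianAdjacency-phases : ∀ G → CubeLike G → ∀ u v → hermitianAdjacency G u v ≡ value (entry (phases G) u v)
hermitianAdjacency-phases G cubeLike u v = go (edgeAt u v) ≡.refl (edgeAt-spec u v)
  where
  -- The body of `hermitianAdjacency` with its tests turned into arguments, so that they can be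
  -- rewritten one at a time.
  weight : (a x y : Bool) → ℂ
  weight a x y = if a ∧ not (x ∨ y) then 1ᶜ else if x then 𝕚 else if y then -ᶜ 𝕚 else 0ᶜ

  along : ∀ x y → weight true x y ≡ 𝕚^ (phase (edgeState x y))
  along true  _     = ≡.refl
  along false true  = ≡.refl
  along false false = ≡.refl

  -- With arcs both ways, `weight` would give `𝕚` while the reversed edge state gives `-ᶜ 𝕚`;
  -- asymmetry of arcs rules this out.
  against : ∀ x y → (x ≡ true → y ≡ false) → weight true x y ≡ 𝕚^ (⊖ phase (edgeState y x))
  against true  true  asym = contradiction (asym ≡.refl) λ ()
  against true  false _    = ≡.refl
  against false true  _    = ≡.refl
  against false false _    = ≡.refl

  absent : ∀ u v → adj cube u v ≡ false → arc G u v ≡ false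
  absent u v nonadjacent with arc G u v in eq
  ... | false = ≡.refl
  ... | true  = contradiction (≡.trans (≡.sym (arc⇒adj G u v eq)) (≡.trans (cubeLike u v) nonadjacent)) λ ()

  value-entry : ∀ e → edgeAt u v ≡ e → value (entry (phases G) u v) ≡ value (entryOf (phases G) e)
  value-entry _ ≡.refl = ≡.refl

  go : ∀ e → edgeAt u v ≡ e → EdgeSpec u v e → hermitianAdjacency G u v ≡ value (entry (phases G) u v)
  go nothing e≡ nonadjacent = ≡.trans
    (≡.trans (cong₂ (weight (adj (underlying G) u v))
        (absent u v nonadjacent) (absent v u (≡.trans (adj-sym cube v u) nonadjacent)))
      (cong (λ a → weight a false false) (≡.trans (cubeLike u v) nonadjacent)))
    (≡.sym (value-entry nothing e≡))
  go (just (k , true)) e≡ (edge , ends) = ≡.trans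
    (cong (λ a → weight a (arc G u v) (arc G v u)) (≡.trans (cubeLike u v) edge))
    (≡.trans (along (arc G u v) (arc G v u))
      (≡.sym (≡.trans (value-entry _ e≡) (cong 𝕚^
        (≡.trans (Vec.lookup∘tabulate (phase ∘ state G) k)
          (cong (λ (a , b) → phase (edgeState (arc G a b) (arc G b a))) ends))))))
  go (just (k , false)) e≡ (edge , ends) = ≡.trans
    (cong (λ a → weight a (arc G u v) (arc G v u)) (≡.trans (cubeLike u v) edge))
    (≡.trans (against (arc G u v) (arc G v u) (arc-asym G u v))
      (≡.sym (≡.trans (value-entry _ e≡) (cong (𝕚^ ∘ ⊖_)
        (≡.trans (Vec.lookup∘tabulate (phase ∘ state G) k)
          (cong (λ (a , b) → phase (edgeState (arc G a b) (arc G b a))) ends))))))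

switching-equivalent : ∀ {n} (X G : MixedGraph (Fin n)) (ε : Fin n → Bool) (h : Fin n → Fin n → Maybe ℤ₄) →
  (∀ u v → adj (underlying X) u v ≡ adj (underlying G) u v) →
  (∀ u v → hermitianAdjacency X u v ≡ value (h u v)) →
  (∀ u v → hermitianAdjacency G u v ≡ value (switch (ε u) (ε v) (h u v))) →
  SwitchingEquivalent X G
switching-equivalent X G ε h same-adj X≡ G≡ = record
  { same-underlying = same-adj
  ; D          = signDiagonal ε
  ; D⁻¹        = signDiagonal ε
  ; D-diagonal = diagonal-off (λ k → 𝕚^ (sign (ε k)))
  ; D-±1       = λ k → diagonal-±1 k (ε k) ≡.refl
  ; D-inverse  = signDiagonal-involutive ε , signDiagonal-involutive ε
  ; switched   = signDiagonal-conjugate ε h (hermitianAdjacency X) (hermitianAdjacency G) X≡ G≡ }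
  where
  diagonal-±1 : ∀ k b → ε k ≡ b → signDiagonal ε k k ≈ᶜ 1ᶜ ⊎ signDiagonal ε k k ≈ᶜ -ᶜ 1ᶜ
  diagonal-±1 k false eq = inj₁ (ℂᵣ.reflexive (≡.trans (diagonal-on (λ k → 𝕚^ (sign (ε k))) k) (cong (𝕚^ ∘ sign) eq)))
  diagonal-±1 k true  eq = inj₂ (ℂᵣ.reflexive (≡.trans (diagonal-on (λ k → 𝕚^ (sign (ε k))) k) (cong (𝕚^ ∘ sign) eq)))

-- The seven graphs and the conclusion

sevenGraphs : List (MixedGraph (Fin 8))
sevenGraphs = D₂ ∷ H₁ ∷ H₂ ∷ H₃ ∷ H₄ ∷ H₅ ∷ H₆ ∷ []

HasPhases : Vec ℤ₄ 12 → MixedGraph (Fin 8) → Set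
HasPhases t X = CubeLike X × phases X ≡ t

sevenGraphs-phases : Pointwise HasPhases sevenPhases sevenGraphs
sevenGraphs-phases =
    ((λ _ _ → ≡.refl) , ≡.refl)
  ∷ ((λ _ _ → ≡.refl) , ≡.refl)
  ∷ ((λ _ _ → ≡.refl) , ≡.refl)
  ∷ ((λ _ _ → ≡.refl) , ≡.refl)
  ∷ ((λ _ _ → ≡.refl) , ≡.refl)
  ∷ ((λ _ _ → ≡.refl) , ≡.refl)
  ∷ ((λ _ _ → ≡.refl) , ≡.refl) ∷ []

Any-pointwise : ∀ {A B : Set} {R : A → B → Set} {P : A → Set} {Q : B → Set} {xs ys} →
  Pointwise R xs ys → (∀ {x y} → R x y → P x → Q y) → Any P xs → Any Q ys
Any-pointwise (r ∷ _)  f (here p)   = here (f r p)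
Any-pointwise (_ ∷ rs) f (there ps) = there (Any-pointwise rs f ps)

optimum-spectrum : ∀ {n k} (G : MixedGraph (Fin n)) → maxDegree (underlying G) ≡ k → OptimumHermitianEnergy G →
  ∃[ ev ] ∃[ E ] ∃[ r ] (HasSpectrum (hermitianAdjacency G) ev × E ≃ᴿ sumᴿ (λ k → ∣ ev k ∣ᴿ)
    × r *ᴿ r ≃ᴿ fromℕ k × E ≃ᴿ fromℕ n *ᴿ r)
optimum-spectrum G ≡.refl (E , r , (ev , spectrum , energy) , (_ , r²) , optimum) =
  ev , E , r , hasSpectrum spectrum , energy , r² , optimum

regular⇒maxDegree : ∀ {n k} (G : Graph (Fin (suc n))) → Regular k G → maxDegree G ≡ k
regular⇒maxDegree {n} {k} G regular = go n (degree G) regular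
  where
  go : ∀ n (f : Fin (suc n) → ℕ) → (∀ v → f v ≡ k) → Vector.foldr ℕ._⊔_ 0 f ≡ k
  go zero    f eq = ≡.trans (ℕ.⊔-identityʳ (f zero)) (eq zero)
  go (suc n) f eq = ≡.trans (cong₂ ℕ._⊔_ (eq zero) (go n (f ∘ suc) (eq ∘ suc))) (ℕ.⊔-idem k)

-- A vertex corresponds to the binary digits of its index, least significant first.
bits : Fin 8 ↔ Vec Bool 3
bits = mk↔ₛ′ to from
  (λ { (false ∷ false ∷ false ∷ []) → ≡.refl ; (true ∷ false ∷ false ∷ []) → ≡.refl
     ; (false ∷ true ∷ false ∷ []) → ≡.refl ; (true ∷ true ∷ false ∷ []) → ≡.refl
     ; (false ∷ false ∷ true ∷ []) → ≡.refl ; (true ∷ false ∷ true ∷ []) → ≡.refl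
     ; (false ∷ true ∷ true ∷ []) → ≡.refl ; (true ∷ true ∷ true ∷ []) → ≡.refl })
  (toWitness {a? = Fin.all? λ v → from (to v) Fin.≟ v} _)
  where
  to : Fin 8 → Vec Bool 3
  to 0F = false ∷ false ∷ false ∷ []
  to 1F = true  ∷ false ∷ false ∷ []
  to 2F = false ∷ true  ∷ false ∷ []
  to 3F = true  ∷ true  ∷ false ∷ []
  to 4F = false ∷ false ∷ true  ∷ []
  to 5F = true  ∷ false ∷ true  ∷ []
  to 6F = false ∷ true  ∷ true  ∷ []
  to 7F = true  ∷ true  ∷ true  ∷ []
  from : Vec Bool 3 → Fin 8
  from (false ∷ false ∷ false ∷ []) = 0F
  from (true  ∷ false ∷ false ∷ []) = 1F
  from (false ∷ true  ∷ false ∷ []) = 2F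
  from (true  ∷ true  ∷ false ∷ []) = 3F
  from (false ∷ false ∷ true  ∷ []) = 4F
  from (true  ∷ false ∷ true  ∷ []) = 5F
  from (false ∷ true  ∷ true  ∷ []) = 6F
  from (true  ∷ true  ∷ true  ∷ []) = 7F

bits-adj : ∀ u v → adj (hypercube 3) (Inverse.to bits u) (Inverse.to bits v) ≡ adj cube u v
bits-adj = toWitness {a? = Fin.all? λ u → Fin.all? λ v → _ Bool.≟ adj cube u v} _

-- The staged search writes `𝟘` for edges not yet chosen. A face has exponent `𝟘` there, so the face
-- conditions for the full vector fit by computation.
classified : ∀ G → NegativeFaces (phases G) → Classified (phases G)
classified G (p₁ , p₂ , p₃ , p₄ , p₅ , _) = classification-by-faces
  (state G 0F) (state G 5F) (state G 1F) (state G 4F) p₁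
  (state G 8F) (state G 2F) (state G 9F) p₂
  (state G 6F) (state G (suc 9F)) p₃ (state G (suc (suc 9F))) (state G 7F) p₄ (state G 3F) p₅

-- Relabelling along the inverse of `σ` makes the entry at `u`, `v` equal to that of `G` at the
-- images of `u`, `v` under `σ`, which is the form compared in `Switched`.
switched⇒equivalent : ∀ G → CubeLike G → ∀ {σ} → σ ∈ automorphisms → ∀ {t X} → HasPhases t X →
  Switched (phases G) t σ → SwitchingEquivalent X (relabel (Permutation.flip σ) G)
switched⇒equivalent G cubeLike {σ} σ∈ {t} {X} (X-cube , phases≡) switched =
  switching-equivalent X (relabel (Permutation.flip σ) G) (signs (phases G) σ t) (entry t)
    (λ u v → ≡.trans (X-cube u v) (≡.sym (≡.trans (cubeLike (σ ⟨$⟩ʳ u) (σ ⟨$⟩ʳ v))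
      (All.lookup automorphisms-pres-adj σ∈ u v))))
    (λ u v → ≡.trans (hermitianAdjacency-phases X X-cube u v) (cong (λ t → value (entry t u v)) phases≡))
    (λ u v → ≡.trans (hermitianAdjacency-phases G cubeLike (σ ⟨$⟩ʳ u) (σ ⟨$⟩ʳ v)) (cong value (switched u v)))

classify : ∀ G → CubeLike G → NegativeFaces (phases G) →
  ∃[ σ ] Any (λ X → SwitchingEquivalent X (relabel (Permutation.flip σ) G)) sevenGraphs
classify G cubeLike negative =
  -- The search picks the graph first and the automorphism second. Swapping the order fixes `σ`, and
  -- with it the isomorphic copy of `G`, before a graph of the list is chosen.
  let σ , σ∈ , switched = find (Any.swap (classified G negative))
  in σ , Any-pointwise sevenGraphs-phases (switched⇒equivalent G cubeLike σ∈) switched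

theorem3p2 : ∀ {n} (G : MixedGraph (Fin n)) →
    Regular 3 (underlying G) →
    underlying G ≅ᴳ hypercube 3 →
    OptimumHermitianEnergy G →
    ∃[ G′ ] (G ≅ G′ × Any (λ X → SwitchingEquivalent X G′) (D₂ ∷ H₁ ∷ H₂ ∷ H₃ ∷ H₄ ∷ H₅ ∷ H₆ ∷ []))
theorem3p2 {n} G regular iso optimum = go (Permutation.↔⇒≡ f) G regular f f-adj optimum
  where
  open _≅ᴳ_ iso
  f : Fin n ↔ Fin 8
  f = ↔-sym bits ↔-∘ bijection
  f-adj : ∀ u v → adj (underlying G) (Inverse.from f u) (Inverse.from f v) ≡ adj cube u v
  f-adj u v = ≡.trans (≡.sym (pres-adj (Inverse.from f u) (Inverse.from f v)))
    (≡.trans (cong₂ (adj (hypercube 3)) (Inverse.strictlyInverseˡ bijection (Inverse.to bits u))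
        (Inverse.strictlyInverseˡ bijection (Inverse.to bits v)))
      (bits-adj u v))

  -- Cardinality gives `n ≡ 8` only as an equation; `go` generalises over all data depending on `n`
  -- so that it can be matched.
  go : ∀ {n} → n ≡ 8 → (G : MixedGraph (Fin n)) → Regular 3 (underlying G) → (f : Fin n ↔ Fin 8) →
    (∀ u v → adj (underlying G) (Inverse.from f u) (Inverse.from f v) ≡ adj cube u v) →
    OptimumHermitianEnergy G →
    ∃[ G′ ] (G ≅ G′ × Any (λ X → SwitchingEquivalent X G′) sevenGraphs)
  go ≡.refl G regular f cubeLike optimum =
    let ev , E , r , spectrum , energy , r² , E≃8r =
          optimum-spectrum G (regular⇒maxDegree (underlying G) regular) optimum
        G₀ = relabel f G
        σ , switched = classify G₀ cubeLike (negativeFaces (phases G₀) ev E r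
          (HasSpectrum-permute (hermitianAdjacency G) (λ u v → value (entry (phases G₀) u v)) ev
            (Permutation.flip f) (hermitianAdjacency-phases G₀ cubeLike) spectrum)
          energy r² E≃8r)
    -- Relabelling along the composite is, by computation, the relabelling of `G₀` along the inverse
    -- of `σ`, so `switched` applies as it stands.
    in relabel (f ∘ₚ Permutation.flip σ) G , relabel-≅ (f ∘ₚ Permutation.flip σ) G , switched
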